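{- There exists a set $W$ of $23$ Wang tiles such that the tiling problem for finite simply connected regions with the fixed set $W$ is $\mathsf{NP}$-complete.
   Context: A Wang tile is a unit square with each of its four edges (north, south, west, east) assigned a color. Tiles are used only by translation (no rotation or reflection), and each tile of a set may be used an unlimited number of times (including zero). A polyomino is a simply connected shape obtained by gluing finitely many unit squares of the square grid together edge-to-edge. A finite simply connected region (for Wang tiles) is a finite simply connected polyomino region $D$ (i.e. without holes) together with a color assigned to each unit segment of its boundary. A set $W$ of Wang tiles tiles $D$ if every unit square of $D$ can be covered by a translated copy of a tile of $W$ so that any two copies sharing an edge have the same color on that edge, and every tile edge lying on the boundary of $D$ has the color assigned to that boundary segment. For a fixed set $W$ of Wang tiles, the tiling problem for finite simply connected regions with $W$ is the decision problem: given an arbitrary finite simply connected region $D$ (with its boundary colors), can $D$ be tiled with translated copies of tiles from $W$? The set $W$ is not part of the input; the region $D$ is given explicitly, as a list of its unit squares together with the colors of its boundary segments. -}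

module Defs where

open import Data.Bool.Base using (Bool; true; false)
open import Data.Fin.Base using (Fin)
open import Data.Integer.Base using (ℤ; +_; -[1+_]) renaming (suc to sucℤ; pred to predℤ)
open import Data.List.Base using (List; []; _∷_; _++_; map; replicate; length)
open import Data.List.Membership.Propositional using (_∈_; _∉_)
open import Data.List.Relation.Unary.Unique.Propositional using (Unique)
open import Data.Nat.Base using (ℕ; zero; suc; _+_; _*_; _≤_)
open import Data.Nat.Binary.Base using (ℕᵇ; 2[1+_]; 1+[2_]; fromℕ)
open import Data.Product.Base using (Σ; ∃; ∃-syntax; _×_; _,_; proj₁)
open import Data.Vec.Base as Vec using (Vec)
open import Function.Base using (_∘_)
open import Function.Bundles using (_⇔_; _↔_)
open import Relation.Binary.Construct.Closure.ReflexiveTransitive using (Star)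
open import Relation.Binary.PropositionalEquality.Core using (_≡_; _≢_)

------------------------------------------------------------------------
-- Turing machines

data Symbol (A : Set) : Set where
  blank : Symbol A
  bit   : Bool → Symbol A
  mark  : A → Symbol A

data Move : Set where
  left stay right : Move

-- A two-way infinite tape.  `before` lists the cells to the left of the head,
-- nearest first; cells beyond either list are blank.
record Tape (A : Set) : Set where
  constructor tape
  field
    before  : List (Symbol A)
    current : Symbol A
    after   : List (Symbol A)

open Tape public

module _ {A : Set} where

  write : Symbol A → Tape A → Tape A
  write s (tape ls _ rs) = tape ls s rs

  move : Move → Tape A → Tape A
  move left  (tape []       s rs)       = tape [] blank (s ∷ rs)
  move left  (tape (l ∷ ls) s rs)       = tape ls l (s ∷ rs)
  move stay  t                          = t
  move right (tape ls       s [])       = tape (s ∷ ls) blank []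
  move right (tape ls       s (r ∷ rs)) = tape (s ∷ ls) r rs

  emptyTape : Tape A
  emptyTape = tape [] blank []

  inputTape : List Bool → Tape A
  inputTape []       = emptyTape
  inputTape (b ∷ bs) = tape [] (bit b) (map bit bs)

  -- The word starts under the head and is followed by blanks only.
  Holds : Tape A → List Bool → Set
  Holds t w = ∃[ m ] current t ∷ after t ≡ map bit w ++ replicate m blank

Finite : Set → Set
Finite A = ∃[ n ] (A ↔ Fin n)

-- A nondeterministic machine with 1 + extraTapes tapes; `δ` lists the possible
-- actions, and the machine halts when there is none.
record Machine : Set₁ where
  field
    State      : Set
    Mark       : Set
    finState   : Finite State
    finMark    : Finite Mark
    extraTapes : ℕ
    start      : State
    accepting  : State → Bool
    δ          : State → Vec (Symbol Mark) (suc extraTapes) →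
                 List (State × Vec (Symbol Mark × Move) (suc extraTapes))

  Config : Set
  Config = State × Vec (Tape Mark) (suc extraTapes)

  initial : List Bool → Config
  initial x = start , inputTape x Vec.∷ Vec.replicate extraTapes emptyTape

  options : Config → List (State × Vec (Symbol Mark × Move) (suc extraTapes))
  options (q , ts) = δ q (Vec.map current ts)

  act : Symbol Mark × Move → Tape Mark → Tape Mark
  act (s , d) = move d ∘ write s

  successors : Config → List Config
  successors (q , ts) =
    map (λ (q′ , as) → q′ , Vec.zipWith act as ts) (options (q , ts))

  infix 4 _⟶[_]_

  data _⟶[_]_ : Config → ℕ → Config → Set where
    done : ∀ {c} → c ⟶[ zero ] c
    step : ∀ {c c′ c″ t} → c′ ∈ successors c → c′ ⟶[ t ] c″ → c ⟶[ suc t ] c″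

  Halted : Config → Set
  Halted c = options c ≡ []

  Accepting : Config → Set
  Accepting (q , _) = accepting q ≡ true

  Deterministic : Set
  Deterministic = ∀ q as → length (δ q as) ≤ 1

  AcceptsIn : ℕ → List Bool → Set
  AcceptsIn t x = ∃[ c ] (initial x ⟶[ t ] c × Accepting c)

  -- The input is on the first tape, the output on the last one.
  OutputsIn : ℕ → List Bool → List Bool → Set
  OutputsIn t x y =
    ∃[ q ] ∃[ ts ] (initial x ⟶[ t ] (q , ts) × Halted (q , ts) × Holds (Vec.last ts) y)

------------------------------------------------------------------------
-- NP-completeness

-- Coefficients, constant term first.
Polynomial : Set
Polynomial = List ℕ

eval : Polynomial → ℕ → ℕ
eval []      n = 0
eval (a ∷ p) n = a + n * eval p n

Language : Set₁
Language = List Bool → Set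

PolyTime : (List Bool → List Bool) → Set₁
PolyTime f =
  Σ Machine λ M → let open Machine M in
    Deterministic ×
    ∃ λ (p : Polynomial) →
      ∀ x → ∃[ t ] (t ≤ eval p (length x) × OutputsIn t x (f x))

-- The running time on an accepted word is that of a shortest accepting
-- computation.
NP : Language → Set₁
NP L =
  Σ Machine λ M → let open Machine M in
    (∀ x t → AcceptsIn t x → L x) ×
    ∃ λ (p : Polynomial) →
      ∀ x → L x → ∃[ t ] (t ≤ eval p (length x) × AcceptsIn t x)

infix 4 _≤ₚ_

_≤ₚ_ : Language → Language → Set₁
K ≤ₚ L = ∃ λ f → PolyTime f × (∀ x → K x ⇔ L (f x))

NPHard : Language → Set₁
NPHard L = ∀ K → NP K → K ≤ₚ L

NPComplete : Language → Set₁
NPComplete L = NP L × NPHard L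

------------------------------------------------------------------------
-- Polyominoes

data Direction : Set where
  north south west east : Direction

opposite : Direction → Direction
opposite north = south
opposite south = north
opposite west  = east
opposite east  = west

-- A unit square, named by the coordinates of its south-west corner.
Square : Set
Square = ℤ × ℤ

neighbour : Direction → Square → Square
neighbour north (x , y) = x , sucℤ y
neighbour south (x , y) = x , predℤ y
neighbour west  (x , y) = predℤ x , y
neighbour east  (x , y) = sucℤ x , y

Connected : (Square → Set) → Set
Connected P = ∀ {a b} → P a → P b → Star Step a b
  where
  Step : Square → Square → Set
  Step a b = P a × P b × ∃[ d ] b ≡ neighbour d a

-- Absence of holes is edge-connectedness of the complement, that is,
-- connectedness of the complement of the closed region in the plane.
record IsSimplyConnectedPolyomino (squares : List Square) : Set where
  field
    nonEmpty  : squares ≢ []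
    connected : Connected (_∈ squares)
    noHoles   : Connected (_∉ squares)

------------------------------------------------------------------------
-- Regions with coloured boundary, and tilings

Colour : Set
Colour = ℕ

-- A boundary segment is a side of exactly one square of the region, so it is
-- named by that square and the side.
Segment : Set
Segment = Square × Direction

IsBoundary : List Square → Segment → Set
IsBoundary squares (a , d) = a ∈ squares × neighbour d a ∉ squares

record Region : Set where
  constructor region
  field
    squares  : List Square
    boundary : List (Segment × Colour)

record IsSimplyConnectedRegion (D : Region) : Set where
  open Region D
  field
    uniqueSquares : Unique squares
    polyomino     : IsSimplyConnectedPolyomino squares
    uniqueColour  : Unique (map proj₁ boundary)
    coloured      : ∀ s → s ∈ map proj₁ boundary ⇔ IsBoundary squares s

record Tile : Set where
  constructor tile
  field
    northColour southColour westColour eastColour : Colour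

side : Direction → Tile → Colour
side north = Tile.northColour
side south = Tile.southColour
side west  = Tile.westColour
side east  = Tile.eastColour

record IsTiling (W : List Tile) (D : Region) (f : Square → Tile) : Set where
  open Region D
  field
    fromSet         : ∀ {a} → a ∈ squares → f a ∈ W
    matching        : ∀ {a} d → a ∈ squares → neighbour d a ∈ squares →
                      side d (f a) ≡ side (opposite d) (f (neighbour d a))
    matchesBoundary : ∀ {a d c} → ((a , d) , c) ∈ boundary → side d (f a) ≡ c

Tiles : List Tile → Region → Set
Tiles W D = ∃ (IsTiling W D)

------------------------------------------------------------------------
-- Regions as words

-- Each of these encodings is injective and prefix-free.

encodeList : {A : Set} → (A → List Bool) → List A → List Bool
encodeList e []       = false ∷ []
encodeList e (x ∷ xs) = true ∷ e x ++ encodeList e xs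

encodePair : {A B : Set} → (A → List Bool) → (B → List Bool) → A × B → List Bool
encodePair e e′ (x , y) = e x ++ e′ y

-- Bijective base-2 digits, least significant first: true is 2, false is 1.
digits : ℕᵇ → List Bool
digits ℕᵇ.zero  = []
digits 2[1+ n ] = true ∷ digits n
digits 1+[2 n ] = false ∷ digits n

encodeℕ : ℕ → List Bool
encodeℕ = encodeList (λ b → b ∷ []) ∘ digits ∘ fromℕ

encodeℤ : ℤ → List Bool
encodeℤ (+ n)    = false ∷ encodeℕ n
encodeℤ -[1+ n ] = true ∷ encodeℕ n

encodeDirection : Direction → List Bool
encodeDirection north = false ∷ false ∷ []
encodeDirection south = false ∷ true ∷ []
encodeDirection west  = true ∷ false ∷ []
encodeDirection east  = true ∷ true ∷ []

encodeSquare : Square → List Bool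
encodeSquare = encodePair encodeℤ encodeℤ

encodeSegment : Segment → List Bool
encodeSegment = encodePair encodeSquare encodeDirection

encodeRegion : Region → List Bool
encodeRegion (region squares boundary) =
  encodeList encodeSquare squares ++
  encodeList (encodePair encodeSegment encodeℕ) boundary

TilingProblem : List Tile → Language
TilingProblem W w =
  ∃[ D ] (encodeRegion D ≡ w × IsSimplyConnectedRegion D × Tiles W D)

{-# OPTIONS --safe #-}
-- Membership in NP.  A machine guesses a tile for every square, a walk inside
-- the region that meets all its squares, and a walk outside that meets all
-- squares across the boundary; the walks witness that the region and its
-- complement are connected.  Erasing loops, and clamping the outer walk to a box
-- around the region, makes them short.  The guess is checked by a program built
-- from polynomial time combinators on binary trees, which are compiled to stack
-- programs and these to Turing machines.
--
-- Hardness.  The accepting runs of a nondeterministic machine satisfy local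
-- clauses whose variables say which symbol stands at which position relative
-- to the head at which time, so the clauses do not depend on where the head is.
-- The formula becomes a rectangle: the bottom row guesses, for each variable, a
-- pair of neighbouring columns with values x and ¬x.  For each clause a token
-- starts in the first column and steps one column east in every row.  The west
-- colour of a row says whether the value that the token looks at is a literal
-- of the clause, and the token must leave in the east having met a true literal.
-- A last tile whose colour occurs nowhere else brings the number of tiles to 23.

module Submission where

open import Defs
open import Data.Bool.Base as _ using (Bool; true; false; if_then_else_; not; _∧_; _∨_; T)
open import Data.Bool.ListAction as _ using (all; any)
open import Data.Bool.Properties as _ using (∧-assoc; ∧-zeroʳ; ∨-assoc; ∨-identityʳ)
open import Data.Empty as _ using (⊥; ⊥-elim)
open import Data.Fin.Base as _ using (Fin; zero; suc; toℕ; combine)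
open import Data.Fin.Properties as _ using (+↔⊎; combine-injective; toℕ-injective)
open import Data.Integer.Base as _ using (ℤ; -[1+_]) renaming (+_ to pos; suc to sucℤ; pred to predℤ)
import Data.Integer.Base as ℤ using (_+_; -_; _-_; _⊖_)
import Data.Integer.Properties as ℤ using (+-assoc; +-comm; +-identityʳ; +-identityˡ; +-injective; +-inverseʳ; +-inverseˡ; [1+m]⊖[1+n]≡m⊖n; distribʳ-⊖-+-pos; i-j≡0⇒i≡j; m-n≡m⊖n; neg-distrib-+; neg-involutive; n⊖n≡0)
open import Data.List.Base as _ using (List; []; _∷_; _++_; _ʳ++_; map; replicate; length; foldl; foldr; reverse; concat; concatMap; upTo; applyUpTo; allFin; head; cartesianProduct)
open import Data.List.Membership.Propositional as _ using (_∈_; _∉_)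
open import Data.List.Membership.Propositional.Properties as _ using (∈-map⁺; ∈-map⁻; ∈-++⁺ˡ; ∈-++⁺ʳ; ∈-++⁻; ∈-∃++; ∈-upTo⁺; ∈-upTo⁻; ∈-cartesianProduct⁺; ∈-cartesianProduct⁻; ∈-allFin; ∈-concat⁺′; ∈-concat⁻′)
open import Data.List.Properties as _ using (reverse-foldr; length-++; length-map; length-replicate; ++-assoc; ++-identityʳ; reverse-involutive; length-reverse; map-++; map-∘; map-cong; map-id; length-upTo; map-upTo; ∷-injectiveʳ)
open import Data.List.Relation.Binary.Disjoint.Propositional as _ using (Disjoint)
open import Data.List.Relation.Unary.All as _ using (All; []; _∷_)
import Data.List.Relation.Unary.All as All using (lookup; map; tabulate; zipWith)
open import Data.List.Relation.Unary.All.Properties as _ using (¬Any⇒All¬; All¬⇒¬Any)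
open import Data.List.Relation.Unary.AllPairs as _ using ([]; _∷_)
open import Data.List.Relation.Unary.Any as _ using (here; there)
open import Data.List.Relation.Unary.Unique.Propositional as _ using (Unique)
import Data.List.Relation.Unary.Unique.Propositional.Properties as Unique using (++⁺; cartesianProduct⁺; map⁺; upTo⁺)
open import Data.Maybe.Base as _ using (Maybe; just; nothing; maybe′)
open import Data.Nat.Base as _ using (ℕ; zero; suc; pred; _+_; _*_; _∸_; _⊔_; _⊓_; _≤_; _<_; z≤n; s≤s; >-nonZero)
open import Data.Nat.Binary.Base as _ using (ℕᵇ; 2[1+_]; 1+[2_]; fromℕ)
import Data.Nat.Binary.Base as Bin using (zero; suc; pred; double; toℕ)
import Data.Nat.Binary.Properties as Bin using (fromℕ-injective; fromℕ-pred; fromℕ-toℕ; toℕ-fromℕ; fromℕ≡fromℕ')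
open import Data.Nat.Properties as _ using (_≟_; *-distribˡ-+; *-mono-≤; *-monoʳ-≤; *-monoˡ-≤; *-zeroʳ; +-assoc; +-cancelˡ-<; +-cancelˡ-≡; +-comm; +-identityʳ; +-mono-≤; +-monoʳ-≤; +-monoˡ-≤; +-suc; 0≢1+n; <-cmp; <-irrefl; <-trans; <⇒≤; <⇒≱; m+[n∸m]≡n; m∸n+n≡m; m≤m*n; m≤m+n; m≤m⊔n; m≤n+m; m≤n⇒m<n∨m≡n; m≤n⇒m≤1+n; m≤n⇒m⊓n≡m; m≤n⊔m; m≥n⇒m⊓n≡n; m⊓n≤n; n<1+n; n∸n≡0; n≤1+n; pred[m∸n]≡m∸[1+n]; suc-injective; ≤-pred; ≤-refl; ≤-reflexive; ≤-total; ≤-trans; ≤ᵇ⇒≤; ≮⇒≥)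
open import Data.Nat.Tactic.RingSolver as _ using (solve-∀)
open import Data.Product.Base as _ using (Σ; ∃; ∃-syntax; _×_; _,_; proj₁; proj₂)
open import Data.Sum.Base as _ using (_⊎_; inj₁; inj₂)
open import Data.Sum.Function.Propositional as _ using (_⊎-↔_)
open import Data.Unit.Base as _ using (⊤; tt)
open import Data.Vec.Base as _ using (Vec; []; _∷_; lookup; updateAt)
import Data.Vec.Base as Vec using (last; map; replicate; zipWith)
import Data.Vec.Properties as Vec using (lookup-map; lookup-replicate; lookup-zipWith; tabulate-cong; tabulate∘lookup)
open import Data.Vec.Relation.Binary.Pointwise.Inductive as _ using (Pointwise; []; _∷_)
open import Function.Base as _ using (_∘_; id; case_of_)
open import Function.Bundles as _ using (_↔_; mk↔ₛ′; Inverse; _⇔_; mk⇔; module Equivalence)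
open import Function.Properties.Inverse as _ using (↔-sym; ↔-trans; ↔-refl)
open import Relation.Binary.Construct.Closure.ReflexiveTransitive as _ using (Star; ε; _◅_; _◅◅_)
import Relation.Binary.Construct.Closure.ReflexiveTransitive as Star using (reverse)
open import Relation.Binary.Definitions as _ using (tri<; tri≈; tri>)
open import Relation.Binary.PropositionalEquality as _ using (_≡_; _≢_; refl; sym; trans; cong; cong₂; subst; subst₂; module ≡-Reasoning)
open import Relation.Nullary.Decidable.Core as _ using (yes; no)

-- Each combinator keeps, beside a program, a bound on its time and one on the size of its result;
-- the latter is what keeps composition and iteration polynomial. The complement of a region is
-- infinite, and `noHoles` yields paths of unbounded length. The squares across the boundary suffice
-- as a witness because a straight walk through the complement either runs clear of the region or
-- stops at such a square. In the rectangle, the south and west colours of a square leave a choice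
-- of tile only on `guess₁`, so a tiling is a deterministic computation once the bottom row is
-- guessed. A column that holds the token needs one vertical colour for value and token together.
-- This takes 4 tiles that place the token and 8 that let it look; with 4 for guessing, 4 for
-- crossing and 2 for a top row that replaces the values, unknown to the reduction, by one fixed
-- colour, there are 22. The symbols on the tape are controlled only in a window about the head that
-- loses a cell at each end per step, since what a move brings in from outside is arbitrary. A
-- window of `T` cells on both sides lasts for `T` steps.

infixl 6 _⊕_
infixl 7 _⊗_

-- Bounds are kept as syntax, so that sums, products and composition need no computation with
-- coefficients, and monotonicity holds without side conditions because nothing is ever subtracted.
-- `coefficients` produces a coefficient list only at the very end.
data Poly : Set where
  con     : ℕ → Poly
  var     : Poly
  _⊕_ _⊗_ : Poly → Poly → Poly

infix 9 ⟦_⟧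

⟦_⟧ : Poly → ℕ → ℕ
⟦ con k ⟧ n = k
⟦ var ⟧   n = n
⟦ p ⊕ q ⟧ n = ⟦ p ⟧ n + ⟦ q ⟧ n
⟦ p ⊗ q ⟧ n = ⟦ p ⟧ n * ⟦ q ⟧ n

⟦⟧-mono : ∀ p {m n} → m ≤ n → ⟦ p ⟧ m ≤ ⟦ p ⟧ n
⟦⟧-mono (con k) m≤n = ≤-refl
⟦⟧-mono var     m≤n = m≤n
⟦⟧-mono (p ⊕ q) m≤n = +-mono-≤ (⟦⟧-mono p m≤n) (⟦⟧-mono q m≤n)
⟦⟧-mono (p ⊗ q) m≤n = *-mono-≤ (⟦⟧-mono p m≤n) (⟦⟧-mono q m≤n)

infixr 8 _⊙_

_⊙_ : Poly → Poly → Poly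
con k   ⊙ r = con k
var     ⊙ r = r
(p ⊕ q) ⊙ r = p ⊙ r ⊕ q ⊙ r
(p ⊗ q) ⊙ r = (p ⊙ r) ⊗ (q ⊙ r)

⟦⊙⟧ : ∀ p r n → ⟦ p ⊙ r ⟧ n ≡ ⟦ p ⟧ (⟦ r ⟧ n)
⟦⊙⟧ (con k) r n = refl
⟦⊙⟧ var     r n = refl
⟦⊙⟧ (p ⊕ q) r n = cong₂ _+_ (⟦⊙⟧ p r n) (⟦⊙⟧ q r n)
⟦⊙⟧ (p ⊗ q) r n = cong₂ _*_ (⟦⊙⟧ p r n) (⟦⊙⟧ q r n)

⊙-bound : ∀ p r {m n} → m ≤ ⟦ r ⟧ n → ⟦ p ⟧ m ≤ ⟦ p ⊙ r ⟧ n
⊙-bound p r {n = n} h = ≤-trans (⟦⟧-mono p h) (≤-reflexive (sym (⟦⊙⟧ p r n)))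

addPoly : Polynomial → Polynomial → Polynomial
addPoly []      q       = q
addPoly (a ∷ p) []      = a ∷ p
addPoly (a ∷ p) (b ∷ q) = a + b ∷ addPoly p q

scalePoly : ℕ → Polynomial → Polynomial
scalePoly k = map (k *_)

mulPoly : Polynomial → Polynomial → Polynomial
mulPoly []      q = []
mulPoly (a ∷ p) q = addPoly (scalePoly a q) (0 ∷ mulPoly p q)

eval-add : ∀ p q n → eval (addPoly p q) n ≡ eval p n + eval q n
eval-add []      q       n = refl
eval-add (a ∷ p) []      n = sym (+-identityʳ _)
eval-add (a ∷ p) (b ∷ q) n = begin
  a + b + n * eval (addPoly p q) n     ≡⟨ cong (λ e → a + b + n * e) (eval-add p q n) ⟩
  a + b + n * (eval p n + eval q n)    ≡⟨ lemma a b n (eval p n) (eval q n) ⟩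
  a + n * eval p n + (b + n * eval q n) ∎
  where
  open ≡-Reasoning
  lemma : ∀ a b n x y → a + b + n * (x + y) ≡ a + n * x + (b + n * y)
  lemma = solve-∀

eval-scale : ∀ k p n → eval (scalePoly k p) n ≡ k * eval p n
eval-scale k []      n = sym (*-zeroʳ k)
eval-scale k (a ∷ p) n = trans (cong (λ e → k * a + n * e) (eval-scale k p n)) (lemma k a n (eval p n))
  where
  lemma : ∀ k a n x → k * a + n * (k * x) ≡ k * (a + n * x)
  lemma = solve-∀

eval-mul : ∀ p q n → eval (mulPoly p q) n ≡ eval p n * eval q n
eval-mul []      q n = refl
eval-mul (a ∷ p) q n = begin
  eval (addPoly (scalePoly a q) (0 ∷ mulPoly p q)) n   ≡⟨ eval-add (scalePoly a q) _ n ⟩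
  eval (scalePoly a q) n + n * eval (mulPoly p q) n    ≡⟨ cong₂ (λ x y → x + n * y) (eval-scale a q n) (eval-mul p q n) ⟩
  a * eval q n + n * (eval p n * eval q n)             ≡⟨ lemma a n (eval p n) (eval q n) ⟩
  (a + n * eval p n) * eval q n                        ∎
  where
  open ≡-Reasoning
  lemma : ∀ a n x y → a * y + n * (x * y) ≡ (a + n * x) * y
  lemma = solve-∀

coefficients : Poly → Polynomial
coefficients (con k) = k ∷ []
coefficients var     = 0 ∷ 1 ∷ []
coefficients (p ⊕ q) = addPoly (coefficients p) (coefficients q)
coefficients (p ⊗ q) = mulPoly (coefficients p) (coefficients q)

eval-coefficients : ∀ p n → eval (coefficients p) n ≡ ⟦ p ⟧ n
eval-coefficients (con k) n = trans (cong (k +_) (*-zeroʳ n)) (+-identityʳ k)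
eval-coefficients var     n = lemma n
  where
  lemma : ∀ n → n * (1 + n * 0) ≡ n
  lemma = solve-∀
eval-coefficients (p ⊕ q) n =
  trans (eval-add (coefficients p) _ n) (cong₂ _+_ (eval-coefficients p n) (eval-coefficients q n))
eval-coefficients (p ⊗ q) n =
  trans (eval-mul (coefficients p) _ n) (cong₂ _*_ (eval-coefficients p n) (eval-coefficients q n))

-- Stack programs and their execution on a machine with four tapes.

data Sym : Set where
  dat : Bool → Sym
  sep : Sym

embed : Sym → Symbol ⊤
embed (dat b) = bit b
embed sep     = mark tt

scan : Symbol ⊤ → Maybe Sym
scan blank    = nothing
scan (bit b)  = just (dat b)
scan (mark _) = just sep

scan-embed : ∀ s → scan (embed s) ≡ just s
scan-embed (dat b) = refl
scan-embed sep     = refl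

Stack : Set
Stack = List Sym

Store : Set
Store = Vec Stack 4

-- Structured programs on four stacks.  `branch i c` pops stack i and continues
-- with c; `loop i c` pops stack i and runs c until the stack is found empty.
infixr 5 _⨾_

data Prog : Set where
  skip        : Prog
  push        : Fin 4 → Sym → Prog
  _⨾_         : Prog → Prog → Prog
  branch      : Fin 4 → (Maybe Sym → Prog) → Prog
  loop        : Fin 4 → (Sym → Prog) → Prog

-- The numbers count machine steps exactly. A push is one step; a pop takes two, one that moves left
-- onto the top symbol and one that reads and erases it.
data Exec : Prog → Store → ℕ → Store → Set where
  skip      : ∀ {σ} → Exec skip σ 1 σ
  push      : ∀ {i s σ} → Exec (push i s) σ 1 (updateAt σ i (s ∷_))
  _⨾_       : ∀ {p q σ σ′ σ″ m n} → Exec p σ m σ′ → Exec q σ′ n σ″ → Exec (p ⨾ q) σ (m + n) σ″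
  branch[]  : ∀ {i c σ σ′ n} → lookup σ i ≡ [] →
              Exec (c nothing) σ n σ′ → Exec (branch i c) σ (2 + n) σ′
  branch∷   : ∀ {i c σ σ′ n} s {l} → lookup σ i ≡ s ∷ l →
              Exec (c (just s)) (updateAt σ i (λ _ → l)) n σ′ → Exec (branch i c) σ (2 + n) σ′
  loop[]    : ∀ {i c σ} → lookup σ i ≡ [] → Exec (loop i c) σ 2 σ
  loop∷     : ∀ {i c σ σ′ σ″ m n} s {l} → lookup σ i ≡ s ∷ l →
              Exec (c s) (updateAt σ i (λ _ → l)) m σ′ → Exec (loop i c) σ′ n σ″ →
              Exec (loop i c) σ (2 + (m + n)) σ″

Point : Prog → Set
Point skip         = ⊤
Point (push i s)   = ⊤
Point (p ⨾ q)      = Point p ⊎ Point q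
Point (branch i c) = Bool ⊎ Σ (Maybe Sym) λ s → Point (c s)
Point (loop i c)   = Bool ⊎ Σ Sym λ s → Point (c s)

entry : ∀ p → Point p
entry skip         = tt
entry (push i s)   = tt
entry (p ⨾ q)      = inj₁ (entry p)
entry (branch i c) = inj₁ false
entry (loop i c)   = inj₁ false

Actions : Set
Actions = Vec (Symbol ⊤ × Move) 4

keep : ∀ {k} → Vec (Symbol ⊤) k → Vec (Symbol ⊤ × Move) k
keep = Vec.map (_, stay)

only : ∀ {k} → Fin k → Symbol ⊤ × Move → Vec (Symbol ⊤) k → Vec (Symbol ⊤ × Move) k
only i a as = updateAt (keep as) i (λ _ → a)

-- Compilation by continuations: `ι` embeds the points of the subprogram into the states of the
-- whole machine, and `e` is the state to go to afterwards. The body of a loop has the entry of that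
-- loop as its exit.
delta : ∀ p {X : Set} → (Point p → X) → X → Point p → Vec (Symbol ⊤) 4 → X × Actions
delta skip         ι e x           as = e , keep as
delta (push i s)   ι e x           as = e , only i (embed s , right) as
delta (p ⨾ q)      ι e (inj₁ x)    as = delta p (ι ∘ inj₁) (ι (inj₂ (entry q))) x as
delta (p ⨾ q)      ι e (inj₂ x)    as = delta q (ι ∘ inj₂) e x as
delta (branch i c) ι e (inj₁ false) as = ι (inj₁ true) , only i (lookup as i , left) as
delta (branch i c) ι e (inj₁ true) as =
  (let s = scan (lookup as i) in ι (inj₂ (s , entry (c s)))) , only i (blank , stay) as
delta (branch i c) ι e (inj₂ (s , x)) as = delta (c s) (λ y → ι (inj₂ (s , y))) e x as
delta (loop i c)   ι e (inj₁ false) as = ι (inj₁ true) , only i (lookup as i , left) as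
delta (loop i c)   ι e (inj₁ true) as =
  maybe′ (λ s → ι (inj₂ (s , entry (c s)))) e (scan (lookup as i)) , only i (blank , stay) as
delta (loop i c)   ι e (inj₂ (s , x)) as = delta (c s) (λ y → ι (inj₂ (s , y))) (ι (inj₁ false)) x as

-- The head stands on the first free cell, with the top of the stack immediately to its left. The
-- blanks stored on the right are traces of earlier pops, so their number is left open.
Represents : Tape ⊤ → Stack → Set
Represents t l = ∃[ m ] t ≡ tape (map embed l) blank (replicate m blank)

Tapes : Set
Tapes = Vec (Tape ⊤) 4

perform : Symbol ⊤ × Move → Tape ⊤ → Tape ⊤
perform (s , d) = move d ∘ write s

zipWith-keep : ∀ {k} (ts : Vec (Tape ⊤) k) → Vec.zipWith perform (keep (Vec.map current ts)) ts ≡ ts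
zipWith-keep []       = refl
zipWith-keep (t ∷ ts) = cong (t ∷_) (zipWith-keep ts)

zipWith-only : ∀ {k} i a (ts : Vec (Tape ⊤) k) →
               Vec.zipWith perform (only i a (Vec.map current ts)) ts ≡ updateAt ts i (perform a)
zipWith-only zero    a (t ∷ ts) = cong (perform a t ∷_) (zipWith-keep ts)
zipWith-only (suc i) a (t ∷ ts) = cong (t ∷_) (zipWith-only i a ts)

AllRepresent : ∀ {k} → Vec (Tape ⊤) k → Vec Stack k → Set
AllRepresent = Pointwise Represents

update-represents : ∀ {k} i {f} {g : Stack → Stack} {ts : Vec (Tape ⊤) k} {σ} → AllRepresent ts σ →
                    (∀ {t} → Represents t (lookup σ i) → Represents (f t) (g (lookup σ i))) →
                    AllRepresent (updateAt ts i f) (updateAt σ i g)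
update-represents zero    (r ∷ rs) h = h r ∷ rs
update-represents (suc i) (r ∷ rs) h = r ∷ update-represents i rs h

lookup-represents : ∀ {k} i {ts : Vec (Tape ⊤) k} {σ} → AllRepresent ts σ → Represents (lookup ts i) (lookup σ i)
lookup-represents zero    (r ∷ rs) = r
lookup-represents (suc i) (r ∷ rs) = lookup-represents i rs

lookup-current : ∀ {k} i (f : Tape ⊤ → Tape ⊤) ts → lookup {n = k} (Vec.map current (updateAt ts i f)) i ≡ current (f (lookup ts i))
lookup-current zero    f (t ∷ ts) = refl
lookup-current (suc i) f (t ∷ ts) = lookup-current i f ts

updateAt-twice : ∀ {k} {A : Set} i (f g : A → A) (ts : Vec A k) → updateAt (updateAt ts i f) i g ≡ updateAt ts i (g ∘ f)
updateAt-twice zero    f g (t ∷ ts) = refl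
updateAt-twice (suc i) f g (t ∷ ts) = cong (t ∷_) (updateAt-twice i f g ts)

updateAt-same : ∀ {k} {A : Set} i {x : A} (ts : Vec A k) → lookup ts i ≡ x → updateAt ts i (λ _ → x) ≡ ts
updateAt-same zero    (t ∷ ts) refl = refl
updateAt-same (suc i) (t ∷ ts) eq   = cong (t ∷_) (updateAt-same i ts eq)

module Simulation {X : Set} (δ : X → Vec (Symbol ⊤) 4 → List (X × Actions)) where

  Conf : Set
  Conf = X × Tapes

  next : Conf → List Conf
  next (q , ts) = map (λ (q′ , as) → q′ , Vec.zipWith perform as ts) (δ q (Vec.map current ts))

  infix 4 _⇒[_]_

  -- A step is recorded only where the successor is unique. One derivation thus serves twice: as a
  -- run of the machine, and in `forced` as a statement about every accepting run from the same
  -- configuration.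
  data _⇒[_]_ : Conf → ℕ → Conf → Set where
    done : ∀ {c} → c ⇒[ 0 ] c
    step : ∀ {c c′ d n} → next c ≡ c′ ∷ [] → c′ ⇒[ n ] d → c ⇒[ suc n ] d

  ⇒-trans : ∀ {c d e m n} → c ⇒[ m ] d → d ⇒[ n ] e → c ⇒[ m + n ] e
  ⇒-trans done       s = s
  ⇒-trans (step e r) s = step e (⇒-trans r s)

  step-only : ∀ {q q′ i ts f} a → δ q (Vec.map current ts) ≡ (q′ , only i a (Vec.map current ts)) ∷ [] →
              perform a (lookup ts i) ≡ f (lookup ts i) → next (q , ts) ≡ (q′ , updateAt ts i f) ∷ []
  step-only {q} {q′} {i} {ts} {f} a eq h rewrite eq | zipWith-only i a ts =
    cong (λ us → (q′ , us) ∷ []) (same i ts h)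
    where
    same : ∀ {k} i (ts : Vec (Tape ⊤) k) → perform a (lookup ts i) ≡ f (lookup ts i) →
           updateAt ts i (perform a) ≡ updateAt ts i f
    same zero    (t ∷ ts) h = cong (_∷ ts) h
    same (suc i) (t ∷ ts) h = cong (t ∷_) (same i ts h)

  popTape : Tape ⊤ → Tape ⊤
  popTape t = write blank (move left t)

  pop-represents[] : ∀ {t} → Represents t [] → Represents (popTape t) []
  pop-represents[] (m , refl) = suc m , refl

  pop-represents∷ : ∀ {t s l} → Represents t (s ∷ l) → Represents (popTape t) l
  pop-represents∷ (m , refl) = suc m , refl

  current-left : ∀ {t} l → Represents t l → scan (current (move left t)) ≡ head l
  current-left []      (m , refl) = refl
  current-left (s ∷ l) (m , refl) = scan-embed s

  -- Both outcomes of a pop take the same two steps: an empty stack shows itself as a blank to the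
  -- left of the head, which `scan` turns into `nothing`.
  pop-steps : ∀ {q₀ q₁ i} (next′ : Maybe Sym → X) {ts σ l} → AllRepresent ts σ → lookup σ i ≡ l →
              (∀ as → δ q₀ as ≡ (q₁ , only i (lookup as i , left) as) ∷ []) →
              (∀ as → δ q₁ as ≡ (next′ (scan (lookup as i)) , only i (blank , stay) as) ∷ []) →
              (q₀ , ts) ⇒[ 2 ] (next′ (head l) , updateAt ts i popTape)
  pop-steps {i = i} next′ {ts} r refl h₀ h₁ =
    step (step-only {i = i} {ts} {move left} _ (h₀ _) (cong (λ s → move left (write s (lookup ts i))) (look i ts)))
      (step (trans (step-only {i = i} {updateAt ts i (move left)} {write blank} (blank , stay) (h₁ _) refl)
              (cong (_∷ []) (cong₂ _,_
                (cong next′ (trans (cong scan (lookup-current i (move left) ts)) (current-left _ (lookup-represents i r))))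
                (updateAt-twice i (move left) (write blank) ts)))) done)
    where
    look : ∀ {k} i (ts : Vec (Tape ⊤) k) → lookup (Vec.map current ts) i ≡ current (lookup ts i)
    look zero    (t ∷ ts) = refl
    look (suc i) (t ∷ ts) = look i ts

  push-represents : ∀ s {t l} → Represents t l → Represents (perform (embed s , right) t) (s ∷ l)
  push-represents s (zero  , refl) = 0 , refl
  push-represents s (suc m , refl) = m , refl

  -- The hypothesis on `δ` concerns the points of `p` only. The induction can therefore descend into
  -- subprograms, and the result applies to a machine with further states around the program.
  simulate : ∀ p (ι : Point p → X) e → (∀ x as → δ (ι x) as ≡ delta p ι e x as ∷ []) →
             ∀ {σ n σ′} → Exec p σ n σ′ → ∀ {ts} → AllRepresent ts σ →
             ∃[ ts′ ] ((ι (entry p) , ts) ⇒[ n ] (e , ts′) × AllRepresent ts′ σ′)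
  simulate p ι e h {σ} skip {ts} r =
    ts , step (trans (cong (map _) (h tt _)) (cong (λ us → (e , us) ∷ []) (zipWith-keep ts))) done , r
  simulate p ι e h (push {i} {s}) r =
    _ , step (step-only _ (h tt _) refl) done , update-represents i r (push-represents s)
  simulate (p ⨾ q) ι e h (x ⨾ y) r =
    let _ , s₁ , r₁ = simulate p (ι ∘ inj₁) _ (h ∘ inj₁) x r
        _ , s₂ , r₂ = simulate q (ι ∘ inj₂) e (h ∘ inj₂) y r₁
    in _ , ⇒-trans s₁ s₂ , r₂
  simulate (branch i c) ι e h {σ} (branch[] eq x) r =
    let r₁ = subst (AllRepresent _) (updateAt-same i σ eq)
               (update-represents i r λ {t} w → pop-represents[] {t} (subst (Represents t) eq w))
        _ , s₂ , r₂ = simulate (c nothing) (λ y → ι (inj₂ (nothing , y))) e (λ y → h (inj₂ (nothing , y))) x r₁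
    in _ , ⇒-trans (pop-steps (λ s → ι (inj₂ (s , entry (c s)))) r eq (h (inj₁ false)) (h (inj₁ true))) s₂ , r₂
  simulate (branch i c) ι e h (branch∷ s eq x) r =
    let r₁ = update-represents i r λ {t} w → pop-represents∷ {t} (subst (Represents t) eq w)
        _ , s₂ , r₂ = simulate (c (just s)) (λ y → ι (inj₂ (just s , y))) e (λ y → h (inj₂ (just s , y))) x r₁
    in _ , ⇒-trans (pop-steps (λ s → ι (inj₂ (s , entry (c s)))) r eq (h (inj₁ false)) (h (inj₁ true))) s₂ , r₂
  simulate (loop i c) ι e h {σ} (loop[] eq) r =
    _ , pop-steps (maybe′ (λ s → ι (inj₂ (s , entry (c s)))) e) r eq (h (inj₁ false)) (h (inj₁ true)) ,
    subst (AllRepresent _) (updateAt-same i σ eq)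
      (update-represents i r λ {t} w → pop-represents[] {t} (subst (Represents t) eq w))
  simulate (loop i c) ι e h (loop∷ s eq x y) r =
    let r₁ = update-represents i r λ {t} w → pop-represents∷ {t} (subst (Represents t) eq w)
        _ , s₂ , r₂ = simulate (c s) (λ y → ι (inj₂ (s , y))) (ι (inj₁ false)) (λ y → h (inj₂ (s , y))) x r₁
        _ , s₃ , r₃ = simulate (loop i c) ι e h y r₂
    in _ , ⇒-trans (pop-steps (maybe′ (λ s → ι (inj₂ (s , entry (c s)))) e) r eq (h (inj₁ false)) (h (inj₁ true))) (⇒-trans s₂ s₃) , r₃

-- Binary trees on the stacks and the basic operations on them.

data Tree : Set where
  leaf : Tree
  node : Tree → Tree → Tree

size : Tree → ℕ
size leaf       = 1
size (node a b) = suc (size a + size b)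

-- Preorder, one bit per vertex. The code delimits itself, so trees can lie directly on top of each
-- other and the end of a tree is found by counting the subtrees still open.
code : Tree → Stack → Stack
code leaf       s = dat false ∷ s
code (node a b) s = dat true ∷ code a (code b s)

-- `#S` holds the arguments, `#C` is a counter, and trees are parked on `#A` and `#B`. These two are
-- the first and the last tape, hence also the places of the input and the output.
pattern #A = zero
pattern #S = suc zero
pattern #C = suc (suc zero)
pattern #B = suc (suc (suc zero))

Run : Prog → Store → ℕ → Store → Set
Run p σ n σ′ = ∃[ t ] (t ≤ n × Exec p σ t σ′)

weaken : ∀ {p σ m n σ′} → m ≤ n → Run p σ m σ′ → Run p σ n σ′
weaken m≤n (t , t≤m , x) = t , ≤-trans t≤m m≤n , x

infixr 5 _»_

_»_ : ∀ {p q σ σ′ σ″ m n} → Run p σ m σ′ → Run q σ′ n σ″ → Run (p ⨾ q) σ (m + n) σ″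
(t , t≤ , x) » (u , u≤ , y) = t + u , +-mono-≤ t≤ u≤ , x ⨾ y

run-skip : ∀ {σ} → Run skip σ 1 σ
run-skip = 1 , ≤-refl , skip

run-push : ∀ {i s σ} → Run (push i s) σ 1 (updateAt σ i (s ∷_))
run-push = 1 , ≤-refl , push

run-branch∷ : ∀ {i c σ σ′ n} s {l} → lookup σ i ≡ s ∷ l →
              Run (c (just s)) (updateAt σ i (λ _ → l)) n σ′ → Run (branch i c) σ (2 + n) σ′
run-branch∷ s eq (t , t≤ , x) = 2 + t , s≤s (s≤s t≤) , branch∷ s eq x

run-loop∷ : ∀ {i c σ σ′ σ″ m n} s {l} → lookup σ i ≡ s ∷ l →
            Run (c s) (updateAt σ i (λ _ → l)) m σ′ → Run (loop i c) σ′ n σ″ →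
            Run (loop i c) σ (2 + (m + n)) σ″
run-loop∷ s eq (t , t≤ , x) (u , u≤ , y) = 2 + (t + u) , s≤s (s≤s (+-mono-≤ t≤ u≤)) , loop∷ s eq x y

run-loop[] : ∀ {i c σ} → lookup σ i ≡ [] → Run (loop i c) σ 2 σ
run-loop[] eq = 2 , ≤-refl , loop[] eq

copyTo : Bool → Bool → Sym → Prog
copyTo true  true  s = push #A s ⨾ push #B s
copyTo true  false s = push #A s
copyTo false true  s = push #B s
copyTo false false s = skip

addIf : Bool → Sym → Stack → Stack
addIf true  s α = s ∷ α
addIf false s α = α

run-copyTo : ∀ fa fb s {α x c β} →
  Run (copyTo fa fb s) (α ∷ x ∷ c ∷ β ∷ []) 2 (addIf fa s α ∷ x ∷ c ∷ addIf fb s β ∷ [])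
run-copyTo true  true  s = run-push » run-push
run-copyTo true  false s = weaken (s≤s z≤n) run-push
run-copyTo false true  s = weaken (s≤s z≤n) run-push
run-copyTo false false s = weaken (s≤s z≤n) run-skip

consume : Bool → Bool → Maybe Sym → Prog
consume fa fb (just (dat false)) = copyTo fa fb (dat false)
consume fa fb (just (dat true))  = copyTo fa fb (dat true) ⨾ push #C sep ⨾ push #C sep
consume fa fb _                  = skip

-- Stack C counts the trees that remain to be read.
consumeLoop : Bool → Bool → Prog
consumeLoop fa fb = loop #C λ _ → branch #S (consume fa fb)

backwards : Bool → Tree → Stack → Stack
backwards f leaf       α = addIf f (dat false) α
backwards f (node a b) α = backwards f b (backwards f a (addIf f (dat true) α))

backwards-false : ∀ d α → backwards false d α ≡ α
backwards-false leaf       α = refl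
backwards-false (node a b) α = trans (backwards-false b _) (backwards-false a α)

-- A vertex with children trades its counter for two, one per child. The remainder of the loop is a
-- parameter, so that the runs over the two children can be chained. The 8 steps are 2 for the
-- counter, 2 for the bit, 2 for copying and 2 for the new counters.
run-consume : ∀ fa fb d {α s c β n τ} →
  Run (consumeLoop fa fb) (backwards fa d α ∷ s ∷ c ∷ backwards fb d β ∷ []) n τ →
  Run (consumeLoop fa fb) (α ∷ code d s ∷ (sep ∷ c) ∷ β ∷ []) (8 * size d + n) τ
run-consume fa fb leaf r =
  weaken (+-monoˡ-≤ _ (≤ᵇ⇒≤ 6 8 _)) (run-loop∷ sep refl (run-branch∷ _ refl (run-copyTo fa fb _)) r)
run-consume fa fb (node a b) {n = n} r =
  weaken (≤-reflexive (lemma (size a) (size b) n))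
    (run-loop∷ sep refl (run-branch∷ _ refl (run-copyTo fa fb _ » run-push » run-push))
      (run-consume fa fb a (run-consume fa fb b r)))
  where
  lemma : ∀ a b n → 2 + (6 + (8 * a + (8 * b + n))) ≡ 8 * suc (a + b) + n
  lemma = solve-∀

takeTo : Bool → Bool → Prog
takeTo fa fb = copyTo fa fb sep ⨾ push #C sep ⨾ consumeLoop fa fb

-- A parked tree has its bits in reverse order above a `sep`. Moving them back one by one restores
-- the code, and the `sep` ends the move, so that no subtrees have to be counted.
park : Bool → Tree → Stack → Stack
park true  d α = backwards true d (sep ∷ α)
park false d α = α

⟪_,_,_⟫ : Stack → Stack → Stack → Store
⟪ α , s , β ⟫ = α ∷ s ∷ [] ∷ β ∷ []

backwards-park : ∀ f d α → backwards f d (addIf f sep α) ≡ park f d α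
backwards-park true  d α = refl
backwards-park false d α = backwards-false d α

takeCost : Poly
takeCost = con 2 ⊕ (con 1 ⊕ (con 8 ⊗ var ⊕ con 2))

run-takeTo : ∀ fa fb d {α s β} →
  Run (takeTo fa fb) ⟪ α , code d s , β ⟫ (⟦ takeCost ⟧ (size d)) ⟪ park fa d α , s , park fb d β ⟫
run-takeTo fa fb d {α} {s} {β} =
  run-copyTo fa fb sep » run-push » run-consume fa fb d
    (subst (λ σ → Run (consumeLoop fa fb) σ 2 ⟪ park fa d α , s , park fb d β ⟫)
      (sym (cong₂ ⟪_, s ,_⟫ (backwards-park fa d α) (backwards-park fb d β))) (run-loop[] refl))

restore : Maybe Sym → Prog
restore (just (dat b)) = push #S (dat b) ⨾ push #C sep
restore _              = skip

aux : Bool → Fin 4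
aux false = #A
aux true  = #B

restoreLoop : Bool → Prog
restoreLoop i = loop #C λ _ → branch (aux i) restore

run-restoreA : ∀ d {α s c β n τ} →
  Run (restoreLoop false) (α ∷ code d s ∷ (sep ∷ c) ∷ β ∷ []) n τ →
  Run (restoreLoop false) (backwards true d α ∷ s ∷ (sep ∷ c) ∷ β ∷ []) (6 * size d + n) τ
run-restoreA leaf       r = run-loop∷ sep refl (run-branch∷ _ refl (run-push » run-push)) r
run-restoreA (node a b) {n = n} r =
  weaken (≤-reflexive (lemma (size a) (size b) n))
    (run-restoreA b (run-restoreA a (run-loop∷ sep refl (run-branch∷ _ refl (run-push » run-push)) r)))
  where
  lemma : ∀ a b n → 6 * b + (6 * a + (6 + n)) ≡ 6 * suc (a + b) + n
  lemma = solve-∀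

run-restoreB : ∀ d {α s c β n τ} →
  Run (restoreLoop true) (α ∷ code d s ∷ (sep ∷ c) ∷ β ∷ []) n τ →
  Run (restoreLoop true) (α ∷ s ∷ (sep ∷ c) ∷ backwards true d β ∷ []) (6 * size d + n) τ
run-restoreB leaf       r = run-loop∷ sep refl (run-branch∷ _ refl (run-push » run-push)) r
run-restoreB (node a b) {n = n} r =
  weaken (≤-reflexive (lemma (size a) (size b) n))
    (run-restoreB b (run-restoreB a (run-loop∷ sep refl (run-branch∷ _ refl (run-push » run-push)) r)))
  where
  lemma : ∀ a b n → 6 * b + (6 * a + (6 + n)) ≡ 6 * suc (a + b) + n
  lemma = solve-∀

putBack : Bool → Prog
putBack i = push #C sep ⨾ restoreLoop i

putCost : Poly
putCost = con 1 ⊕ (con 6 ⊗ var ⊕ con 7)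

run-putA : ∀ d {α s β} → Run (putBack false) ⟪ park true d α , s , β ⟫ (⟦ putCost ⟧ (size d)) ⟪ α , code d s , β ⟫
run-putA d = run-push » run-restoreA d (run-loop∷ sep refl (run-branch∷ sep refl run-skip) (run-loop[] refl))

run-putB : ∀ d {α s β} → Run (putBack true) ⟪ α , s , park true d β ⟫ (⟦ putCost ⟧ (size d)) ⟪ α , code d s , β ⟫
run-putB d = run-push » run-restoreB d (run-loop∷ sep refl (run-branch∷ sep refl run-skip) (run-loop[] refl))

-- `swap` parks the two trees on different stacks, which can be emptied in either order. `uncons`
-- only removes the root bit: the codes of the children then lie on the stack as two separate trees.
dup drop swap uncons : Prog
dup    = takeTo true true ⨾ putBack false ⨾ putBack true
drop   = takeTo false false
swap   = takeTo true false ⨾ takeTo false true ⨾ putBack false ⨾ putBack true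
uncons = branch #S λ _ → skip

dupCost : Poly
dupCost = takeCost ⊕ (putCost ⊕ putCost)

run-dup : ∀ d {α s β} → Run dup ⟪ α , code d s , β ⟫ (⟦ dupCost ⟧ (size d)) ⟪ α , code d (code d s) , β ⟫
run-dup d = run-takeTo true true d » run-putA d » run-putB d

run-drop : ∀ d {α s β} → Run drop ⟪ α , code d s , β ⟫ (⟦ takeCost ⟧ (size d)) ⟪ α , s , β ⟫
run-drop d = run-takeTo false false d

swapCost : Poly → Poly → Poly
swapCost p q = takeCost ⊙ p ⊕ (takeCost ⊙ q ⊕ (putCost ⊙ p ⊕ putCost ⊙ q))

run-swap : ∀ d e {α s β n} p q → size d ≤ ⟦ p ⟧ n → size e ≤ ⟦ q ⟧ n →
  Run swap ⟪ α , code d (code e s) , β ⟫ (⟦ swapCost p q ⟧ n) ⟪ α , code e (code d s) , β ⟫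
run-swap d e p q h k =
  weaken (⊙-bound takeCost p h) (run-takeTo true false d) »
  weaken (⊙-bound takeCost q k) (run-takeTo false true e) »
  weaken (⊙-bound putCost p h) (run-putA d) »
  weaken (⊙-bound putCost q k) (run-putB e)

run-uncons : ∀ d e {α s β} → Run uncons ⟪ α , code (node d e) s , β ⟫ 3 ⟪ α , code d (code e s) , β ⟫
run-uncons d e = run-branch∷ _ refl run-skip

-- Polynomial-time functions on encoded data.

record Code (A : Set) : Set where
  no-eta-equality
  field enc : A → Tree

open Code {{...}}

instance
  code-Tree : Code Tree
  code-Tree .enc d = d

  code-⊤ : Code ⊤
  code-⊤ .enc _ = leaf

  code-Bool : Code Bool
  code-Bool .enc false = leaf
  code-Bool .enc true  = node leaf leaf

  code-× : ∀ {A B} {{_ : Code A}} {{_ : Code B}} → Code (A × B)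
  code-× .enc (a , b) = node (enc a) (enc b)

encList : ∀ {A} {{_ : Code A}} → List A → Tree
encList []       = leaf
encList (x ∷ xs) = node (enc x) (encList xs)

-- Unary, and the same tree as the code of a list of units, so that arithmetic can be done with list
-- operations. Numbers that have to be short are of type `ℕᵇ`.
encℕ : ℕ → Tree
encℕ zero    = leaf
encℕ (suc n) = node leaf (encℕ n)

instance
  code-List : ∀ {A} {{_ : Code A}} → Code (List A)
  code-List .enc = encList

  code-ℕ : Code ℕ
  code-ℕ .enc = encℕ

⌈_⌉ : ∀ {A} {{_ : Code A}} → A → ℕ
⌈ a ⌉ = size (enc a)

size-Bool : ∀ (b : Bool) → ⌈ b ⌉ ≤ 3
size-Bool false = s≤s z≤n
size-Bool true  = ≤-refl

-- `growth` is what makes composition work: the time of the second function is measured in the size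
-- of the first result. In `runs` all that lies below the argument, and on the stacks `#A` and `#B`,
-- survives, so combinators may keep values there during a call.
record PT {A B : Set} {{ca : Code A}} {{cb : Code B}} (f : A → B) : Set where
  no-eta-equality
  field
    prog    : Prog
    cost    : Poly
    growth  : Poly
    bounded : ∀ a → ⌈ f a ⌉ ≤ ⟦ growth ⟧ ⌈ a ⌉
    runs    : ∀ a {α s β} →
              Run prog ⟪ α , code (enc a) s , β ⟫ (⟦ cost ⟧ ⌈ a ⌉) ⟪ α , code (enc (f a)) s , β ⟫

open PT

pushTree : Tree → Prog
pushTree leaf       = push #S (dat false)
pushTree (node x y) = pushTree y ⨾ pushTree x ⨾ push #S (dat true)

run-pushTree : ∀ d {α s β} → Run (pushTree d) ⟪ α , s , β ⟫ (size d) ⟪ α , code d s , β ⟫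
run-pushTree leaf       = run-push
run-pushTree (node x y) =
  weaken (≤-reflexive (lemma (size x) (size y))) (run-pushTree y » run-pushTree x » run-push)
  where
  lemma : ∀ x y → y + (x + 1) ≡ suc (x + y)
  lemma = solve-∀

module _ {A B : Set} {{_ : Code A}} {{_ : Code B}} where

  infixr 4 _≗⇒_

  -- The combinators dictate the form of the function they compute. This carries the program over to
  -- a function in its natural form, in particular from a fold to a definition by recursion.
  _≗⇒_ : {f g : A → B} → (∀ a → f a ≡ g a) → PT f → PT g
  (h ≗⇒ p) .prog      = prog p
  (h ≗⇒ p) .cost      = cost p
  (h ≗⇒ p) .growth    = growth p
  (h ≗⇒ p) .bounded a = subst (λ b → ⌈ b ⌉ ≤ _) (h a) (bounded p a)
  (h ≗⇒ p) .runs a {α} {s} {β} =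
    subst (λ b → Run _ _ _ ⟪ α , code (enc b) s , β ⟫) (h a) (runs p a)

  recode : {f : A → B} → (∀ a → enc (f a) ≡ enc a) → PT f
  recode h .prog      = skip
  recode h .cost      = con 1
  recode h .growth    = var
  recode h .bounded a = ≤-reflexive (cong size (h a))
  recode h .runs a {α} {s} {β} =
    subst (λ b → Run skip ⟪ α , code (enc a) s , β ⟫ 1 ⟪ α , code b s , β ⟫) (sym (h a)) run-skip

  const′ : (b : B) → PT (λ (_ : A) → b)
  const′ b .prog      = drop ⨾ pushTree (enc b)
  const′ b .cost      = takeCost ⊕ con (size (enc b))
  const′ b .growth    = con ⌈ b ⌉
  const′ b .bounded a = ≤-refl
  const′ b .runs a    = run-drop (enc a) » run-pushTree (enc b)

id′ : ∀ {A} {{_ : Code A}} → PT (λ (a : A) → a)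
id′ = recode λ _ → refl

module _ {A B C : Set} {{_ : Code A}} {{_ : Code B}} {{_ : Code C}} where

  infixr 9 _∙_
  infixr 4 _▵_

  _∙_ : {g : B → C} {f : A → B} → PT g → PT f → PT (λ a → g (f a))
  (q ∙ p) .prog      = prog p ⨾ prog q
  (q ∙ p) .cost      = cost p ⊕ cost q ⊙ growth p
  (q ∙ p) .growth    = growth q ⊙ growth p
  (q ∙ p) .bounded a = ≤-trans (bounded q _) (⊙-bound (growth q) (growth p) (bounded p a))
  (q ∙ p) .runs a    = runs p a » weaken (⊙-bound (cost q) (growth p) (bounded p a)) (runs q _)

  _▵_ : {f : A → B} {g : A → C} → PT f → PT g → PT (λ a → f a , g a)
  -- The second component is computed first, so that in the end the first one lies on top and a
  -- single root bit makes the two a pair.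
  (p ▵ q) .prog      = dup ⨾ prog q ⨾ swap ⨾ prog p ⨾ push #S (dat true)
  (p ▵ q) .cost      = dupCost ⊕ (cost q ⊕ (swapCost (growth q) var ⊕ (cost p ⊕ con 1)))
  (p ▵ q) .growth    = con 1 ⊕ (growth p ⊕ growth q)
  (p ▵ q) .bounded a = s≤s (+-mono-≤ (bounded p a) (bounded q a))
  _▵_ {f} {g} p q .runs a = run-dup (enc a) » runs q a »
    run-swap (enc (g a)) (enc a) (growth q) var (bounded q a) ≤-refl » runs p a » run-push

module _ {A B : Set} {{_ : Code A}} {{_ : Code B}} where

  fst : PT (λ (p : A × B) → proj₁ p)
  fst .prog   = uncons ⨾ swap ⨾ drop
  fst .cost   = con 3 ⊕ (swapCost var var ⊕ takeCost)
  fst .growth = var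
  fst .bounded (a , b) = m≤n⇒m≤1+n (m≤m+n _ _)
  fst .runs (a , b) =
    let l = m≤n⇒m≤1+n (m≤m+n ⌈ a ⌉ ⌈ b ⌉) ; r = m≤n⇒m≤1+n (m≤n+m ⌈ b ⌉ ⌈ a ⌉) in
    run-uncons (enc a) (enc b) » run-swap (enc a) (enc b) var var l r » weaken (⟦⟧-mono takeCost r) (run-drop (enc b))

  snd : PT (λ (p : A × B) → proj₂ p)
  snd .prog   = uncons ⨾ drop
  snd .cost   = con 3 ⊕ takeCost
  snd .growth = var
  snd .bounded (a , b) = m≤n⇒m≤1+n (m≤n+m _ _)
  snd .runs (a , b) =
    run-uncons (enc a) (enc b) » weaken (⟦⟧-mono takeCost (m≤n⇒m≤1+n (m≤m+n ⌈ a ⌉ ⌈ b ⌉))) (run-drop (enc a))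

-- A type whose codes are told apart by their root.
record View (A X Y : Set) {{_ : Code A}} {{_ : Code X}} {{_ : Code Y}} : Set where
  field
    view     : A → Maybe (X × Y)
    enc-view : ∀ a → enc a ≡ maybe′ enc leaf (view a)

open View {{...}}

instance
  view-Bool : View Bool ⊤ ⊤
  view-Bool .view false = nothing
  view-Bool .view true  = just _
  view-Bool .enc-view false = refl
  view-Bool .enc-view true  = refl

  view-ℕ : View ℕ ⊤ ℕ
  view-ℕ .view zero    = nothing
  view-ℕ .view (suc n) = just (_ , n)
  view-ℕ .enc-view zero    = refl
  view-ℕ .enc-view (suc n) = refl

  view-List : ∀ {A} {{_ : Code A}} → View (List A) A (List A)
  view-List .view []       = nothing
  view-List .view (x ∷ xs) = just (x , xs)
  view-List .enc-view []       = refl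
  view-List .enc-view (x ∷ xs) = refl

  view-Tree : View Tree Tree Tree
  view-Tree .view leaf       = nothing
  view-Tree .view (node x y) = just (x , y)
  view-Tree .enc-view leaf       = refl
  view-Tree .enc-view (node x y) = refl

module _ {E A X Y B : Set} {{_ : Code E}} {{_ : Code A}} {{_ : Code X}} {{_ : Code Y}} {{_ : Code B}}
         {{v : View A X Y}} where

  arms : {f : E → B} {g : E × X × Y → B} → PT f → PT g → Maybe Sym → Prog
  -- The bit that the branch has popped is put back to make the children one tree. This is exchanged
  -- with the environment `e` below it, and another root bit forms the argument of `q`.
  arms p q (just (dat true)) = push #S (dat true) ⨾ swap ⨾ push #S (dat true) ⨾ prog q
  arms p q _                 = prog p

  armsCost : {f : E → B} {g : E × X × Y → B} → PT f → PT g → Poly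
  armsCost p q = con 2 ⊕ (cost p ⊕ (con 1 ⊕ (swapCost var var ⊕ (con 1 ⊕ cost q))))

  run-arms : {f : E → B} {g : E × X × Y → B} (p : PT f) (q : PT g) → ∀ (e : E) (a : A) w → enc a ≡ maybe′ enc leaf w →
             ∀ {α s β} → Run (branch #S (arms p q)) ⟪ α , code (enc a) (code (enc e) s) , β ⟫
                             (⟦ armsCost p q ⟧ ⌈ e , a ⌉)
                             ⟪ α , code (enc (maybe′ (λ xy → g (e , xy)) (f e) w)) s , β ⟫
  run-arms p q e a nothing eq rewrite eq =
    run-branch∷ _ refl (weaken (≤-trans (⟦⟧-mono (cost p) (m≤n⇒m≤1+n (m≤m+n _ _))) (m≤m+n _ _)) (runs p e))
  run-arms p q e a (just xy) eq rewrite eq =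
    run-branch∷ _ refl (weaken (m≤n+m _ _)
      (run-push » run-swap (enc xy) (enc e) var var (m≤n⇒m≤1+n (m≤n+m _ _)) (m≤n⇒m≤1+n (m≤m+n _ _)) »
       run-push » runs q _))

  case′ : {f : E → B} {g : E × X × Y → B} → PT f → PT g →
          PT (λ (p : E × A) → maybe′ (λ xy → g (proj₁ p , xy)) (f (proj₁ p)) (view (proj₂ p)))
  case′ p q .prog = uncons ⨾ swap ⨾ branch #S (arms p q)
  case′ p q .cost = con 3 ⊕ (swapCost var var ⊕ armsCost p q)
  case′ p q .growth = growth p ⊕ growth q
  case′ p q .bounded (e , a) with view {{r = v}} a | enc-view {{r = v}} a
  ... | nothing | eq = ≤-trans (bounded p e) (≤-trans (⟦⟧-mono (growth p) (m≤n⇒m≤1+n (m≤m+n _ _))) (m≤m+n _ _))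
  ... | just xy | eq rewrite eq = ≤-trans (bounded q _) (m≤n+m _ _)
  case′ p q .runs (e , a) =
    run-uncons (enc e) (enc a) »
    run-swap (enc e) (enc a) var var (m≤n⇒m≤1+n (m≤m+n _ _)) (m≤n⇒m≤1+n (m≤n+m _ _)) »
    run-arms p q e a (view {{r = v}} a) (enc-view {{r = v}} a)

module _ {E A B : Set} {{_ : Code E}} {{_ : Code A}} {{_ : Code B}} where

  module Fold (s : E × B × A → B) (p : PT s) where

    -- Between the rounds the environment stays parked on `#A`; parking it on both `#A` and `#B`
    -- makes the copy for the call. The rest of the list waits on `#B`. The counter is renewed only
    -- after the call, so `#C` is empty while `p` runs, as `runs` demands.
    body : Maybe Sym → Prog
    body (just (dat true)) =
      takeTo true false ⨾ takeTo false true ⨾ putBack false ⨾ swap ⨾ push #S (dat true) ⨾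
      putBack false ⨾ takeTo true true ⨾ putBack true ⨾ push #S (dat true) ⨾ prog p ⨾
      putBack true ⨾ push #C sep
    body _ = skip

    foldProg : Prog
    foldProg = uncons ⨾ takeTo true false ⨾ uncons ⨾ swap ⨾ push #C sep ⨾
               loop #C (λ _ → branch #S body) ⨾ putBack false ⨾ drop

    argument : Poly → Poly
    argument q = con 1 ⊕ (var ⊕ (con 1 ⊕ (q ⊕ var)))

    bodyCost : Poly → Poly
    bodyCost q = takeCost ⊕ (takeCost ⊕ (putCost ⊕ (swapCost var q ⊕ (con 1 ⊕ (putCost ⊕ (takeCost ⊕
      (putCost ⊕ (con 1 ⊕ (cost p ⊙ argument q ⊕ (putCost ⊕ con 1))))))))))

    foldCost : Poly → Poly
    foldCost q = con 3 ⊕ (takeCost ⊕ (con 3 ⊕ (swapCost var var ⊕ (con 1 ⊕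
      (var ⊗ (con 4 ⊕ bodyCost q) ⊕ con 7 ⊕ (putCost ⊕ takeCost))))))

    module _ (e : E) {n} (q : Poly) (e≤ : ⌈ e ⌉ ≤ n) where

      Bounded : B → List A → Set
      Bounded z xs = ∀ ys zs → ys ++ zs ≡ xs → ⌈ foldl (λ b a → s (e , b , a)) z ys ⌉ ≤ ⟦ q ⟧ n

      run-body : ∀ z x (xs : List A) → ⌈ x ∷ xs ⌉ ≤ n → ⌈ z ⌉ ≤ ⟦ q ⟧ n → ∀ {α σ β} →
        Run (body (just (dat true)))
          ⟪ park true (enc e) α , code (enc x) (code (enc xs) (code (enc z) σ)) , β ⟫
          (⟦ bodyCost q ⟧ n)
          (park true (enc e) α ∷ code (enc xs) (code (enc (s (e , z , x))) σ) ∷ (sep ∷ []) ∷ β ∷ [])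
      run-body z x xs xxs≤ z≤ =
        w takeCost x≤ (run-takeTo true false (enc x)) »
        w takeCost xs≤ (run-takeTo false true (enc xs)) »
        w putCost x≤ (run-putA (enc x)) »
        run-swap (enc x) (enc z) var q x≤ z≤ » run-push »
        w putCost e≤ (run-putA (enc e)) »
        w takeCost e≤ (run-takeTo true true (enc e)) »
        w putCost e≤ (run-putB (enc e)) » run-push »
        weaken (⊙-bound (cost p) (argument q) (s≤s (+-mono-≤ e≤ (s≤s (+-mono-≤ z≤ x≤))))) (runs p (e , z , x)) »
        w putCost xs≤ (run-putB (enc xs)) » run-push
        where
        w : ∀ (c : Poly) {m pr σ σ′} → m ≤ n → Run pr σ (⟦ c ⟧ m) σ′ → Run pr σ (⟦ c ⟧ n) σ′
        w c h = weaken (⟦⟧-mono c h)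
        x≤ : ⌈ x ⌉ ≤ n
        x≤ = ≤-trans (m≤n⇒m≤1+n (m≤m+n _ _)) xxs≤
        xs≤ : ⌈ xs ⌉ ≤ n
        xs≤ = ≤-trans (m≤n⇒m≤1+n (m≤n+m _ _)) xxs≤

      run-fold : ∀ xs z → ⌈ xs ⌉ ≤ n → Bounded z xs → ∀ {α σ β} →
        Run (loop #C (λ _ → branch #S body))
          (park true (enc e) α ∷ code (enc xs) (code (enc z) σ) ∷ (sep ∷ []) ∷ β ∷ [])
          (⌈ xs ⌉ * (4 + ⟦ bodyCost q ⟧ n) + 7)
          ⟪ park true (enc e) α , code (enc (foldl (λ b a → s (e , b , a)) z xs)) σ , β ⟫
      run-fold [] z xs≤ h =
        weaken (m≤n+m 7 (1 * (4 + ⟦ bodyCost q ⟧ n))) (run-loop∷ sep refl (run-branch∷ _ refl run-skip) (run-loop[] refl))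
      run-fold (x ∷ xs) z xs≤ h =
        weaken (≤-trans (m≤n+m _ (⌈ x ⌉ * (4 + ⟦ bodyCost q ⟧ n))) (≤-reflexive (lemma ⌈ x ⌉ ⌈ xs ⌉ (⟦ bodyCost q ⟧ n))))
          (run-loop∷ sep refl (run-branch∷ _ refl (run-body z x xs xs≤ (h [] (x ∷ xs) refl)))
            (run-fold xs _ (≤-trans (m≤n⇒m≤1+n (m≤n+m _ _)) xs≤) (λ ys zs eq → h (x ∷ ys) zs (cong (x ∷_) eq))))
        where
        lemma : ∀ x xs k → x * (4 + k) + (2 + (2 + k + (xs * (4 + k) + 7))) ≡ suc (x + xs) * (4 + k) + 7
        lemma = solve-∀

  -- Iterating a polynomial-time step may blow up the accumulator exponentially, so a bound on the
  -- result must be supplied. It is asked for all lists; applied to the prefixes of the given one it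
  -- bounds every intermediate accumulator.
  foldl′ : {s : E × B × A → B} → PT s → (q : Poly) →
           (∀ e z xs → ⌈ foldl (λ b a → s (e , b , a)) z xs ⌉ ≤ ⟦ q ⟧ ⌈ e , z , xs ⌉) →
           PT (λ (i : E × B × List A) → foldl (λ b a → s (proj₁ i , b , a)) (proj₁ (proj₂ i)) (proj₂ (proj₂ i)))
  foldl′ {s} p q h .prog   = Fold.foldProg s p
  foldl′ {s} p q h .cost   = Fold.foldCost s p q
  foldl′ {s} p q h .growth = q
  foldl′ {s} p q h .bounded (e , z , xs) = h e z xs
  foldl′ {s} p q h .runs (e , z , xs) =
    run-uncons (enc e) (enc (z , xs)) »
    weaken (⟦⟧-mono takeCost e≤) (run-takeTo true false (enc e)) »
    run-uncons (enc z) (enc xs) »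
    run-swap (enc z) (enc xs) var var (≤-trans (m≤n⇒m≤1+n (m≤m+n _ _)) zxs≤) xs≤ »
    run-push »
    weaken (+-monoˡ-≤ 7 (*-monoˡ-≤ _ xs≤)) (Fold.run-fold s p e q e≤ xs z xs≤ prefix) »
    weaken (⟦⟧-mono putCost e≤) (run-putA (enc e)) »
    weaken (⟦⟧-mono takeCost e≤) (run-drop (enc e))
    where
    e≤ : ⌈ e ⌉ ≤ ⌈ e , z , xs ⌉
    e≤ = m≤n⇒m≤1+n (m≤m+n _ _)
    zxs≤ : ⌈ z , xs ⌉ ≤ ⌈ e , z , xs ⌉
    zxs≤ = m≤n⇒m≤1+n (m≤n+m _ _)
    xs≤ : ⌈ xs ⌉ ≤ ⌈ e , z , xs ⌉
    xs≤ = ≤-trans (m≤n⇒m≤1+n (m≤n+m _ _)) zxs≤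
    prefix-size : ∀ (ys zs : List A) → ⌈ ys ⌉ ≤ ⌈ ys ++ zs ⌉
    prefix-size []       []       = ≤-refl
    prefix-size []       (z ∷ zs) = s≤s z≤n
    prefix-size (y ∷ ys) zs       = s≤s (+-monoʳ-≤ ⌈ y ⌉ (prefix-size ys zs))
    prefix : Fold.Bounded s p e q e≤ z xs
    prefix ys zs refl = ≤-trans (h e z ys)
      (⟦⟧-mono q (s≤s (+-monoʳ-≤ ⌈ e ⌉ (s≤s (+-monoʳ-≤ ⌈ z ⌉ (prefix-size ys zs))))))

-- Finiteness of the control states.

finite-⊎ : ∀ {A B} → Finite A → Finite B → Finite (A ⊎ B)
finite-⊎ (m , f) (n , g) = m + n , ↔-trans (f ⊎-↔ g) (↔-sym +↔⊎)

finite-⊤ : Finite ⊤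
finite-⊤ = 1 , mk↔ₛ′ (λ _ → zero) (λ _ → tt) (λ { zero → refl }) (λ _ → refl)

finite-Bool : Finite Bool
finite-Bool = 2 , mk↔ₛ′ (λ { false → zero ; true → suc zero }) (λ { zero → false ; (suc zero) → true })
                    (λ { zero → refl ; (suc zero) → refl }) (λ { false → refl ; true → refl })

finite-↔ : ∀ {A B} → B ↔ A → Finite A → Finite B
finite-↔ f (n , g) = n , ↔-trans f g

finite-Sym : ∀ {F : Sym → Set} → (∀ s → Finite (F s)) → Finite (Σ Sym F)
finite-Sym {F} h = finite-↔ split (finite-⊎ (h sep) (finite-⊎ (h (dat false)) (h (dat true))))
  where
  split : Σ Sym F ↔ (F sep ⊎ (F (dat false) ⊎ F (dat true)))
  split = mk↔ₛ′
    (λ { (sep , x) → inj₁ x ; (dat false , x) → inj₂ (inj₁ x) ; (dat true , x) → inj₂ (inj₂ x) })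
    (λ { (inj₁ x) → sep , x ; (inj₂ (inj₁ x)) → dat false , x ; (inj₂ (inj₂ x)) → dat true , x })
    (λ { (inj₁ x) → refl ; (inj₂ (inj₁ x)) → refl ; (inj₂ (inj₂ x)) → refl })
    (λ { (sep , x) → refl ; (dat false , x) → refl ; (dat true , x) → refl })

finite-MaybeSym : ∀ {F : Maybe Sym → Set} → (∀ s → Finite (F s)) → Finite (Σ (Maybe Sym) F)
finite-MaybeSym {F} h = finite-↔ split (finite-⊎ (h nothing) (finite-Sym (h ∘ just)))
  where
  split : Σ (Maybe Sym) F ↔ (F nothing ⊎ Σ Sym (F ∘ just))
  split = mk↔ₛ′
    (λ { (nothing , x) → inj₁ x ; (just s , x) → inj₂ (s , x) })
    (λ { (inj₁ x) → nothing , x ; (inj₂ (s , x)) → just s , x })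
    (λ { (inj₁ x) → refl ; (inj₂ x) → refl })
    (λ { (nothing , x) → refl ; (just s , x) → refl })

finite-Point : ∀ p → Finite (Point p)
finite-Point skip         = finite-⊤
finite-Point (push i s)   = finite-⊤
finite-Point (p ⨾ q)      = finite-⊎ (finite-Point p) (finite-Point q)
finite-Point (branch i c) = finite-⊎ finite-Bool (finite-MaybeSym λ s → finite-Point (c s))
finite-Point (loop i c)   = finite-⊎ finite-Bool (finite-Sym λ s → finite-Point (c s))

-- Machines for polynomial-time functions and for verifiers.

gather : Sym → Prog
gather (dat b) = pushTree (enc b) ⨾ push #S (dat true)
gather sep     = skip

gatherLoop : Bool → Prog
gatherLoop i = push #S (dat false) ⨾ loop (if i then #A else #C) gather

emit : Maybe Sym → Prog
emit (just (dat true)) = branch #S λ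
  { (just (dat true)) → branch #S λ _ → branch #S λ _ → push #B (dat true) ⨾ push #C sep
  ; _                 → push #B (dat false) ⨾ push #C sep }
emit _ = skip

emitLoop : Prog
emitLoop = push #C sep ⨾ loop #C λ _ → branch #S emit

wordSize : ∀ (l acc : List Bool) → ⌈ l ʳ++ acc ⌉ ≤ 4 * length l + ⌈ acc ⌉
wordSize []      acc = ≤-refl
wordSize (b ∷ l) acc = ≤-trans (wordSize l (b ∷ acc))
  (≤-trans (+-monoʳ-≤ (4 * length l) (s≤s (+-monoˡ-≤ ⌈ acc ⌉ (size-Bool b)))) (≤-reflexive (lemma (length l) ⌈ acc ⌉)))
  where
  lemma : ∀ l a → 4 * l + (1 + (3 + a)) ≡ 4 * suc l + a
  lemma = solve-∀

word-size : ∀ (x : List Bool) → ⌈ x ⌉ ≤ 4 * length x + 1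
word-size x = subst₂ (λ u n → ⌈ u ⌉ ≤ 4 * n + 1) (reverse-involutive x) (length-reverse x) (wordSize (reverse x) [])

word-sizes : ∀ x y → ⌈ x , y ⌉ ≤ 3 + 4 * (length x + length y)
word-sizes x y = ≤-trans (s≤s (+-mono-≤ (word-size x) (word-size y))) (≤-reflexive (lemma (length x) (length y)))
  where
  lemma : ∀ m n → suc (4 * m + 1 + (4 * n + 1)) ≡ 3 + 4 * (m + n)
  lemma = solve-∀

run-pushBit : ∀ (b : Bool) {α s c β} → Run (pushTree (enc b)) (α ∷ s ∷ c ∷ β ∷ []) 3 (α ∷ code (enc b) s ∷ c ∷ β ∷ [])
run-pushBit false = weaken (s≤s z≤n) run-push
run-pushBit true  = run-push » run-push » run-push

gatherCost : ℕ → ℕ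
gatherCost n = 1 + (6 * n + 2)

-- Adding the letters to a list as they are popped reverses the stack. Reading or guessing a word
-- leaves its last letter on top, so for such a stack the two reversals cancel.
run-gatherC : ∀ l {α s β} → Run (gatherLoop false) (α ∷ s ∷ map dat l ∷ β ∷ []) (gatherCost (length l))
                                  ⟪ α , code (enc (l ʳ++ [])) s , β ⟫
run-gatherC l {α} {s} {β} = run-push » go l []
  where
  lemma : ∀ n → 2 + (4 + (6 * n + 2)) ≡ 6 * suc n + 2
  lemma = solve-∀
  go : ∀ l acc → Run (loop #C gather) (α ∷ code (enc acc) s ∷ map dat l ∷ β ∷ []) (6 * length l + 2)
                   ⟪ α , code (enc (l ʳ++ acc)) s , β ⟫
  go []      acc = run-loop[] refl
  go (b ∷ l) acc = weaken (≤-reflexive (lemma (length l)))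
    (run-loop∷ _ refl (run-pushBit b » run-push {σ = α ∷ code (enc b) (code (enc acc) s) ∷ map dat l ∷ β ∷ []}) (go l (b ∷ acc)))

run-gatherA : ∀ l {s β} → Run (gatherLoop true) ⟪ map dat l , s , β ⟫ (gatherCost (length l))
                                ⟪ [] , code (enc (l ʳ++ [])) s , β ⟫
run-gatherA l {s} {β} = run-push » go l []
  where
  lemma : ∀ n → 2 + (4 + (6 * n + 2)) ≡ 6 * suc n + 2
  lemma = solve-∀
  go : ∀ l acc → Run (loop #A gather) ⟪ map dat l , code (enc acc) s , β ⟫ (6 * length l + 2)
                   ⟪ [] , code (enc (l ʳ++ acc)) s , β ⟫
  go []      acc = run-loop[] refl
  go (b ∷ l) acc = weaken (≤-reflexive (lemma (length l)))
    (run-loop∷ _ refl (run-pushBit b » run-push {σ = ⟪ map dat l , code (enc b) (code (enc acc) s) , β ⟫}) (go l (b ∷ acc)))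

run-gatherC′ : ∀ y {α s β} → Run (gatherLoop false) (α ∷ s ∷ map dat (y ʳ++ []) ∷ β ∷ []) (gatherCost (length y))
                                   ⟪ α , code (enc y) s , β ⟫
run-gatherC′ y {α} {s} {β} =
  subst₂ (λ z n → Run (gatherLoop false) (α ∷ s ∷ map dat (y ʳ++ []) ∷ β ∷ []) (gatherCost n) ⟪ α , code (enc z) s , β ⟫)
    (reverse-involutive y) (length-reverse y) (run-gatherC (y ʳ++ []))

run-gatherA′ : ∀ x {s β} → Run (gatherLoop true) ⟪ map dat (x ʳ++ []) , s , β ⟫ (gatherCost (length x))
                                 ⟪ [] , code (enc x) s , β ⟫
run-gatherA′ x {s} {β} =
  subst₂ (λ z n → Run (gatherLoop true) ⟪ map dat (x ʳ++ []) , s , β ⟫ (gatherCost n) ⟪ [] , code (enc z) s , β ⟫)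
    (reverse-involutive x) (length-reverse x) (run-gatherA (x ʳ++ []))

-- The last letter ends on top of `#B`, next to the head, so that the tape shows the word from left
-- to right as `Holds` wants it.
run-emit : ∀ w {α s} → Run emitLoop ⟪ α , code (enc w) s , [] ⟫ (1 + (12 * length w + 7)) ⟪ α , s , map dat (w ʳ++ []) ⟫
run-emit w {α} {s} = run-push » go w []
  where
  lemma : ∀ n → 2 + (10 + (12 * n + 7)) ≡ 12 * suc n + 7
  lemma = solve-∀
  go : ∀ w l → Run (loop #C λ _ → branch #S emit) (α ∷ code (enc w) s ∷ (sep ∷ []) ∷ map dat l ∷ [])
                 (12 * length w + 7) ⟪ α , s , map dat (w ʳ++ l) ⟫
  go []          l = run-loop∷ sep refl (run-branch∷ _ refl run-skip) (run-loop[] refl)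
  go (false ∷ w) l = weaken (≤-trans (+-monoʳ-≤ 2 (+-monoˡ-≤ _ (≤ᵇ⇒≤ 6 10 _))) (≤-reflexive (lemma (length w))))
    (run-loop∷ sep refl (run-branch∷ _ refl (run-branch∷ _ refl (run-push » run-push))) (go w (false ∷ l)))
  go (true ∷ w)  l = weaken (≤-reflexive (lemma (length w)))
    (run-loop∷ sep refl (run-branch∷ _ refl (run-branch∷ _ refl (run-branch∷ _ refl (run-branch∷ _ refl
      (run-push » run-push))))) (go w (true ∷ l)))

length≤size : ∀ (w : List Bool) → length w ≤ ⌈ w ⌉
length≤size []      = z≤n
length≤size (b ∷ w) = s≤s (≤-trans (length≤size w) (m≤n+m _ _))

-- One machine for two purposes. Without guessing, the second argument of `f` is the empty word and
-- the word left on the last tape is what counts. With guessing, the second argument is the guess,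
-- and the first bit of the output decides between `accept` and `reject`. Neither of these two
-- states has a successor.
module Wrap {f : List Bool × List Bool → List Bool} (F : PT f) (guessing : Bool) where

  opaque
    whole : Prog
    whole = gatherLoop false ⨾ gatherLoop true ⨾ push #S (dat true) ⨾ prog F ⨾ emitLoop

    wholeCost : Poly
    wholeCost = con 1 ⊕ (con 6 ⊗ var ⊕ con 2) ⊕ (con 1 ⊕ (con 6 ⊗ var ⊕ con 2) ⊕ (con 1 ⊕ (cost F ⊕
                (con 1 ⊕ (con 12 ⊗ growth F ⊕ con 7)))))

    run-whole : ∀ x y → Run whole (map dat (x ʳ++ []) ∷ [] ∷ map dat (y ʳ++ []) ∷ [] ∷ [])
                  (⟦ wholeCost ⟧ ⌈ x , y ⌉) (⟪ [] , [] , map dat (f (x , y) ʳ++ []) ⟫)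
    run-whole x y =
      weaken (gathered y (m≤n⇒m≤1+n (m≤n+m _ _))) (run-gatherC′ y) »
      weaken (gathered x (m≤n⇒m≤1+n (m≤m+n _ _))) (run-gatherA′ x) »
      run-push » runs F (x , y) »
      weaken (s≤s (+-monoˡ-≤ 7 (*-monoʳ-≤ 12 (≤-trans (length≤size (f (x , y))) (bounded F (x , y)))))) (run-emit (f (x , y)))
      where
      gathered : ∀ (l : List Bool) {n} → ⌈ l ⌉ ≤ n → gatherCost (length l) ≤ gatherCost n
      gathered l h = s≤s (+-monoˡ-≤ 2 (*-monoʳ-≤ 6 (≤-trans (length≤size l) h)))

  Control : Set
  Control = Fin 7 ⊎ Point whole

  pattern load    = inj₁ zero
  pattern guess   = inj₁ (suc zero)
  pattern rewind₀ = inj₁ (suc (suc zero))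
  pattern rewind₁ = inj₁ (suc (suc (suc zero)))
  pattern test    = inj₁ (suc (suc (suc (suc zero))))
  pattern accept     = inj₁ (suc (suc (suc (suc (suc zero)))))
  pattern reject      = inj₁ (suc (suc (suc (suc (suc (suc zero))))))

  Step : Set
  Step = Control × Actions

  loadStep rewindStep testStep : Symbol ⊤ → Vec (Symbol ⊤) 4 → List Step
  loadStep (bit b) as = (load , only #A (bit b , right) as) ∷ []
  loadStep _       as = (guess , keep as) ∷ []
  rewindStep blank as = (test , only #B (blank , right) as) ∷ []
  rewindStep s     as = (rewind₁ , only #B (s , left) as) ∷ []
  testStep (bit true) as = (accept , keep as) ∷ []
  testStep _          as = (reject , keep as) ∷ []

  guessStep : Bool → Vec (Symbol ⊤) 4 → List Step
  guessStep false as = (inj₂ (entry whole) , keep as) ∷ []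
  guessStep true  as = (guess , only #C (bit false , right) as) ∷ (guess , only #C (bit true , right) as) ∷
                       (inj₂ (entry whole) , keep as) ∷ []

  transitions : Control → Vec (Symbol ⊤) 4 → List Step
  transitions load     as = loadStep (lookup as #A) as
  transitions guess    as = guessStep guessing as
  transitions rewind₀  as = (rewind₁ , only #B (lookup as #B , left) as) ∷ []
  transitions rewind₁  as = rewindStep (lookup as #B) as
  transitions test     as = testStep (lookup as #B) as
  transitions accept      as = []
  transitions reject       as = []
  transitions (inj₂ x) as = delta whole inj₂ rewind₀ x as ∷ []

  isYes : Control → Bool
  isYes accept = true
  isYes _   = false

  machine : Machine
  machine = record
    { State      = Control
    ; Mark       = ⊤
    ; finState   = finite-⊎ (7 , ↔-refl) (finite-Point whole)
    ; finMark    = finite-⊤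
    ; extraTapes = 3
    ; start      = load
    ; accepting  = isYes
    ; δ          = transitions
    }

  open Machine machine using (_⟶[_]_; done; step; initial; successors; Accepting)
  open Simulation transitions renaming (done to done′; step to step′)

  ⟶-trans : ∀ {c d e m n} → c ⟶[ m ] d → d ⟶[ n ] e → c ⟶[ m + n ] e
  ⟶-trans done       s = s
  ⟶-trans (step e r) s = step e (⟶-trans r s)

  ⇒⟶ : ∀ {c d n} → c ⇒[ n ] d → c ⟶[ n ] d
  ⇒⟶ done′ = done
  ⇒⟶ (step′ {c′ = c′} eq r) = step (subst (c′ ∈_) (sym eq) (here refl)) (⇒⟶ r)

  -- An accepting run cannot end inside a deterministic phase, because `accept` has no successor and
  -- every configuration of the phase has one. So it runs through to the end of the phase.
  forced : ∀ {c d e m n} → c ⇒[ m ] d → c ⟶[ n ] e → Accepting e → ∃[ k ] (d ⟶[ k ] e)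
  forced done′        s    acc = _ , s
  forced (step′ eq r) done acc = ⊥-elim (stuck _ acc eq)
    where
    stuck : ∀ c → Accepting c → ∀ {c′} → next c ≢ c′ ∷ []
    stuck (accept , ts) _ ()
    stuck (inj₂ _ , ts) ()
  forced (step′ eq r) (step c∈ s) acc with subst (_ ∈_) eq c∈
  ... | here refl = forced r s acc

  inputAt : List Bool → List Bool → Tape ⊤
  inputAt l []       = tape (map embed (map dat l)) blank []
  inputAt l (b ∷ bs) = tape (map embed (map dat l)) (bit b) (map bit bs)

  inputAt[] : ∀ x → inputTape x ≡ inputAt [] x
  inputAt[] []      = refl
  inputAt[] (b ∷ x) = refl

  loading : ∀ l x → (load , inputAt l x ∷ Vec.replicate 3 emptyTape) ⇒[ length x + 1 ]
                    (guess , inputAt (x ʳ++ l) [] ∷ Vec.replicate 3 emptyTape)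
  loading l []      = step′ refl done′
  loading l (b ∷ x) = step′ (cong (λ t → (load , t ∷ Vec.replicate 3 emptyTape) ∷ []) (advance x)) (loading (b ∷ l) x)
    where
    advance : ∀ x → move right (inputAt l (b ∷ x)) ≡ inputAt (b ∷ l) x
    advance []      = refl
    advance (c ∷ x) = refl

  Ready : List Bool → List Bool → Tapes → Set
  Ready x l ts = AllRepresent ts (map dat (x ʳ++ []) ∷ [] ∷ map dat l ∷ [] ∷ [])

  represents-empty : Represents emptyTape []
  represents-empty = 0 , refl

  loaded : ∀ x → ∃[ ts ] (initial x ⇒[ length x + 1 ] (guess , ts) × Ready x [] ts)
  loaded x = _ , subst (λ t → (load , t ∷ Vec.replicate 3 emptyTape) ⇒[ length x + 1 ]
                                                                (guess , inputAt (x ʳ++ []) [] ∷ Vec.replicate 3 emptyTape)) (sym (inputAt[] x)) (loading [] x) ,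
             (0 , refl) ∷ represents-empty ∷ represents-empty ∷ represents-empty ∷ []

  outputAt : List Bool → List (Symbol ⊤) → Tape ⊤
  outputAt []      rs = tape [] blank rs
  outputAt (b ∷ l) rs = tape (map embed (map dat l)) (bit b) rs

  -- The bottom of the stack is the leftmost cell ever written, so the first blank met on the way
  -- left marks the beginning of the word.
  rewinding : ∀ {tA tS tC} l w m →
    ∃[ t ] ((rewind₁ , tA ∷ tS ∷ tC ∷ outputAt l (map bit w ++ blank ∷ replicate m blank) ∷ []) ⇒[ length l + 1 ]
            (test , tA ∷ tS ∷ tC ∷ t ∷ []) × Holds t (l ʳ++ w))
  rewinding []      []      m = _ , step′ refl done′ , suc m , refl
  rewinding []      (b ∷ w) m = _ , step′ refl done′ , suc m , refl
  rewinding (b ∷ l) w       m =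
    let t , r , h = rewinding l (b ∷ w) m in
    t , step′ (cong (λ t → (rewind₁ , _ ∷ _ ∷ _ ∷ t ∷ []) ∷ []) (back l)) r , h
    where
    back : ∀ l {rs} → move left (outputAt (b ∷ l) rs) ≡ outputAt l (bit b ∷ rs)
    back []      = refl
    back (c ∷ l) = refl

  verdict : List Bool → Control
  verdict (true ∷ _) = accept
  verdict _          = reject

  testing : ∀ {tA tS tC t} w → Holds t w →
            (test , tA ∷ tS ∷ tC ∷ t ∷ []) ⇒[ 1 ] (verdict w , tA ∷ tS ∷ tC ∷ t ∷ [])
  testing []          (suc m , refl) = step′ refl done′
  testing (false ∷ w) (m , refl)     = step′ refl done′
  testing (true ∷ w)  (m , refl)     = step′ refl done′

  opaque
    runCost : Poly
    runCost = wholeCost ⊕ (con 1 ⊕ (growth F ⊕ con 1 ⊕ con 1))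

    running : ∀ x y {ts} → Ready x (y ʳ++ []) ts →
              ∃[ ts′ ] ∃[ n ] ((inj₂ (entry whole) , ts) ⇒[ n ] (verdict (f (x , y)) , ts′) ×
                               Holds (Vec.last ts′) (f (x , y)) × n ≤ ⟦ runCost ⟧ ⌈ x , y ⌉)
    running x y {ts} r with run-whole x y
    ... | t , t≤ , exec with simulate whole inj₂ rewind₀ (λ _ _ → refl) exec r
    ... | tA ∷ tS ∷ tC ∷ _ ∷ [] , s , (_ ∷ _ ∷ _ ∷ (m , refl) ∷ []) with rewinding {tA} {tS} {tC} (f (x , y) ʳ++ []) [] m
    ... | tB , r′ , h =
      let h′ = subst (Holds tB) (reverse-involutive (f (x , y))) h in
      _ , _ ,
      ⇒-trans s (step′ (cong (λ t → (rewind₁ , _ ∷ _ ∷ _ ∷ t ∷ []) ∷ []) (back (f (x , y) ʳ++ [])))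
        (⇒-trans r′ (testing (f (x , y)) h′))) , h′ ,
      +-mono-≤ t≤ (s≤s (+-monoˡ-≤ 1 (+-monoˡ-≤ 1
        (≤-trans (≤-reflexive (length-reverse (f (x , y)))) (≤-trans (length≤size (f (x , y))) (bounded F (x , y)))))))
      where
      back : ∀ l {rs} → move left (tape (map embed (map dat l)) blank rs) ≡ outputAt l (blank ∷ rs)
      back []      = refl
      back (c ∷ l) = refl

totalTime : Poly → Poly
totalTime p = var ⊕ con 1 ⊕ (con 1 ⊕ p)

totalBound : ∀ p l {n} → n ≤ ⟦ p ⟧ l → l + 1 + suc n ≤ eval (coefficients (totalTime p)) l
totalBound p l h = ≤-trans (+-monoʳ-≤ (l + 1) (s≤s h)) (≤-reflexive (sym (eval-coefficients (totalTime p) l)))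

PT⇒PolyTime : ∀ {f : List Bool → List Bool} → PT f → PolyTime f
PT⇒PolyTime {f} F = machine , deterministic , coefficients (totalTime (runCost ⊙ (con 3 ⊕ con 4 ⊗ var))) , computes
  where
  open Wrap (F ∙ fst) false
  open Machine machine using (Deterministic; OutputsIn)
  open Simulation transitions using (⇒-trans; step)

  deterministic : Deterministic
  deterministic load as with lookup as zero
  ... | blank  = ≤-refl
  ... | bit _  = ≤-refl
  ... | mark _ = ≤-refl
  deterministic guess as = ≤-refl
  deterministic rewind₀ as = ≤-refl
  deterministic rewind₁ as with lookup as #B
  ... | blank  = ≤-refl
  ... | bit _  = ≤-refl
  ... | mark _ = ≤-refl
  deterministic test as with lookup as #B
  ... | blank     = ≤-refl
  ... | bit true  = ≤-refl
  ... | bit false = ≤-refl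
  ... | mark _    = ≤-refl
  deterministic accept as = z≤n
  deterministic reject  as = z≤n
  deterministic (inj₂ _) as = ≤-refl

  computes : ∀ x → ∃[ t ] (t ≤ eval (coefficients (totalTime (runCost ⊙ (con 3 ⊕ con 4 ⊗ var)))) (length x) × OutputsIn t x (f x))
  computes x =
    let ts , s₁ , r = loaded x
        ts′ , n , s₂ , holds , n≤ = running x [] r
    in length x + 1 + suc n ,
       totalBound (runCost ⊙ (con 3 ⊕ con 4 ⊗ var)) (length x) (≤-trans n≤ (⊙-bound runCost (con 3 ⊕ con 4 ⊗ var) {n = length x} (subst (λ n → ⌈ x , [] {A = Bool} ⌉ ≤ 3 + 4 * n) (+-identityʳ (length x)) (word-sizes x [])))) ,
       verdict (f x) , ts′ , ⇒⟶ (⇒-trans s₁ (step (cong (λ us → (inj₂ (entry whole) , us) ∷ []) (zipWith-keep ts)) s₂)) , halted (f x) ts′ , holds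
    where
    halted : ∀ w ts → Machine.Halted machine (verdict w , ts)
    halted []          ts = refl
    halted (false ∷ w) ts = refl
    halted (true ∷ w)  ts = refl

record Verifier (L : Language) : Set₁ where
  field
    verify      : List Bool × List Bool → Bool
    verify-PT   : PT verify
    sound       : ∀ x y → verify (x , y) ≡ true → L x
    certificate : Poly
    complete    : ∀ x → L x → ∃[ y ] (length y ≤ ⟦ certificate ⟧ (length x) × verify (x , y) ≡ true)

certifiedTime : Poly → Poly → Poly
certifiedTime c p = var ⊕ con 1 ⊕ (c ⊕ (con 1 ⊕ p))

certifiedBound : ∀ c p l {m n} → m ≤ ⟦ c ⟧ l → n ≤ ⟦ p ⟧ l → l + 1 + (m + suc n) ≤ eval (coefficients (certifiedTime c p)) l
certifiedBound c p l h k =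
  ≤-trans (+-monoʳ-≤ (l + 1) (+-mono-≤ h (s≤s k))) (≤-reflexive (sym (eval-coefficients (certifiedTime c p) l)))

Verifier⇒NP : ∀ {L} → Verifier L → NP L
Verifier⇒NP {L} v = machine , accepted⇒ , coefficients (certifiedTime certificate time) , λ x Lx → accepts x (complete x Lx)
  where
  open Verifier v

  answer : List Bool × List Bool → List Bool
  answer p = verify p ∷ []

  open Wrap {answer} (recode (λ _ → refl) ∙ (verify-PT ▵ const′ tt)) true
  open Machine machine using (AcceptsIn; _⟶[_]_; done; step; Accepting)
  open Simulation transitions using (push-represents)

  isYes-verdict : ∀ b {ts c k} → (verdict (b ∷ []) , ts) ⟶[ k ] c → Accepting c → b ≡ true
  isYes-verdict true  _    _ = refl
  isYes-verdict false done ()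
  isYes-verdict false (step () _) _

  -- Induction on the run, with the guess growing on its stack. Once guessing stops, `forced` drives
  -- the run through the check, and its acceptance becomes the verdict on the guess made.
  guessed : ∀ {x l ts c k} → Ready x l ts → (guess , ts) ⟶[ k ] c → Accepting c → L x
  guessed r done ()
  guessed (a ∷ s ∷ c ∷ b ∷ []) (step (here refl) run) acc =
    guessed (a ∷ s ∷ push-represents (dat false) c ∷ b ∷ []) run acc
  guessed (a ∷ s ∷ c ∷ b ∷ []) (step (there (here refl)) run) acc =
    guessed (a ∷ s ∷ push-represents (dat true) c ∷ b ∷ []) run acc
  guessed {x} {l} {ts} r (step (there (there (here refl))) run) acc =
    let ts′ , n , s , _ = running x (l ʳ++ []) {ts} (subst (λ l → Ready x l ts) (sym (reverse-involutive l)) r)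
        k , run′ = forced s (subst (λ us → (inj₂ (entry whole) , us) ⟶[ _ ] _) (zipWith-keep ts) run) acc
    in sound x (l ʳ++ []) (isYes-verdict (verify (x , l ʳ++ [])) run′ acc)

  accepted⇒ : ∀ x t → AcceptsIn t x → L x
  accepted⇒ x t (c , run , acc) =
    let ts , s , r = loaded x
        k , run′ = forced s run acc
    in guessed r run′ acc

  guessing : ∀ {x} l y {ts} → Ready x l ts →
             ∃[ ts′ ] ((guess , ts) ⟶[ length y ] (guess , ts′) × Ready x (y ʳ++ l) ts′)
  guessing l []          r = _ , done , r
  guessing {x} l (false ∷ y) {_ ∷ _ ∷ _ ∷ _ ∷ []} (a ∷ s ∷ c ∷ b ∷ []) =
    let ts′ , run , r′ = guessing {x} (false ∷ l) y (a ∷ s ∷ push-represents (dat false) c ∷ b ∷ [])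
    in ts′ , step (here refl) run , r′
  guessing {x} l (true ∷ y)  {_ ∷ _ ∷ _ ∷ _ ∷ []} (a ∷ s ∷ c ∷ b ∷ []) =
    let ts′ , run , r′ = guessing {x} (true ∷ l) y (a ∷ s ∷ push-represents (dat true) c ∷ b ∷ [])
    in ts′ , step (there (here refl)) run , r′

  sizes : Poly
  sizes = con 3 ⊕ con 4 ⊗ (var ⊕ certificate)

  time : Poly
  time = runCost ⊙ sizes

  accepts : ∀ x → ∃[ y ] (length y ≤ ⟦ certificate ⟧ (length x) × verify (x , y) ≡ true) →
            ∃[ t ] (t ≤ eval (coefficients (certifiedTime certificate time)) (length x) × AcceptsIn t x)
  accepts x (y , y≤ , ok) =
    let ts , s₁ , r₁ = loaded x
        ts₂ , s₂ , r₂ = guessing {x} [] y r₁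
        ts₃ , n , s₃ , _ , n≤ = running x y {ts₂} r₂
    in length x + 1 + (length y + suc n) ,
       certifiedBound certificate time (length x) y≤
         (≤-trans n≤ (⊙-bound runCost sizes {n = length x} (≤-trans (word-sizes x y) (+-monoʳ-≤ 3 (*-monoʳ-≤ 4 (+-monoʳ-≤ (length x) y≤)))))) ,
       _ , ⟶-trans (⇒⟶ s₁) (⟶-trans s₂ (step (there (there (here (cong (inj₂ (entry whole) ,_) (sym (zipWith-keep ts₂)))))) (⇒⟶ s₃))) ,
       cong (λ b → isYes (verdict (b ∷ []))) ok

-- Booleans, lists, unary arithmetic and equality tests in polynomial time.

module _ {A B : Set} {{_ : Code A}} {{_ : Code B}} where

  if′ : {c : A → Bool} {f g : A → B} → PT c → PT f → PT g → PT (λ a → if c a then f a else g a)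
  if′ {c} {f} {g} pc pf pg = (λ a → lemma a (c a)) ≗⇒ case′ pg (pf ∙ fst) ∙ (id′ ▵ pc)
    where
    lemma : ∀ a b → maybe′ (λ _ → f a) (g a) (view b) ≡ (if b then f a else g a)
    lemma a false = refl
    lemma a true  = refl

module _ {A : Set} {{_ : Code A}} where

  infixr 6 _∧′_
  infixr 5 _∨′_

  _∧′_ : {f g : A → Bool} → PT f → PT g → PT (λ a → f a ∧ g a)
  _∧′_ {f} {g} p q = (λ a → lemma (f a) (g a)) ≗⇒ if′ p q (const′ false)
    where
    lemma : ∀ x y → (if x then y else false) ≡ x ∧ y
    lemma false y = refl
    lemma true  y = refl

  _∨′_ : {f g : A → Bool} → PT f → PT g → PT (λ a → f a ∨ g a)
  _∨′_ {f} {g} p q = (λ a → lemma (f a) (g a)) ≗⇒ if′ p (const′ true) q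
    where
    lemma : ∀ x y → (if x then true else y) ≡ x ∨ y
    lemma false y = refl
    lemma true  y = refl

  not′ : {f : A → Bool} → PT f → PT (λ a → not (f a))
  not′ {f} p = (λ a → lemma (f a)) ≗⇒ if′ p (const′ false) (const′ true)
    where
    lemma : ∀ x → (if x then false else true) ≡ not x
    lemma false = refl
    lemma true  = refl

  cons′ : {B : Set} {{_ : Code B}} {f : A → B} {g : A → List B} → PT f → PT g → PT (λ a → f a ∷ g a)
  cons′ p q = recode {f = λ xs → proj₁ xs ∷ proj₂ xs} (λ _ → refl) ∙ (p ▵ q)

  suc′ : {f : A → ℕ} → PT f → PT (λ a → suc (f a))
  suc′ p = recode {f = λ n → suc (proj₂ {A = ⊤} n)} (λ _ → refl) ∙ (const′ tt ▵ p)

private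
  size-ʳ++ : ∀ {A} {{_ : Code A}} (xs ys : List A) → ⌈ xs ʳ++ ys ⌉ ≤ ⌈ ys ⌉ + ⌈ xs ⌉
  size-ʳ++ []       ys = m≤m+n _ _
  size-ʳ++ (x ∷ xs) ys = ≤-trans (size-ʳ++ xs (x ∷ ys)) (≤-reflexive (lemma (⌈ x ⌉) (⌈ xs ⌉) ⌈ ys ⌉))
    where
    lemma : ∀ x xs ys → suc (x + ys) + xs ≡ ys + suc (x + xs)
    lemma = solve-∀

reverse′ : ∀ {A} {{_ : Code A}} → PT (λ (xs : List A) → reverse xs)
reverse′ {A} =
  foldl′ {E = ⊤} {s = λ i → proj₂ (proj₂ i) ∷ proj₁ (proj₂ i)} (cons′ (snd ∙ snd) (fst ∙ snd)) var bound ∙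
  (const′ tt ▵ const′ [] ▵ id′)
  where
  bound : ∀ e (z : List A) xs → ⌈ xs ʳ++ z ⌉ ≤ ⌈ e , z , xs ⌉
  bound e z xs = ≤-trans (size-ʳ++ xs z) (m≤n+m _ 3)

module _ {E A B : Set} {{_ : Code E}} {{_ : Code A}} {{_ : Code B}} where

  -- A left fold over the reversed list. The estimate for the size of a reversed list is larger by
  -- one, which is why `q` is evaluated at the successor.
  foldr′ : {s : E × A × B → B} → PT s → (q : Poly) →
           (∀ e z xs → ⌈ foldr (λ a b → s (e , a , b)) z xs ⌉ ≤ ⟦ q ⟧ ⌈ e , z , xs ⌉) →
           PT (λ (i : E × B × List A) → foldr (λ a b → s (proj₁ i , a , b)) (proj₁ (proj₂ i)) (proj₂ (proj₂ i)))
  foldr′ {s} p q h =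
    (λ { (e , z , xs) → trans (as-foldr e z (reverse xs)) (cong (foldr (λ a b → s (e , a , b)) z) (reverse-involutive xs)) }) ≗⇒
    foldl′ (p ∙ (fst ▵ snd ∙ snd ▵ fst ∙ snd)) (q ⊙ (con 1 ⊕ var)) bound ∙ (fst ▵ fst ∙ snd ▵ reverse′ ∙ snd ∙ snd)
    where
    as-foldr : ∀ e z xs → foldl (λ b a → s (e , a , b)) z xs ≡ foldr (λ a b → s (e , a , b)) z (reverse xs)
    as-foldr e z xs = sym (reverse-foldr (λ a b → s (e , a , b)) z xs)
    bound : ∀ (e : E) (z : B) (xs : List A) → ⌈ foldl (λ b a → s (e , a , b)) z xs ⌉ ≤ ⟦ q ⊙ (con 1 ⊕ var) ⟧ ⌈ e , z , xs ⌉
    bound e z xs = subst (λ b → ⌈ b ⌉ ≤ _) (sym (as-foldr e z xs))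
      (≤-trans (h e z (reverse xs)) (⊙-bound q (con 1 ⊕ var) {n = ⌈ e , z , xs ⌉} larger))
      where
      larger : ⌈ e , z , reverse xs ⌉ ≤ 1 + ⌈ e , z , xs ⌉
      larger = s≤s (≤-trans (+-monoʳ-≤ ⌈ e ⌉ (s≤s (+-monoʳ-≤ ⌈ z ⌉ (size-ʳ++ xs []))))
                            (≤-reflexive (lemma ⌈ e ⌉ ⌈ z ⌉ ⌈ xs ⌉)))
        where
        lemma : ∀ e z xs → e + suc (z + (1 + xs)) ≡ suc (e + suc (z + xs))
        lemma = solve-∀

module _ {E A B : Set} {{_ : Code E}} {{_ : Code A}} {{_ : Code B}} where

  map′ : {f : E × A → B} → PT f → PT (λ (i : E × List A) → map (λ x → f (proj₁ i , x)) (proj₂ i))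
  map′ {f} p =
    (λ { (e , xs) → as-map e xs }) ≗⇒
    foldr′ {s = λ i → f (proj₁ i , proj₁ (proj₂ i)) ∷ proj₂ (proj₂ i)}
      (cons′ (p ∙ (fst ▵ fst ∙ snd)) (snd ∙ snd)) (var ⊗ (con 1 ⊕ growth p) ⊕ var) bound ∙ (fst ▵ const′ [] ▵ snd)
    where
    as-map : ∀ e xs → foldr (λ a b → f (e , a) ∷ b) [] xs ≡ map (λ x → f (e , x)) xs
    as-map e []       = refl
    as-map e (x ∷ xs) = cong (f (e , x) ∷_) (as-map e xs)
    go : ∀ {n} (e : E) (z : List B) (xs : List A) → ⌈ e ⌉ + ⌈ xs ⌉ ≤ n →
         ⌈ foldr (λ a b → f (e , a) ∷ b) z xs ⌉ ≤ ⌈ xs ⌉ * (1 + ⟦ growth p ⟧ n) + ⌈ z ⌉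
    go {n} e z []       h = m≤n+m _ (1 * (1 + ⟦ growth p ⟧ n))
    go {n} e z (x ∷ xs) h = ≤-trans
      (s≤s (+-mono-≤ (≤-trans (bounded p (e , x)) (⟦⟧-mono (growth p) (≤-trans head≤ h))) (go e z xs (≤-trans tail≤ h))))
      (≤-trans (m≤m+n _ (⌈ x ⌉ * (1 + ⟦ growth p ⟧ n))) (≤-reflexive (lemma (⟦ growth p ⟧ n) ⌈ x ⌉ ⌈ xs ⌉ ⌈ z ⌉)))
      where
      head≤ : suc (⌈ e ⌉ + ⌈ x ⌉) ≤ ⌈ e ⌉ + suc (⌈ x ⌉ + ⌈ xs ⌉)
      head≤ = ≤-trans (≤-reflexive (sym (+-suc ⌈ e ⌉ ⌈ x ⌉))) (+-monoʳ-≤ ⌈ e ⌉ (s≤s (m≤m+n _ _)))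
      tail≤ : ⌈ e ⌉ + ⌈ xs ⌉ ≤ ⌈ e ⌉ + suc (⌈ x ⌉ + ⌈ xs ⌉)
      tail≤ = +-monoʳ-≤ ⌈ e ⌉ (m≤n⇒m≤1+n (m≤n+m _ _))
      lemma : ∀ g x xs z → suc (g + (xs * (1 + g) + z)) + x * (1 + g) ≡ suc (x + xs) * (1 + g) + z
      lemma = solve-∀
    bound : ∀ (e : E) (z : List B) (xs : List A) → ⌈ foldr (λ a b → f (e , a) ∷ b) z xs ⌉ ≤ ⟦ var ⊗ (con 1 ⊕ growth p) ⊕ var ⟧ ⌈ e , z , xs ⌉
    bound e z xs = ≤-trans (go e z xs exs≤) (+-mono-≤ (*-monoˡ-≤ (1 + ⟦ growth p ⟧ ⌈ e , z , xs ⌉) (≤-trans (m≤n+m ⌈ xs ⌉ ⌈ e ⌉) exs≤)) z≤)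
      where
      exs≤ : ⌈ e ⌉ + ⌈ xs ⌉ ≤ ⌈ e , z , xs ⌉
      exs≤ = m≤n⇒m≤1+n (+-monoʳ-≤ ⌈ e ⌉ (m≤n⇒m≤1+n (m≤n+m _ _)))
      z≤ : ⌈ z ⌉ ≤ ⌈ e , z , xs ⌉
      z≤ = m≤n⇒m≤1+n (≤-trans (m≤n⇒m≤1+n (m≤m+n _ _)) (m≤n+m _ _))

module _ {A : Set} {{_ : Code A}} where

  size-++ : ∀ (xs ys : List A) → ⌈ xs ++ ys ⌉ ≤ ⌈ xs ⌉ + ⌈ ys ⌉
  size-++ []       ys = n≤1+n _
  size-++ (x ∷ xs) ys = s≤s (≤-trans (+-monoʳ-≤ ⌈ x ⌉ (size-++ xs ys)) (≤-reflexive (sym (+-assoc ⌈ x ⌉ _ _))))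

  append′ : PT (λ (i : List A × List A) → proj₁ i ++ proj₂ i)
  append′ = (λ { (xs , ys) → as-++ xs ys }) ≗⇒
    foldr′ {E = ⊤} {s = λ i → proj₁ (proj₂ i) ∷ proj₂ (proj₂ i)} (cons′ (fst ∙ snd) (snd ∙ snd)) var bound ∙
    (const′ tt ▵ snd ▵ fst)
    where
    as-++ : ∀ (xs ys : List A) → foldr _∷_ ys xs ≡ xs ++ ys
    as-++ []       ys = refl
    as-++ (x ∷ xs) ys = cong (x ∷_) (as-++ xs ys)
    bound : ∀ (e : ⊤) (z xs : List A) → ⌈ foldr _∷_ z xs ⌉ ≤ ⌈ e , z , xs ⌉
    bound e z xs = subst (λ l → ⌈ l ⌉ ≤ ⌈ e , z , xs ⌉) (sym (as-++ xs z))
      (≤-trans (size-++ xs z) (≤-trans (≤-reflexive (+-comm ⌈ xs ⌉ ⌈ z ⌉)) (m≤n+m _ 3)))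

  infixr 5 _++′_

  _++′_ : {B : Set} {{_ : Code B}} {f g : B → List A} → PT f → PT g → PT (λ b → f b ++ g b)
  p ++′ q = append′ ∙ (p ▵ q)

  concat′ : PT (λ (xss : List (List A)) → concat xss)
  concat′ = foldr′ {E = ⊤} {s = λ i → proj₁ (proj₂ i) ++ proj₂ (proj₂ i)} (append′ ∙ snd) var bound ∙
            (const′ tt ▵ const′ [] ▵ id′)
    where
    go : ∀ z (xss : List (List A)) → ⌈ foldr _++_ z xss ⌉ ≤ ⌈ z ⌉ + ⌈ xss ⌉
    go z []         = m≤m+n _ _
    go z (xs ∷ xss) = ≤-trans (size-++ xs (foldr _++_ z xss)) (≤-trans (+-monoʳ-≤ ⌈ xs ⌉ (go z xss))
      (≤-trans (n≤1+n _) (≤-reflexive (lemma ⌈ xs ⌉ ⌈ z ⌉ ⌈ xss ⌉))))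
      where
      lemma : ∀ x z xss → suc (x + (z + xss)) ≡ z + suc (x + xss)
      lemma = solve-∀
    bound : ∀ (e : ⊤) z (xss : List (List A)) → ⌈ foldr _++_ z xss ⌉ ≤ ⌈ e , z , xss ⌉
    bound e z xss = ≤-trans (go z xss) (m≤n+m _ 3)

concatMap′ : ∀ {E A B} {{_ : Code E}} {{_ : Code A}} {{_ : Code B}} {f : E × A → List B} → PT f →
             PT (λ (i : E × List A) → concatMap (λ x → f (proj₁ i , x)) (proj₂ i))
concatMap′ p = concat′ ∙ map′ p

module _ {E A : Set} {{_ : Code E}} {{_ : Code A}} {f : E × A → Bool} (p : PT f) where

  all′ : PT (λ (i : E × List A) → all (λ x → f (proj₁ i , x)) (proj₂ i))
  all′ = foldr′ {E = ⊤} {s = λ i → proj₁ (proj₂ i) ∧ proj₂ (proj₂ i)} (fst ∙ snd ∧′ snd ∙ snd) (con 3 ⊕ var)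
           (λ e z xs → ≤-trans (size-Bool (foldr _∧_ z xs)) (m≤m+n 3 _)) ∙ (const′ tt ▵ const′ true ▵ map′ p)

  any′ : PT (λ (i : E × List A) → any (λ x → f (proj₁ i , x)) (proj₂ i))
  any′ = foldr′ {E = ⊤} {s = λ i → proj₁ (proj₂ i) ∨ proj₂ (proj₂ i)} (fst ∙ snd ∨′ snd ∙ snd) (con 3 ⊕ var)
           (λ e z xs → ≤-trans (size-Bool (foldr _∨_ z xs)) (m≤m+n 3 _)) ∙ (const′ tt ▵ const′ false ▵ map′ p)

-- Since unary numbers and lists of units share their codes, passing between them costs nothing;
-- addition and multiplication become concatenation and `concatMap`.
enc-length : ∀ (xs : List ⊤) → encℕ (length xs) ≡ encList xs
enc-length []       = refl
enc-length (_ ∷ xs) = cong (node leaf) (enc-length xs)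

enc-replicate : ∀ n → encList (replicate n tt) ≡ encℕ n
enc-replicate zero    = refl
enc-replicate (suc n) = cong (node leaf) (enc-replicate n)

count′ : PT (λ (xs : List ⊤) → length xs)
count′ = recode enc-length

unary′ : PT (λ n → replicate n tt)
unary′ = recode enc-replicate

length′ : ∀ {A} {{_ : Code A}} → PT (λ (xs : List A) → length xs)
length′ {A} = (length-map _) ≗⇒ count′ ∙ map′ {E = ⊤} {A = A} (const′ tt) ∙ (const′ tt ▵ id′)

module _ {A : Set} {{_ : Code A}} {f g : A → ℕ} (p : PT f) (q : PT g) where

  infixl 6 _+′_
  infixl 7 _*′_

  _+′_ : PT (λ a → f a + g a)
  _+′_ = (λ a → trans (length-++ (replicate (f a) tt)) (cong₂ _+_ (length-replicate (f a)) (length-replicate (g a)))) ≗⇒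
    count′ ∙ (unary′ ∙ p ++′ unary′ ∙ q)

  _*′_ : PT (λ a → f a * g a)
  _*′_ = (λ a → product (f a) (g a)) ≗⇒
    count′ ∙ concatMap′ (unary′ ∙ fst) ∙ (q ▵ unary′ ∙ p)
    where
    product : ∀ m n → length (concatMap (λ _ → replicate n tt) (replicate m tt)) ≡ m * n
    product zero    n = refl
    product (suc m) n = trans (length-++ (replicate n tt)) (cong₂ _+_ (length-replicate n) (product m n))

map-replicate-++ : ∀ {A B : Set} (b : B) (xs : List A) → map (λ _ → b) xs ≡ replicate (length xs) b
map-replicate-++ b []       = refl
map-replicate-++ b (x ∷ xs) = cong (b ∷_) (map-replicate-++ b xs)

module _ {A B : Set} {{_ : Code A}} {{_ : Code B}} {f : A → ℕ} {g : A → B} (p : PT f) (q : PT g) where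

  replicate′ : PT (λ a → replicate (f a) (g a))
  replicate′ = (λ a → trans (map-replicate-++ (g a) (replicate (f a) tt)) (cong (λ n → replicate n (g a)) (length-replicate (f a)))) ≗⇒
    map′ fst ∙ (q ▵ unary′ ∙ p)

pred′ : PT pred
pred′ = (λ { zero → refl ; (suc n) → refl }) ≗⇒ case′ {E = ⊤} (const′ 0) (snd ∙ snd) ∙ (const′ tt ▵ id′)

monus′ : PT (λ (i : ℕ × ℕ) → proj₁ i ∸ proj₂ i)
monus′ = (λ { (m , n) → as-∸ m n }) ≗⇒
  foldr′ {E = ⊤} {A = ⊤} {s = λ i → pred (proj₂ (proj₂ i))} (pred′ ∙ snd ∙ snd) var bound ∙ (const′ tt ▵ fst ▵ unary′ ∙ snd)
  where
  as-∸ : ∀ m n → foldr (λ _ → pred) m (replicate n tt) ≡ m ∸ n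
  as-∸ m zero    = refl
  as-∸ m (suc n) = trans (cong pred (as-∸ m n)) (pred[m∸n]≡m∸[1+n] m n)
  pred-size : ∀ n → ⌈ pred n ⌉ ≤ ⌈ n ⌉
  pred-size zero    = ≤-refl
  pred-size (suc n) = m≤n⇒m≤1+n (n≤1+n _)
  go : ∀ z (xs : List ⊤) → ⌈ foldr (λ _ → pred) z xs ⌉ ≤ ⌈ z ⌉
  go z []       = ≤-refl
  go z (x ∷ xs) = ≤-trans (pred-size (foldr (λ _ → pred) z xs)) (go z xs)
  bound : ∀ e z (xs : List ⊤) → ⌈ foldr (λ _ → pred) z xs ⌉ ≤ ⌈ e , z , xs ⌉
  bound e z xs = ≤-trans (go z xs) (≤-trans (m≤m+n _ _) (m≤n+m _ 3))

isZero : ℕ → Bool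
isZero zero    = true
isZero (suc _) = false

isZero′ : PT isZero
isZero′ = (λ { zero → refl ; (suc n) → refl }) ≗⇒ case′ {E = ⊤} (const′ true) (const′ false) ∙ (const′ tt ▵ id′)

null : ∀ {A : Set} → List A → Bool
null []      = true
null (_ ∷ _) = false

null′ : ∀ {A} {{_ : Code A}} → PT (λ (xs : List A) → null xs)
null′ = (λ { [] → refl ; (x ∷ xs) → refl }) ≗⇒ case′ {E = ⊤} (const′ true) (const′ false) ∙ (const′ tt ▵ id′)

record Eq (A : Set) {{_ : Code A}} : Set where
  no-eta-equality
  field
    eq      : A → A → Bool
    eq-PT   : PT (λ (i : A × A) → eq (proj₁ i) (proj₂ i))
    eq⇒≡    : ∀ {a b} → eq a b ≡ true → a ≡ b
    eq-refl : ∀ a → eq a a ≡ true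

open Eq {{...}}

∧-true : ∀ {a b} → a ∧ b ≡ true → a ≡ true × b ≡ true
∧-true {true} {true} _ = refl , refl

∧-intro : ∀ {a b} → a ≡ true → b ≡ true → a ∧ b ≡ true
∧-intro refl refl = refl

eqBits : List Bool → List Bool → Bool
eqBits []       []       = true
eqBits []       (y ∷ ys) = false
eqBits (x ∷ xs) []       = false
eqBits (x ∷ xs) (y ∷ ys) = (if x then y else not y) ∧ eqBits xs ys

private
  Progress : Set
  Progress = Bool × List Bool

  -- Two lists are compared by a fold over the first whose accumulator holds the verdict so far and
  -- the unread rest of the second.
  advance : Bool → Progress → Progress
  advance x (ok , [])     = false , []
  advance x (ok , y ∷ ys) = ok ∧ (if x then y else not y) , ys

  advance′ : PT (λ (i : ⊤ × Progress × Bool) → advance (proj₂ (proj₂ i)) (proj₁ (proj₂ i)))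
  advance′ = (λ { (_ , (ok , []) , x) → refl ; (_ , (ok , y ∷ ys) , x) → refl }) ≗⇒
    case′ (const′ (false , []))
      ((fst ∙ fst ∧′ if′ (snd ∙ fst) (fst ∙ snd) (not′ (fst ∙ snd))) ▵ snd ∙ snd) ∙
    ((fst ∙ fst ∙ snd ▵ snd ∙ snd) ▵ snd ∙ fst ∙ snd)

  eqBits′ : PT (λ (i : List Bool × List Bool) → eqBits (proj₁ i) (proj₂ i))
  eqBits′ = (λ { (xs , ys) → correct xs true ys }) ≗⇒
    (fst ∧′ null′ ∙ snd) ∙ foldl′ {E = ⊤} advance′ (con 4 ⊕ var) bound ∙ (const′ tt ▵ (const′ true ▵ snd) ▵ fst)
    where
    finish : Progress → Bool
    finish (ok , rest) = ok ∧ null rest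
    failed : ∀ xs → finish (foldl (λ p x → advance x p) (false , []) xs) ≡ false
    failed []       = refl
    failed (x ∷ xs) = failed xs
    correct : ∀ xs b ys → finish (foldl (λ p x → advance x p) (b , ys) xs) ≡ b ∧ eqBits xs ys
    correct []       b []       = refl
    correct []       b (y ∷ ys) = refl
    correct (x ∷ xs) b []       = trans (failed xs) (sym (∧-zeroʳ b))
    correct (x ∷ xs) b (y ∷ ys) = trans (correct xs (b ∧ (if x then y else not y)) ys) (∧-assoc b _ _)
    go : ∀ (z : Progress) xs → ⌈ foldl (λ p x → advance x p) z xs ⌉ ≤ 4 + ⌈ proj₂ z ⌉
    go (ok , ys)     []       = s≤s (+-monoˡ-≤ ⌈ ys ⌉ (size-Bool ok))
    go (ok , [])     (x ∷ xs) = go (false , []) xs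
    go (ok , y ∷ ys) (x ∷ xs) = ≤-trans (go (ok ∧ (if x then y else not y) , ys) xs) (+-monoʳ-≤ 4 (m≤n⇒m≤1+n (m≤n+m _ _)))
    bound : ∀ (e : ⊤) (z : Progress) (xs : List Bool) → ⌈ foldl (λ p x → advance x p) z xs ⌉ ≤ 4 + ⌈ e , z , xs ⌉
    bound e z xs = ≤-trans (go z xs) (+-monoʳ-≤ 4 (≤-trans (m≤n⇒m≤1+n (m≤n+m _ ⌈ proj₁ z ⌉)) (≤-trans (m≤m+n _ _) (m≤n+m _ 3))))

  eqBits⇒≡ : ∀ xs ys → eqBits xs ys ≡ true → xs ≡ ys
  eqBits⇒≡ []           []           h = refl
  eqBits⇒≡ (true ∷ xs)  (true ∷ ys)  h = cong (true ∷_) (eqBits⇒≡ xs ys h)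
  eqBits⇒≡ (false ∷ xs) (false ∷ ys) h = cong (false ∷_) (eqBits⇒≡ xs ys h)

  eqBits-refl : ∀ xs → eqBits xs xs ≡ true
  eqBits-refl []           = refl
  eqBits-refl (true ∷ xs)  = eqBits-refl xs
  eqBits-refl (false ∷ xs) = eqBits-refl xs

instance
  eq-Bits : Eq (List Bool)
  eq-Bits .eq        = eqBits
  eq-Bits .eq-PT     = eqBits′
  eq-Bits .eq⇒≡ {xs} = eqBits⇒≡ xs _
  eq-Bits .eq-refl   = eqBits-refl

  eq-Bool : Eq Bool
  eq-Bool .eq x y = if x then y else not y
  eq-Bool .eq-PT  = if′ fst snd (not′ snd)
  eq-Bool .eq⇒≡ {false} {false} _ = refl
  eq-Bool .eq⇒≡ {true}  {true}  _ = refl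
  eq-Bool .eq-refl false = refl
  eq-Bool .eq-refl true  = refl

  eq-× : ∀ {A B} {{_ : Code A}} {{_ : Code B}} {{_ : Eq A}} {{_ : Eq B}} → Eq (A × B)
  eq-× .eq (a , b) (c , d) = eq a c ∧ eq b d
  eq-× .eq-PT = eq-PT ∙ (fst ∙ fst ▵ fst ∙ snd) ∧′ eq-PT ∙ (snd ∙ fst ▵ snd ∙ snd)
  eq-× .eq⇒≡ h = let h₁ , h₂ = ∧-true h in cong₂ _,_ (eq⇒≡ h₁) (eq⇒≡ h₂)
  eq-× .eq-refl (a , b) = ∧-intro (eq-refl a) (eq-refl b)

  eq-ℕ : Eq ℕ
  eq-ℕ .eq m n = isZero (m ∸ n) ∧ isZero (n ∸ m)
  eq-ℕ .eq-PT  = isZero′ ∙ monus′ ∧′ isZero′ ∙ monus′ ∙ (snd ▵ fst)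
  eq-ℕ .eq⇒≡ {m} {n} = go m n
    where
    go : ∀ m n → isZero (m ∸ n) ∧ isZero (n ∸ m) ≡ true → m ≡ n
    go zero    zero    h = refl
    go (suc m) (suc n) h = cong suc (go m n h)
  eq-ℕ .eq-refl n rewrite n∸n≡0 n = refl

module _ {A : Set} {{_ : Code A}} {{_ : Eq A}} where

  elem : A → List A → Bool
  elem x = any (eq x)

  elem′ : PT (λ (i : A × List A) → elem (proj₁ i) (proj₂ i))
  elem′ = any′ eq-PT

  elem⇒∈ : ∀ x ys → elem x ys ≡ true → x ∈ ys
  elem⇒∈ x (y ∷ ys) h with eq x y in eqn
  ... | true  = here (eq⇒≡ eqn)
  ... | false = there (elem⇒∈ x ys h)

  ∈⇒elem : ∀ {x ys} → x ∈ ys → elem x ys ≡ true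
  ∈⇒elem {x} (here refl) rewrite eq-refl x = refl
  ∈⇒elem {x} {y ∷ ys} (there h) with eq x y
  ... | true  = refl
  ... | false = ∈⇒elem h

bump : ∀ {A : Set} → List (ℕ × A) → List (ℕ × A)
bump = map λ (i , x) → suc i , x

indexed : ∀ {A : Set} → List A → List (ℕ × A)
indexed []       = []
indexed (x ∷ xs) = (0 , x) ∷ bump (indexed xs)

-- Every round renumbers what has been built. This adds 2 to the size of each entry, for at most n
-- entries in at most n rounds, whence a quadratic bound.
indexed′ : ∀ {A} {{_ : Code A}} → PT (λ (xs : List A) → indexed xs)
indexed′ {A} = as-indexed ≗⇒
  foldr′ {E = ⊤} {s = λ i → (0 , proj₁ (proj₂ i)) ∷ bump (proj₂ (proj₂ i))}
    (cons′ (const′ 0 ▵ fst ∙ snd) (map′ {E = ⊤} (suc′ (fst ∙ snd) ▵ snd ∙ snd) ∙ (const′ tt ▵ snd ∙ snd)))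
    ((var ⊗ con 2 ⊕ con 3) ⊗ var) bound ∙ (const′ tt ▵ const′ [] ▵ id′)
  where
  as-indexed : ∀ (xs : List A) → foldr (λ a b → (0 , a) ∷ bump b) [] xs ≡ indexed xs
  as-indexed []       = refl
  as-indexed (x ∷ xs) = cong (λ l → (0 , x) ∷ bump l) (as-indexed xs)
  bump-size : ∀ (xs : List (ℕ × A)) → ⌈ bump xs ⌉ ≡ ⌈ xs ⌉ + 2 * length xs
  bump-size []             = refl
  bump-size ((i , x) ∷ xs) = trans (cong (λ n → suc (suc (suc (suc (⌈ i ⌉ + ⌈ x ⌉ + n))))) (bump-size xs))
                                   (lemma ⌈ i ⌉ ⌈ x ⌉ ⌈ xs ⌉ (length xs))
    where
    lemma : ∀ i x s l → 4 + (i + x + (s + 2 * l)) ≡ suc (suc (i + x) + s) + 2 * suc l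
    lemma = solve-∀
  steps : List (ℕ × A) → List A → List (ℕ × A)
  steps = foldr (λ a b → (0 , a) ∷ bump b)
  length-steps : ∀ z xs → length (steps z xs) ≡ length xs + length z
  length-steps z []       = refl
  length-steps z (x ∷ xs) = cong suc (trans (length-map _ (steps z xs)) (length-steps z xs))
  length≤ : ∀ {B : Set} {{_ : Code B}} (xs : List B) → length xs ≤ ⌈ xs ⌉
  length≤ []       = z≤n
  length≤ (x ∷ xs) = s≤s (≤-trans (length≤ xs) (m≤n+m _ _))
  go : ∀ {n} z xs → length xs + length z ≤ n → ⌈ steps z xs ⌉ ≤ (n * 2 + 3) * ⌈ xs ⌉ + ⌈ z ⌉
  go z []           h = m≤n+m _ _
  go {n} z (x ∷ xs) h = ≤-trans
    (s≤s (s≤s (s≤s (+-monoʳ-≤ ⌈ x ⌉ (≤-trans (≤-reflexive (trans (bump-size (steps z xs)) (cong (λ l → ⌈ steps z xs ⌉ + 2 * l) (length-steps z xs))))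
      (+-mono-≤ (go z xs (≤-trans (n≤1+n _) h)) (*-monoʳ-≤ 2 (≤-trans (n≤1+n _) h))))))))
    (≤-trans (m≤m+n _ (n * 2 * ⌈ x ⌉ + 2 * ⌈ x ⌉)) (≤-reflexive (lemma n ⌈ x ⌉ ⌈ xs ⌉ ⌈ z ⌉)))
    where
    lemma : ∀ n x s z → 3 + (x + ((n * 2 + 3) * s + z + 2 * n)) + (n * 2 * x + 2 * x) ≡ (n * 2 + 3) * suc (x + s) + z
    lemma = solve-∀
  bound : ∀ (e : ⊤) (z : List (ℕ × A)) (xs : List A) → ⌈ steps z xs ⌉ ≤ ⟦ (var ⊗ con 2 ⊕ con 3) ⊗ var ⟧ ⌈ e , z , xs ⌉
  bound e z xs = ≤-trans (go z xs len≤) (≤-trans (+-monoʳ-≤ ((n * 2 + 3) * ⌈ xs ⌉) (m≤m*n ⌈ z ⌉ (n * 2 + 3) {{>-nonZero (≤-trans (s≤s z≤n) (m≤n+m 3 (n * 2)))}}))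
    (≤-trans (≤-reflexive (lemma (n * 2 + 3) ⌈ xs ⌉ ⌈ z ⌉)) (*-monoʳ-≤ (n * 2 + 3) (≤-trans (≤-reflexive (+-comm ⌈ xs ⌉ ⌈ z ⌉)) (m≤n+m _ 3)))))
    where
    n = ⌈ e , z , xs ⌉
    lemma : ∀ k x z → k * x + z * k ≡ k * (x + z)
    lemma = solve-∀
    len≤ : length xs + length z ≤ n
    len≤ = ≤-trans (+-mono-≤ (length≤ xs) (length≤ z)) (≤-trans (≤-reflexive (+-comm ⌈ xs ⌉ ⌈ z ⌉)) (m≤n+m _ 3))

indices : ℕ → List ℕ
indices n = map proj₁ (indexed (replicate n tt))

indices′ : PT indices
indices′ = map′ {E = ⊤} (fst ∙ snd) ∙ (const′ tt ▵ indexed′ ∙ unary′)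

-- Binary numbers, integers and the encoding of regions.

undigits : List Bool → ℕᵇ
undigits []           = ℕᵇ.zero
undigits (true ∷ ds)  = 2[1+ undigits ds ]
undigits (false ∷ ds) = 1+[2 undigits ds ]

digits-undigits : ∀ ds → digits (undigits ds) ≡ ds
digits-undigits []           = refl
digits-undigits (true ∷ ds)  = cong (true ∷_) (digits-undigits ds)
digits-undigits (false ∷ ds) = cong (false ∷_) (digits-undigits ds)

undigits-digits : ∀ n → undigits (digits n) ≡ n
undigits-digits ℕᵇ.zero  = refl
undigits-digits 2[1+ n ] = cong 2[1+_] (undigits-digits n)
undigits-digits 1+[2 n ] = cong 1+[2_] (undigits-digits n)

Signed : Set
Signed = Bool × List Bool

signed : ℤ → Signed
signed (pos n)    = false , digits (fromℕ n)
signed -[1+ n ] = true , digits (fromℕ n)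

unsigned : Signed → ℤ
unsigned (false , ds) = pos (Bin.toℕ (undigits ds))
unsigned (true , ds)  = -[1+ Bin.toℕ (undigits ds) ]

digits-toℕ : ∀ ds → digits (fromℕ (Bin.toℕ (undigits ds))) ≡ ds
digits-toℕ ds = trans (cong digits (Bin.fromℕ-toℕ (undigits ds))) (digits-undigits ds)

toℕ-digits : ∀ n → Bin.toℕ (undigits (digits (fromℕ n))) ≡ n
toℕ-digits n = trans (cong Bin.toℕ (undigits-digits (fromℕ n))) (Bin.toℕ-fromℕ n)

signed-unsigned : ∀ r → signed (unsigned r) ≡ r
signed-unsigned (false , ds) = cong (false ,_) (digits-toℕ ds)
signed-unsigned (true , ds)  = cong (true ,_) (digits-toℕ ds)

unsigned-signed : ∀ z → unsigned (signed z) ≡ z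
unsigned-signed (pos n)    = cong pos (toℕ-digits n)
unsigned-signed -[1+ n ] = cong -[1+_] (toℕ-digits n)

directionBits : Direction → Bool × Bool
directionBits north = false , false
directionBits south = false , true
directionBits west  = true , false
directionBits east  = true , true

direction : Bool × Bool → Direction
direction (false , false) = north
direction (false , true)  = south
direction (true , false)  = west
direction (true , true)   = east

direction-bits : ∀ d → direction (directionBits d) ≡ d
direction-bits north = refl
direction-bits south = refl
direction-bits west  = refl
direction-bits east  = refl

bits-direction : ∀ b → directionBits (direction b) ≡ b
bits-direction (false , false) = refl
bits-direction (false , true)  = refl
bits-direction (true , false)  = refl
bits-direction (true , true)   = refl

instance
  code-ℕᵇ : Code ℕᵇ
  code-ℕᵇ .enc n = enc (digits n)

  code-ℤ : Code ℤ
  code-ℤ .enc z = enc (signed z)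

  code-Direction : Code Direction
  code-Direction .enc d = enc (directionBits d)

digits′ : PT digits
digits′ = recode λ _ → refl

undigits′ : PT undigits
undigits′ = recode λ ds → cong enc (digits-undigits ds)

signed′ : PT signed
signed′ = recode λ _ → refl

unsigned′ : PT unsigned
unsigned′ = recode λ r → cong enc (signed-unsigned r)

directionBits′ : PT directionBits
directionBits′ = recode λ _ → refl

direction′ : PT direction
direction′ = recode λ b → cong enc (bits-direction b)

module _ {A B : Set} {{_ : Code A}} {{_ : Code B}} {{_ : Eq B}} (f : A → B) (g : B → A)
         (inv : ∀ a → g (f a) ≡ a) (p : PT f) where

  eq-via : Eq A
  eq-via .eq a b    = eq (f a) (f b)
  eq-via .eq-PT     = eq-PT ∙ (p ∙ fst ▵ p ∙ snd)
  eq-via .eq⇒≡ {a} {b} h = trans (sym (inv a)) (trans (cong g (eq⇒≡ h)) (inv b))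
  eq-via .eq-refl a = eq-refl (f a)

instance
  eq-ℕᵇ : Eq ℕᵇ
  eq-ℕᵇ = eq-via digits undigits undigits-digits digits′

  eq-ℤ : Eq ℤ
  eq-ℤ = eq-via signed unsigned unsigned-signed signed′

  eq-Direction : Eq Direction
  eq-Direction = eq-via directionBits direction direction-bits directionBits′

-- Folds over digits that may also look at the digits not yet folded.
module _ (base : List Bool) (s : Bool → List Bool → List Bool → List Bool)
         (small : ∀ b i ds → ⌈ s b i ds ⌉ ≤ 6 + ⌈ i ⌉ ⊎ ⌈ s b i ds ⌉ ≤ 6 + ⌈ ds ⌉)
         (p : PT (λ (i : Bool × List Bool × List Bool) → s (proj₁ i) (proj₁ (proj₂ i)) (proj₂ (proj₂ i)))) where

  digitRec : List Bool → List Bool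
  digitRec []       = base
  digitRec (b ∷ ds) = s b (digitRec ds) ds

  private
    rec-step : Bool → List Bool × List Bool → List Bool × List Bool
    rec-step b (i , ds) = s b i ds , b ∷ ds

  -- The accumulator carries, next to the result, the digits behind the current one. By `small` a
  -- step lengthens either the recursive result or these digits by a constant, so sizes stay linear.
  digitRec′ : PT digitRec
  digitRec′ = (λ ds → cong proj₁ (correct ds)) ≗⇒
    fst ∙ foldr′ {E = ⊤} {s = λ i → rec-step (proj₁ (proj₂ i)) (proj₂ (proj₂ i))}
      (p ∙ snd ▵ cons′ (fst ∙ snd) (snd ∙ snd ∙ snd)) (con 9 ⊗ var) bound ∙
    (const′ tt ▵ const′ (base , []) ▵ id′)
    where
    correct : ∀ ds → foldr rec-step (base , []) ds ≡ (digitRec ds , ds)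
    correct []       = refl
    correct (b ∷ ds) = cong (rec-step b) (correct ds)
    second : ∀ z xs → proj₂ (foldr rec-step z xs) ≡ xs ++ proj₂ z
    second z []       = refl
    second z (x ∷ xs) = cong (x ∷_) (second z xs)
    first : ∀ (z : List Bool × List Bool) xs → ⌈ proj₁ (foldr rec-step z xs) ⌉ ≤ 7 * ⌈ xs ⌉ + (⌈ proj₁ z ⌉ + ⌈ proj₂ z ⌉)
    first z []       = ≤-trans (m≤m+n _ _) (m≤n+m _ 7)
    first z (x ∷ xs) with small x (proj₁ (foldr rec-step z xs)) (proj₂ (foldr rec-step z xs))
    ... | inj₁ h = ≤-trans h (≤-trans (+-monoʳ-≤ 6 (first z xs)) (≤-trans (m≤m+n _ (1 + 7 * ⌈ x ⌉)) (≤-reflexive (lemma ⌈ x ⌉ ⌈ xs ⌉ _))))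
      where
      lemma : ∀ x s z → 6 + (7 * s + z) + (1 + 7 * x) ≡ 7 * suc (x + s) + z
      lemma = solve-∀
    ... | inj₂ h = ≤-trans h (≤-trans (+-monoʳ-≤ 6 (≤-trans (≤-reflexive (cong ⌈_⌉ (second z xs))) (size-++ xs (proj₂ z))))
      (≤-trans (m≤m+n _ (1 + 7 * ⌈ x ⌉ + 6 * ⌈ xs ⌉ + ⌈ proj₁ z ⌉)) (≤-reflexive (lemma ⌈ x ⌉ ⌈ xs ⌉ ⌈ proj₁ z ⌉ ⌈ proj₂ z ⌉))))
      where
      lemma : ∀ x s y z → 6 + (s + z) + (1 + 7 * x + 6 * s + y) ≡ 7 * suc (x + s) + (y + z)
      lemma = solve-∀
    bound : ∀ (e : ⊤) (z : List Bool × List Bool) (xs : List Bool) → ⌈ foldr rec-step z xs ⌉ ≤ 9 * ⌈ e , z , xs ⌉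
    bound e z xs = ≤-trans
      (s≤s (+-mono-≤ (first z xs) (≤-trans (≤-reflexive (cong ⌈_⌉ (second z xs))) (size-++ xs (proj₂ z)))))
      (≤-trans (m≤m+n _ (35 + 8 * ⌈ proj₁ z ⌉ + 7 * ⌈ proj₂ z ⌉ + ⌈ xs ⌉)) (≤-reflexive (lemma ⌈ proj₁ z ⌉ ⌈ proj₂ z ⌉ ⌈ xs ⌉)))
      where
      lemma : ∀ y z s → suc (7 * s + (y + z) + (s + z)) + (35 + 8 * y + 7 * z + s) ≡ 9 * suc (1 + suc (suc (y + z) + s))
      lemma = solve-∀

-- In bijective base 2 a digit 2 (`true`) overflows to 1 with a carry, and a digit 1 becomes 2.
-- Doubling rests on 2(2+2n) = 2(1+(1+2n)) and on reading 2(1+2n) as the digit 2 followed by the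
-- digits of 2n. It is needed for the predecessor of 1+2n.
incStep doubleStep : Bool → List Bool → List Bool → List Bool
incStep    b i ds = if b then false ∷ i else true ∷ ds
doubleStep b i ds = if b then true ∷ false ∷ ds else true ∷ i

incStep-small : ∀ b i ds → ⌈ incStep b i ds ⌉ ≤ 6 + ⌈ i ⌉ ⊎ ⌈ incStep b i ds ⌉ ≤ 6 + ⌈ ds ⌉
incStep-small true  i ds = inj₁ (m≤n+m _ 4)
incStep-small false i ds = inj₂ (m≤n+m _ 2)

doubleStep-small : ∀ b i ds → ⌈ doubleStep b i ds ⌉ ≤ 6 + ⌈ i ⌉ ⊎ ⌈ doubleStep b i ds ⌉ ≤ 6 + ⌈ ds ⌉
doubleStep-small true  i ds = inj₂ ≤-refl
doubleStep-small false i ds = inj₁ (m≤n+m _ 2)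

incStep′ : PT (λ (i : Bool × List Bool × List Bool) → incStep (proj₁ i) (proj₁ (proj₂ i)) (proj₂ (proj₂ i)))
incStep′ = if′ fst (cons′ (const′ false) (fst ∙ snd)) (cons′ (const′ true) (snd ∙ snd))

doubleStep′ : PT (λ (i : Bool × List Bool × List Bool) → doubleStep (proj₁ i) (proj₁ (proj₂ i)) (proj₂ (proj₂ i)))
doubleStep′ = if′ fst (cons′ (const′ true) (cons′ (const′ false) (snd ∙ snd))) (cons′ (const′ true) (fst ∙ snd))

incDigits doubleDigits predDigits : List Bool → List Bool
incDigits    = digitRec (false ∷ []) incStep incStep-small incStep′
doubleDigits = digitRec [] doubleStep doubleStep-small doubleStep′
predDigits []           = []
predDigits (true ∷ ds)  = false ∷ ds
predDigits (false ∷ ds) = doubleDigits ds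

incDigits′ : PT incDigits
incDigits′ = digitRec′ (false ∷ []) incStep incStep-small incStep′

predDigits′ : PT predDigits
predDigits′ = (λ { [] → refl ; (true ∷ ds) → refl ; (false ∷ ds) → refl }) ≗⇒
  case′ {E = ⊤} (const′ []) (if′ (fst ∙ snd) (cons′ (const′ false) (snd ∙ snd)) (digitRec′ [] doubleStep doubleStep-small doubleStep′ ∙ snd ∙ snd)) ∙
  (const′ tt ▵ id′)

digits-suc : ∀ n → digits (Bin.suc n) ≡ incDigits (digits n)
digits-suc ℕᵇ.zero  = refl
digits-suc 2[1+ n ] = cong (false ∷_) (digits-suc n)
digits-suc 1+[2 n ] = refl

digits-double : ∀ n → digits (Bin.double n) ≡ doubleDigits (digits n)
digits-double ℕᵇ.zero  = refl
digits-double 2[1+ n ] = refl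
digits-double 1+[2 n ] = cong (true ∷_) (digits-double n)

digits-pred : ∀ n → digits (Bin.pred n) ≡ predDigits (digits n)
digits-pred ℕᵇ.zero  = refl
digits-pred 2[1+ n ] = refl
digits-pred 1+[2 n ] = digits-double n

fromℕ-suc : ∀ n → fromℕ (suc n) ≡ Bin.suc (fromℕ n)
fromℕ-suc n = trans (Bin.fromℕ≡fromℕ' (suc n)) (cong Bin.suc (sym (Bin.fromℕ≡fromℕ' n)))

sucSigned : Signed → Signed
sucSigned (s , ds) = if s then (if null ds then (false , []) else (true , predDigits ds)) else (false , incDigits ds)

-- Since `-[1+ n ]` is stored with the digits of n, flipping the sign bit is the map from z to -1-z.
-- It conjugates the successor into the predecessor.
negate : Signed → Signed
negate (s , ds) = not s , ds

sucSigned′ : PT sucSigned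
sucSigned′ = if′ fst (if′ (null′ ∙ snd) (const′ (false , [])) (const′ true ▵ predDigits′ ∙ snd)) (const′ false ▵ incDigits′ ∙ snd)

signed-suc : ∀ z → signed (sucℤ z) ≡ sucSigned (signed z)
signed-suc (pos n)        = cong (false ,_) (trans (cong digits (fromℕ-suc n)) (digits-suc (fromℕ n)))
signed-suc -[1+ zero ]  = refl
signed-suc -[1+ suc n ] = trans (cong (true ,_) (trans (cong digits (Bin.fromℕ-pred (suc n))) (digits-pred (fromℕ (suc n)))))
                                (nonempty (fromℕ (suc n)) (λ eq → 0≢1+n (trans (sym (cong Bin.toℕ eq)) (Bin.toℕ-fromℕ (suc n)))))
  where
  nonempty : ∀ m → m ≢ ℕᵇ.zero → (true , predDigits (digits m)) ≡ sucSigned (true , digits m)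
  nonempty ℕᵇ.zero  h = ⊥-elim (h refl)
  nonempty 2[1+ m ] h = refl
  nonempty 1+[2 m ] h = refl

signed-pred : ∀ z → signed (predℤ z) ≡ negate (sucSigned (negate (signed z)))
signed-pred (pos zero)    = refl
signed-pred (pos (suc n))   = cong negate (signed-suc -[1+ suc n ])
signed-pred -[1+ n ]    = cong negate (signed-suc (pos n))

sucℤ′ : PT sucℤ
sucℤ′ = (λ z → trans (cong unsigned (sym (signed-suc z))) (unsigned-signed (sucℤ z))) ≗⇒ unsigned′ ∙ sucSigned′ ∙ signed′

predℤ′ : PT predℤ
predℤ′ = (λ z → trans (cong unsigned (sym (signed-pred z))) (unsigned-signed (predℤ z))) ≗⇒
  unsigned′ ∙ negate′ ∙ sucSigned′ ∙ negate′ ∙ signed′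
  where
  negate′ : PT negate
  negate′ = not′ fst ▵ snd

neighbour′ : PT (λ (i : Direction × Square) → neighbour (proj₁ i) (proj₂ i))
neighbour′ = (λ { (north , a) → refl ; (south , a) → refl ; (west , a) → refl ; (east , a) → refl }) ≗⇒
  if′ (fst ∙ directionBits′ ∙ fst)
    (if′ (snd ∙ directionBits′ ∙ fst) (sucℤ′ ∙ fst ∙ snd ▵ snd ∙ snd) (predℤ′ ∙ fst ∙ snd ▵ snd ∙ snd))
    (if′ (snd ∙ directionBits′ ∙ fst) (fst ∙ snd ▵ predℤ′ ∙ snd ∙ snd) (fst ∙ snd ▵ sucℤ′ ∙ snd ∙ snd))

encodeList′ : ∀ {A} {{_ : Code A}} {e : A → List Bool} → PT e → PT (λ (xs : List A) → encodeList e xs)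
encodeList′ {e = e} p = as-encodeList ≗⇒
  concatMap′ {E = ⊤} (cons′ (const′ true) (p ∙ snd)) ∙ (const′ tt ▵ id′) ++′ const′ (false ∷ [])
  where
  as-encodeList : ∀ xs → concatMap (λ x → true ∷ e x) xs ++ false ∷ [] ≡ encodeList e xs
  as-encodeList []       = refl
  as-encodeList (x ∷ xs) = cong (true ∷_) (trans (++-assoc (e x) _ _) (cong (e x ++_) (as-encodeList xs)))

encodeBits : List Bool → List Bool
encodeBits = encodeList (λ b → b ∷ [])

encodeBits′ : PT encodeBits
encodeBits′ = encodeList′ (cons′ id′ (const′ []))

encodeℤ′ : PT encodeℤ
encodeℤ′ = (λ { (pos n) → refl ; -[1+ n ] → refl }) ≗⇒ cons′ (fst ∙ signed′) (encodeBits′ ∙ snd ∙ signed′)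

encodeSquare′ : PT encodeSquare
encodeSquare′ = encodeℤ′ ∙ fst ++′ encodeℤ′ ∙ snd

encodeDirection′ : PT encodeDirection
encodeDirection′ = (λ { north → refl ; south → refl ; west → refl ; east → refl }) ≗⇒
  cons′ (fst ∙ directionBits′) (cons′ (snd ∙ directionBits′) (const′ []))

encodeSegment′ : PT encodeSegment
encodeSegment′ = encodeSquare′ ∙ fst ++′ encodeDirection′ ∙ snd

-- The input word writes colours in binary, so a region with unary colours could be exponentially
-- larger than its word. The checker therefore works with `ℕᵇ` throughout.
BinaryRegion : Set
BinaryRegion = List Square × List (Segment × ℕᵇ)

toRegion : BinaryRegion → Region
toRegion (squares , boundary) = region squares (map (λ (s , c) → s , Bin.toℕ c) boundary)

encodeRegion′ : PT (λ (D : BinaryRegion) → encodeRegion (toRegion D))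
encodeRegion′ = (λ (squares , boundary) → cong (encodeList encodeSquare squares ++_) (as-boundary boundary)) ≗⇒
  encodeList′ encodeSquare′ ∙ fst ++′ encodeList′ (encodeSegment′ ∙ fst ++′ encodeBits′ ∙ digits′ ∙ snd) ∙ snd
  where
  as-boundary : ∀ bs → encodeList (λ (s , c) → encodeSegment s ++ encodeBits (digits c)) bs ≡
                       encodeList (encodePair encodeSegment encodeℕ) (map (λ (s , c) → s , Bin.toℕ c) bs)
  as-boundary []             = refl
  as-boundary ((s , c) ∷ bs) = cong (true ∷_) (cong₂ _++_
    (cong (λ n → encodeSegment s ++ encodeBits (digits n)) (sym (Bin.fromℕ-toℕ c))) (as-boundary bs))

-- Certificates as trees and as words.

record Decode (A : Set) {{_ : Code A}} : Set where
  no-eta-equality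
  field
    dec     : Tree → A
    dec-enc : ∀ a → dec (enc a) ≡ a
    dec-PT  : PT dec

open Decode {{...}}

decode-via : ∀ {A B : Set} {{_ : Code A}} {{_ : Code B}} {{_ : Decode B}} (f : A → B) (g : B → A) →
             (∀ a → g (f a) ≡ a) → (∀ a → enc (f a) ≡ enc a) → PT g → Decode A
decode-via f g inv same p .dec     = g ∘ dec
decode-via f g inv same p .dec-enc a = trans (cong (g ∘ dec) (sym (same a))) (trans (cong g (dec-enc (f a))) (inv a))
decode-via f g inv same p .dec-PT  = p ∙ dec-PT

children : Tree → List Tree
children leaf       = []
children (node a b) = a ∷ children b

enc-children : ∀ t → encList (children t) ≡ t
enc-children leaf       = refl
enc-children (node a b) = cong (node a) (enc-children b)

instance
  decode-Bool : Decode Bool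
  decode-Bool .dec leaf       = false
  decode-Bool .dec (node _ _) = true
  decode-Bool .dec-enc false = refl
  decode-Bool .dec-enc true  = refl
  decode-Bool .dec-PT = (λ { leaf → refl ; (node _ _) → refl }) ≗⇒
    case′ {E = ⊤} (const′ false) (const′ true) ∙ (const′ tt ▵ id′)

  decode-× : ∀ {A B} {{_ : Code A}} {{_ : Code B}} {{_ : Decode A}} {{_ : Decode B}} → Decode (A × B)
  -- The guess may be any tree, so decoding has to be total. A tree of the wrong shape gets some
  -- default value, which the check then treats like any other certificate.
  decode-× .dec leaf       = dec leaf , dec leaf
  decode-× .dec (node a b) = dec a , dec b
  decode-× .dec-enc (a , b) = cong₂ _,_ (dec-enc a) (dec-enc b)
  decode-× .dec-PT = (λ { leaf → refl ; (node _ _) → refl }) ≗⇒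
    case′ {E = ⊤} (const′ _) (dec-PT ∙ fst ∙ snd ▵ dec-PT ∙ snd ∙ snd) ∙ (const′ tt ▵ id′)

  decode-List : ∀ {A} {{_ : Code A}} {{_ : Decode A}} → Decode (List A)
  decode-List .dec t = map dec (children t)
  decode-List .dec-enc []       = refl
  decode-List .dec-enc (x ∷ xs) = cong₂ _∷_ (dec-enc x) (dec-enc xs)
  decode-List .dec-PT = map′ {E = ⊤} (dec-PT ∙ snd) ∙ (const′ tt ▵ recode enc-children)

  decode-ℕᵇ : Decode ℕᵇ
  decode-ℕᵇ = decode-via digits undigits undigits-digits (λ _ → refl) undigits′

  decode-ℤ : Decode ℤ
  decode-ℤ = decode-via signed unsigned unsigned-signed (λ _ → refl) unsigned′

  decode-Direction : Decode Direction
  decode-Direction = decode-via directionBits direction direction-bits (λ _ → refl) direction′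

treeBits : Tree → List Bool
treeBits leaf       = false ∷ []
treeBits (node a b) = true ∷ treeBits a ++ treeBits b

length-treeBits : ∀ t → length (treeBits t) ≡ size t
length-treeBits leaf       = refl
length-treeBits (node a b) = cong suc (trans (length-++ (treeBits a)) (cong₂ _+_ (length-treeBits a) (length-treeBits b)))

join : List Tree → List Tree
join (a ∷ b ∷ ts) = node a b ∷ ts
join ts           = ts

-- Read from the right, a word in preorder is in postfix order: a leaf is pushed, and an inner
-- vertex joins the two topmost trees.
shiftReduce : Bool → List Tree → List Tree
shiftReduce b ts = if b then join ts else leaf ∷ ts

headTree : List Tree → Tree
headTree []      = leaf
headTree (t ∷ _) = t

parse : List Bool → Tree
parse bs = headTree (foldr shiftReduce [] bs)

parse-treeBits : ∀ t → parse (treeBits t) ≡ t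
parse-treeBits t = cong headTree (trans (cong (foldr shiftReduce []) (sym (++-identityʳ (treeBits t)))) (go t [] ))
  where
  go : ∀ t bs → foldr shiftReduce [] (treeBits t ++ bs) ≡ t ∷ foldr shiftReduce [] bs
  go leaf       bs = refl
  go (node a b) bs = trans (cong (join ∘ foldr shiftReduce []) (++-assoc (treeBits a) (treeBits b) bs))
    (trans (cong join (go a (treeBits b ++ bs))) (cong (λ ts → join (a ∷ ts)) (go b bs)))

parse′ : PT parse
parse′ = headTree′ ∙ foldr′ {E = ⊤} {s = λ i → shiftReduce (proj₁ (proj₂ i)) (proj₂ (proj₂ i))}
  (if′ (fst ∙ snd) (join′ ∙ snd ∙ snd) (cons′ (const′ leaf) (snd ∙ snd))) (con 2 ⊗ var) bound ∙ (const′ tt ▵ const′ [] ▵ id′)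
  where
  headTree′ : PT headTree
  headTree′ = (λ { [] → refl ; (t ∷ ts) → refl }) ≗⇒ case′ {E = ⊤} (const′ leaf) (fst ∙ snd) ∙ (const′ tt ▵ id′)
  join′ : PT join
  join′ = (λ { [] → refl ; (a ∷ []) → refl ; (a ∷ b ∷ ts) → refl }) ≗⇒
    case′ id′ (case′ fst (cons′ (recode {f = λ (ab : Tree × Tree) → node (proj₁ ab) (proj₂ ab)} (λ _ → refl) ∙ (snd ∙ fst ▵ fst ∙ snd)) (snd ∙ snd)) ∙
                ((fst ▵ fst ∙ snd) ▵ snd ∙ snd)) ∙ (id′ ▵ id′)
  join-size : ∀ ts → ⌈ join ts ⌉ ≤ ⌈ ts ⌉
  join-size []           = ≤-refl
  join-size (a ∷ [])     = ≤-refl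
  join-size (a ∷ b ∷ ts) = ≤-reflexive (lemma (size a) (size b) ⌈ ts ⌉)
    where
    lemma : ∀ a b s → 1 + (1 + (a + b) + s) ≡ 1 + (a + (1 + (b + s)))
    lemma = solve-∀
  go : ∀ (z : List Tree) (bs : List Bool) → ⌈ foldr shiftReduce z bs ⌉ ≤ 2 * ⌈ bs ⌉ + ⌈ z ⌉
  go z []           = m≤n+m _ 2
  go z (true ∷ bs)  = ≤-trans (join-size (foldr shiftReduce z bs)) (≤-trans (go z bs) (+-monoˡ-≤ ⌈ z ⌉ (*-monoʳ-≤ 2 (m≤n+m ⌈ bs ⌉ 4))))
  go z (false ∷ bs) = ≤-trans (s≤s (s≤s (go z bs))) (≤-trans (m≤n+m _ 2) (≤-reflexive (lemma ⌈ bs ⌉ ⌈ z ⌉)))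
    where
    lemma : ∀ b z → 4 + (2 * b + z) ≡ 2 * (2 + b) + z
    lemma = solve-∀
  bound : ∀ (e : ⊤) (z : List Tree) (bs : List Bool) → ⌈ foldr shiftReduce z bs ⌉ ≤ 2 * ⌈ e , z , bs ⌉
  bound e z bs = ≤-trans (go z bs) (≤-trans (m≤m+n _ (6 + ⌈ z ⌉)) (≤-reflexive (lemma ⌈ bs ⌉ ⌈ z ⌉)))
    where
    lemma : ∀ b z → 2 * b + z + (6 + z) ≡ 2 * (3 + (z + b))
    lemma = solve-∀

record Checker (L : Language) : Set₁ where
  field
    Certificate : Set
    {{codeC}}   : Code Certificate
    {{decodeC}} : Decode Certificate
    check       : List Bool × Certificate → Bool
    check-PT    : PT check
    sound       : ∀ x c → check (x , c) ≡ true → L x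
    size-bound  : Poly
    complete    : ∀ x → L x → ∃[ c ] (⌈ c ⌉ ≤ ⟦ size-bound ⟧ (length x) × check (x , c) ≡ true)

Checker⇒NP : ∀ {L} → Checker L → NP L
Checker⇒NP {L} k = Verifier⇒NP record
  { verify      = λ (x , y) → check (x , dec (parse y))
  ; verify-PT   = check-PT ∙ (fst ▵ dec-PT ∙ parse′ ∙ snd)
  ; sound       = λ x y → sound x (dec (parse y))
  ; certificate = size-bound
  ; complete    = λ x Lx → let c , c≤ , ok = complete x Lx in
      treeBits (enc c) , ≤-trans (≤-reflexive (length-treeBits (enc c))) c≤ ,
      trans (cong (λ d → check (x , d)) (trans (cong dec (parse-treeBits (enc c))) (dec-enc c))) ok
  }
  where open Checker k

module _ {A : Set} {{_ : Code A}} {{_ : Eq A}} where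

  distinct : List A → Bool
  distinct []       = true
  distinct (x ∷ xs) = not (elem x xs) ∧ distinct xs

  private
    step : A → Bool × List A → Bool × List A
    step x (ok , xs) = not (elem x xs) ∧ ok , x ∷ xs

  distinct′ : PT distinct
  distinct′ = (λ xs → cong proj₁ (correct xs)) ≗⇒
    fst ∙ foldr′ {E = ⊤} {s = λ i → step (proj₁ (proj₂ i)) (proj₂ (proj₂ i))}
      ((not′ (elem′ ∙ (fst ∙ snd ▵ snd ∙ snd ∙ snd)) ∧′ fst ∙ snd ∙ snd) ▵ cons′ (fst ∙ snd) (snd ∙ snd ∙ snd))
      (con 4 ⊕ var) bound ∙ (const′ tt ▵ const′ (true , []) ▵ id′)
    where
    correct : ∀ xs → foldr step (true , []) xs ≡ (distinct xs , xs)
    correct []       = refl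
    correct (x ∷ xs) = cong (step x) (correct xs)
    second : ∀ z xs → proj₂ (foldr step z xs) ≡ xs ++ proj₂ z
    second z []       = refl
    second z (x ∷ xs) = cong (x ∷_) (second z xs)
    bound : ∀ (e : ⊤) (z : Bool × List A) (xs : List A) → ⌈ foldr step z xs ⌉ ≤ 4 + ⌈ e , z , xs ⌉
    bound e z xs = s≤s (+-mono-≤ (size-Bool (proj₁ (foldr step z xs)))
      (≤-trans (≤-reflexive (cong ⌈_⌉ (second z xs))) (≤-trans (size-++ xs (proj₂ z))
      (≤-trans (m≤m+n _ (4 + ⌈ proj₁ z ⌉)) (≤-reflexive (lemma ⌈ xs ⌉ ⌈ proj₂ z ⌉ ⌈ proj₁ z ⌉))))))
      where
      lemma : ∀ s z b → s + z + (4 + b) ≡ 3 + (suc (b + z) + s)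
      lemma = solve-∀

  distinct⇒Unique : ∀ xs → distinct xs ≡ true → Unique xs
  distinct⇒Unique []       h = []
  distinct⇒Unique (x ∷ xs) h with elem x xs in eqn
  ... | false = ¬Any⇒All¬ xs (λ x∈ → case trans (sym eqn) (∈⇒elem x∈) of λ ()) ∷ distinct⇒Unique xs h

  Unique⇒distinct : ∀ {xs} → Unique xs → distinct xs ≡ true
  Unique⇒distinct []             = refl
  Unique⇒distinct {x ∷ xs} (x∉ ∷ u) with elem x xs in eqn
  ... | false = Unique⇒distinct u
  ... | true  = ⊥-elim (All¬⇒¬Any x∉ (elem⇒∈ x xs eqn))

-- Tracing lattice walks in polynomial time.

trace : Square → List Direction → List Square
trace a []       = a ∷ []
trace a (d ∷ ds) = a ∷ trace (neighbour d a) ds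

digitCount : ℤ → ℕ
digitCount z = length (proj₂ (signed z))

length-inc : ∀ ds → length (incDigits ds) ≤ suc (length ds)
length-inc []           = ≤-refl
length-inc (true ∷ ds)  = s≤s (length-inc ds)
length-inc (false ∷ ds) = n≤1+n _

length-double : ∀ ds → length (doubleDigits ds) ≤ suc (length ds)
length-double []           = z≤n
length-double (true ∷ ds)  = ≤-refl
length-double (false ∷ ds) = s≤s (length-double ds)

length-sucSigned : ∀ r → length (proj₂ (sucSigned r)) ≤ suc (length (proj₂ r))
length-sucSigned (false , ds)        = length-inc ds
length-sucSigned (true , [])         = z≤n
length-sucSigned (true , true ∷ ds)  = n≤1+n _
length-sucSigned (true , false ∷ ds) = m≤n⇒m≤1+n (length-double ds)

digitCount-suc : ∀ z → digitCount (sucℤ z) ≤ suc (digitCount z)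
digitCount-suc z = subst (λ r → length (proj₂ r) ≤ suc (digitCount z)) (sym (signed-suc z)) (length-sucSigned (signed z))

digitCount-pred : ∀ z → digitCount (predℤ z) ≤ suc (digitCount z)
digitCount-pred z = subst (λ r → length (proj₂ r) ≤ suc (digitCount z)) (sym (signed-pred z)) (length-sucSigned (negate (signed z)))

squareDigits : Square → ℕ
squareDigits (x , y) = digitCount x + digitCount y

squareDigits-neighbour : ∀ d a → squareDigits (neighbour d a) ≤ suc (squareDigits a)
squareDigits-neighbour north (x , y) = ≤-trans (+-monoʳ-≤ (digitCount x) (digitCount-suc y)) (≤-reflexive (+-suc _ _))
squareDigits-neighbour south (x , y) = ≤-trans (+-monoʳ-≤ (digitCount x) (digitCount-pred y)) (≤-reflexive (+-suc _ _))
squareDigits-neighbour west  (x , y) = +-monoˡ-≤ (digitCount y) (digitCount-pred x)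
squareDigits-neighbour east  (x , y) = +-monoˡ-≤ (digitCount y) (digitCount-suc x)

size-ℤ : ∀ (z : ℤ) → ⌈ z ⌉ ≤ 5 + 4 * digitCount z
size-ℤ z = ≤-trans (s≤s (+-mono-≤ (size-Bool (proj₁ (signed z))) (word-size (proj₂ (signed z)))))
                   (≤-reflexive (lemma (digitCount z)))
  where
  lemma : ∀ n → 1 + (3 + (4 * n + 1)) ≡ 5 + 4 * n
  lemma = solve-∀

size-Square : ∀ (a : Square) → ⌈ a ⌉ ≤ 11 + 4 * squareDigits a
size-Square (x , y) = ≤-trans (s≤s (+-mono-≤ (size-ℤ x) (size-ℤ y))) (≤-reflexive (lemma (digitCount x) (digitCount y)))
  where
  lemma : ∀ m n → 1 + (5 + 4 * m + (5 + 4 * n)) ≡ 11 + 4 * (m + n)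
  lemma = solve-∀

digitCount≤ : ∀ (z : ℤ) → digitCount z ≤ ⌈ z ⌉
digitCount≤ z = ≤-trans (length≤size (proj₂ (signed z))) (m≤n⇒m≤1+n (m≤n+m _ _))

-- Coordinates are binary and gain at most one digit per move. So k moves from a square with m
-- digits yield k+1 squares of size linear in m+k.
trace′ : PT (λ (i : Square × List Direction) → trace (proj₁ i) (proj₂ i))
trace′ = (λ (a , ds) → correct a [] ds) ≗⇒
  reverse′ ∙ cons′ fst snd ∙ foldl′ {E = ⊤} {s = λ i → step (proj₁ (proj₂ i)) (proj₂ (proj₂ i))}
    (neighbour′ ∙ (snd ∙ snd ▵ fst ∙ fst ∙ snd) ▵ cons′ (fst ∙ fst ∙ snd) (snd ∙ fst ∙ snd))
    (con 1 ⊕ var ⊕ (con 1 ⊕ var) ⊗ (con 12 ⊕ con 4 ⊗ (var ⊕ var))) bound ∙ (const′ tt ▵ (fst ▵ const′ []) ▵ snd)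
  where
  step : Square × List Square → Direction → Square × List Square
  step (p , vs) d = neighbour d p , p ∷ vs
  correct : ∀ a vs ds → (let q = foldl step (a , vs) ds in reverse (proj₁ q ∷ proj₂ q)) ≡ vs ʳ++ trace a ds
  correct a vs []       = refl
  correct a vs (d ∷ ds) = correct (neighbour d a) (a ∷ vs) ds
  go : ∀ (a : Square) (vs : List Square) ds →
       ⌈ foldl step (a , vs) ds ⌉ ≤ 1 + ⌈ vs ⌉ + (1 + length ds) * (12 + 4 * (squareDigits a + length ds))
  go a vs [] = ≤-trans (s≤s (+-monoˡ-≤ ⌈ vs ⌉ (size-Square a)))
    (≤-trans (n≤1+n _) (≤-reflexive (lemma ⌈ vs ⌉ (squareDigits a))))
    where
    lemma : ∀ v m → 2 + (11 + 4 * m + v) ≡ 1 + v + (1 + 0) * (12 + 4 * (m + 0))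
    lemma = solve-∀
  go a vs (d ∷ ds) = ≤-trans (go (neighbour d a) (a ∷ vs) ds) (≤-trans
    (+-mono-≤ {1 + ⌈ a ∷ vs ⌉} {1 + (1 + (11 + 4 * squareDigits a + ⌈ vs ⌉))} (s≤s (s≤s (+-monoˡ-≤ ⌈ vs ⌉ (size-Square a))))
      (*-monoʳ-≤ (1 + length ds) (+-monoʳ-≤ 12 (*-monoʳ-≤ 4 (+-monoˡ-≤ (length ds) (squareDigits-neighbour d a))))))
    (≤-trans (m≤m+n _ (4 * suc (length ds))) (≤-reflexive (lemma ⌈ vs ⌉ (squareDigits a) (length ds)))))
    where
    lemma : ∀ v m k → 1 + (1 + (11 + 4 * m + v)) + (1 + k) * (12 + 4 * (1 + m + k)) + 4 * (1 + k)
                      ≡ 1 + v + (1 + (1 + k)) * (12 + 4 * (m + (1 + k)))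
    lemma = solve-∀
  bound : ∀ (e : ⊤) (z : Square × List Square) (ds : List Direction) →
          ⌈ foldl step z ds ⌉ ≤ ⟦ con 1 ⊕ var ⊕ (con 1 ⊕ var) ⊗ (con 12 ⊕ con 4 ⊗ (var ⊕ var)) ⟧ ⌈ e , z , ds ⌉
  bound e z@(a@(x , y) , vs) ds = ≤-trans (go a vs ds) (+-mono-≤ (s≤s vs≤)
      (*-mono-≤ (s≤s ds≤) (+-monoʳ-≤ 12 (*-monoʳ-≤ 4 (+-mono-≤ a≤ ds≤)))))
    where
    length≤ : ∀ (ds : List Direction) → length ds ≤ ⌈ ds ⌉
    length≤ []       = z≤n
    length≤ (d ∷ ds) = s≤s (≤-trans (length≤ ds) (m≤n+m _ _))
    z≤ : ⌈ z ⌉ ≤ ⌈ e , z , ds ⌉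
    z≤ = ≤-trans (m≤m+n _ _) (m≤n+m _ 3)
    vs≤ : ⌈ vs ⌉ ≤ ⌈ e , z , ds ⌉
    vs≤ = ≤-trans (m≤n⇒m≤1+n (m≤n+m _ ⌈ a ⌉)) z≤
    ds≤ : length ds ≤ ⌈ e , z , ds ⌉
    ds≤ = ≤-trans (length≤ ds) (≤-trans (m≤n+m _ ⌈ z ⌉) (m≤n+m _ 3))
    a≤ : squareDigits a ≤ ⌈ e , z , ds ⌉
    a≤ = ≤-trans (+-mono-≤ (digitCount≤ x) (digitCount≤ y)) (≤-trans (n≤1+n _) (≤-trans (m≤n⇒m≤1+n (m≤m+n ⌈ a ⌉ ⌈ vs ⌉)) z≤))

-- Connectedness of a region and of its complement, and short walks that witness it.

sucℤ-predℤ : ∀ z → sucℤ (predℤ z) ≡ z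
sucℤ-predℤ (pos zero)    = refl
sucℤ-predℤ (pos (suc n)) = refl
sucℤ-predℤ -[1+ n ]      = refl

predℤ-sucℤ : ∀ z → predℤ (sucℤ z) ≡ z
predℤ-sucℤ (pos n)       = refl
predℤ-sucℤ -[1+ zero ]   = refl
predℤ-sucℤ -[1+ suc n ]  = refl

neighbour-opposite : ∀ d a → neighbour (opposite d) (neighbour d a) ≡ a
neighbour-opposite north (x , y) = cong (x ,_) (predℤ-sucℤ y)
neighbour-opposite south (x , y) = cong (x ,_) (sucℤ-predℤ y)
neighbour-opposite west  (x , y) = cong (_, y) (sucℤ-predℤ x)
neighbour-opposite east  (x , y) = cong (_, y) (predℤ-sucℤ x)

Adjacent : (Square → Set) → Square → Square → Set
Adjacent P a b = P a × P b × ∃[ d ] b ≡ neighbour d a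

Joined : (Square → Set) → Square → Square → Set
Joined P = Star (Adjacent P)

adjacent-sym : ∀ {P a b} → Adjacent P a b → Adjacent P b a
adjacent-sym (Pa , Pb , d , refl) = Pb , Pa , opposite d , sym (neighbour-opposite d _)

joined-sym : ∀ {P a b} → Joined P a b → Joined P b a
joined-sym = Star.reverse adjacent-sym

∈-or-∉ : ∀ {A : Set} {{_ : Code A}} {{_ : Eq A}} (a : A) xs → a ∈ xs ⊎ a ∉ xs
∈-or-∉ a xs with elem a xs in eqn
... | true  = inj₁ (elem⇒∈ a xs eqn)
... | false = inj₂ λ a∈ → case trans (sym eqn) (∈⇒elem a∈) of λ ()

end : Square → List Direction → Square
end a []       = a
end a (d ∷ ds) = end (neighbour d a) ds

start∈trace : ∀ {a} ds → a ∈ trace a ds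
start∈trace []       = here refl
start∈trace (d ∷ ds) = here refl

end∈trace : ∀ {a} ds → end a ds ∈ trace a ds
end∈trace []       = here refl
end∈trace (d ∷ ds) = there (end∈trace ds)

length-trace : ∀ a ds → length (trace a ds) ≡ suc (length ds)
length-trace a []       = refl
length-trace a (d ∷ ds) = cong suc (length-trace (neighbour d a) ds)

trace-joined : ∀ {P a x} ds → All P (trace a ds) → x ∈ trace a ds → Joined P a x
trace-joined []       _        (here refl) = ε
trace-joined (d ∷ ds) _        (here refl) = ε
trace-joined {P} {a} (d ∷ ds) (Pa ∷ Ps) (there x∈) =
  (Pa , All.lookup Ps (start∈trace ds) , d , refl) ◅ trace-joined ds Ps x∈

module _ (S : List Square) (s₀ : Square) (s₀∈ : s₀ ∈ S) (o : Square)
         (outer : ∀ d a → a ∈ S → neighbour d a ∉ S → Joined (_∉ S) (neighbour d a) o) where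

  private
    Out : Square → Square → Set
    Out = Joined (_∉ S)

    steps : Direction → ℕ → Square → Square
    steps d zero    a = a
    steps d (suc k) a = steps d k (neighbour d a)

    -- A straight walk outside S either completes its k steps or is about to enter S. In the latter
    -- case it stands on a square across the boundary, seen from S in the opposite direction, and
    -- `outer` joins that square to `o`.
    march : ∀ d k a → a ∉ S → Out a o ⊎ (Out a (steps d k a) × steps d k a ∉ S)
    march d zero    a a∉ = inj₂ (ε , a∉)
    march d (suc k) a a∉ with ∈-or-∉ (neighbour d a) S
    ... | inj₁ b∈ = inj₁ (subst (λ c → Out c o) (neighbour-opposite d a)
                      (outer (opposite d) (neighbour d a) b∈ (subst (_∉ S) (sym (neighbour-opposite d a)) a∉)))
    ... | inj₂ b∉ with march d k (neighbour d a) b∉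
    ...   | inj₁ j       = inj₁ ((a∉ , b∉ , d , refl) ◅ j)
    ...   | inj₂ (j , h) = inj₂ ((a∉ , b∉ , d , refl) ◅ j , h)

    leftReach : ℤ → ℕ
    leftReach (pos n)  = 0
    leftReach -[1+ n ] = suc n

    leftBound : List Square → ℕ
    leftBound []            = 0
    leftBound ((x , y) ∷ S) = leftReach x ⊔ leftBound S

    reach≤ : ∀ {x y} S → (x , y) ∈ S → leftReach x ≤ leftBound S
    reach≤ (_ ∷ S) (here refl) = m≤m⊔n _ _
    reach≤ (_ ∷ S) (there h)   = ≤-trans (reach≤ S h) (m≤n⊔m _ _)

    M : ℕ
    M = leftBound S

    far∉ : ∀ i {y} → (-[1+ i + M ] , y) ∉ S
    far∉ i h = <⇒≱ (s≤s (m≤n+m M i)) (reach≤ S h)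

    vertical : ∀ y → Out (-[1+ M ] , pos 0) (-[1+ M ] , y)
    vertical (pos zero)    = ε
    vertical (pos (suc n)) = vertical (pos n) ◅◅ (far∉ 0 , far∉ 0 , north , refl) ◅ ε
    vertical -[1+ zero ]   = (far∉ 0 , far∉ 0 , south , refl) ◅ ε
    vertical -[1+ suc n ]  = vertical -[1+ n ] ◅◅ (far∉ 0 , far∉ 0 , south , refl) ◅ ε

    inward : ∀ i y → Out (-[1+ i + M ] , y) (-[1+ M ] , y)
    inward zero    y = ε
    inward (suc i) y = (far∉ (suc i) , far∉ i , east , refl) ◅ inward i y

    iterate-suc : ℕ → ℤ → ℤ
    iterate-suc zero    x = x
    iterate-suc (suc k) x = sucℤ (iterate-suc k x)

    -- A column is either at or west of the reference column `-[1+ M ]`, or it is reached from there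
    -- by steps to the east.
    place : ∀ x → (∃[ i ] x ≡ -[1+ i + M ]) ⊎ (∃[ k ] iterate-suc k -[1+ M ] ≡ x)
    place (pos zero)    = inj₂ (suc M , cong sucℤ (subst (λ m → iterate-suc M -[1+ m ] ≡ -[1+ 0 ]) (+-identityʳ M) (toZero M 0)))
      where
      toZero : ∀ k n → iterate-suc k -[1+ k + n ] ≡ -[1+ n ]
      toZero zero    n = refl
      toZero (suc k) n = trans (cong (λ j → sucℤ (iterate-suc k -[1+ j ])) (sym (+-suc k n))) (cong sucℤ (toZero k (suc n)))
    place (pos (suc n)) with place (pos n)
    ... | inj₂ (k , eq) = inj₂ (suc k , cong sucℤ eq)
    place -[1+ n ] with ≤-total M n
    ... | inj₁ M≤n = inj₁ (n ∸ M , cong -[1+_] (sym (m∸n+n≡m M≤n)))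
    ... | inj₂ n≤M = inj₂ (M ∸ n , subst (λ m → iterate-suc (M ∸ n) -[1+ m ] ≡ -[1+ n ]) (m∸n+n≡m n≤M) (toNeg (M ∸ n) n))
      where
      toNeg : ∀ k n → iterate-suc k -[1+ k + n ] ≡ -[1+ n ]
      toNeg zero    n = refl
      toNeg (suc k) n = trans (cong (λ j → sucℤ (iterate-suc k -[1+ j ])) (sym (+-suc k n))) (cong sucℤ (toNeg k (suc n)))

    steps-east : ∀ k x y → steps east k (x , y) ≡ (iterate-suc k x , y)
    steps-east zero    x y = refl
    steps-east (suc k) x y = trans (steps-east k (sucℤ x) y) (cong (_, y) (shuffle k x))
      where
      shuffle : ∀ k x → iterate-suc k (sucℤ x) ≡ sucℤ (iterate-suc k x)
      shuffle zero    x = refl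
      shuffle (suc k) x = cong sucℤ (shuffle k x)

    steps-west : ∀ k x y → steps west k (iterate-suc k x , y) ≡ (x , y)
    steps-west zero    x y = refl
    steps-west (suc k) x y = trans (cong (λ z → steps west k (z , y)) (predℤ-sucℤ (iterate-suc k x))) (steps-west k x y)

    -- The reference column is free of S, hence connected. In the row of `s₀` a march to the east
    -- must run into S, as `s₀` itself lies on the way, and this gives a path to `o`.
    from-far : ∀ y → Out (-[1+ M ] , y) o
    from-far y = joined-sym (vertical y) ◅◅ vertical (proj₂ s₀) ◅◅ hit (place (proj₁ s₀))
      where
      hit : _ → Out (-[1+ M ] , proj₂ s₀) o
      hit (inj₁ (i , eq)) = ⊥-elim (far∉ i (subst (λ x → (x , proj₂ s₀) ∈ S) eq s₀∈))
      hit (inj₂ (k , eq)) with march east k (-[1+ M ] , proj₂ s₀) (far∉ 0)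
      ... | inj₁ j       = j
      ... | inj₂ (_ , h) = ⊥-elim (h (subst (_∈ S) (sym (trans (steps-east k -[1+ M ] (proj₂ s₀)) (cong (_, proj₂ s₀) eq))) s₀∈))

    to-o : ∀ a → a ∉ S → Out a o
    to-o (x , y) a∉ with place x
    ... | inj₁ (i , refl) = inward i y ◅◅ from-far y
    ... | inj₂ (k , refl) with march west k (x , y) a∉
    ...   | inj₁ j       = j
    ...   | inj₂ (j , _) = subst (Out (x , y)) (steps-west k -[1+ M ] y) j ◅◅ from-far y

  -- Every square outside S is joined to `o`. It walks west until it meets S, where `march` provides
  -- the path, or until it reaches the column `-[1+ M ]`, west of all of S; a square further west
  -- comes east to that column. From there `from-far` leads on.
  complement-connected : Connected (_∉ S)
  complement-connected a∉ b∉ = to-o _ a∉ ◅◅ joined-sym (to-o _ b∉)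

Unique-length : ∀ {A : Set} {xs ys : List A} → Unique xs → All (_∈ ys) xs → length xs ≤ length ys
Unique-length []           []         = z≤n
Unique-length {ys = ys} (x∉ ∷ u) (x∈ ∷ xs⊆) with ∈-∃++ x∈
... | as , bs , refl = ≤-trans (s≤s (Unique-length u (All.zipWith remove (x∉ , xs⊆))))
                         (≤-reflexive (trans (cong suc (length-++ as)) (trans (sym (+-suc _ _)) (sym (length-++ as)))))
  where
  remove : ∀ {z} → _ × z ∈ as ++ _ ∷ bs → z ∈ as ++ bs
  remove (x≢z , z∈) with ∈-++⁻ as z∈
  ... | inj₁ h           = ∈-++⁺ˡ h
  ... | inj₂ (here refl) = ⊥-elim (x≢z refl)
  ... | inj₂ (there h)   = ∈-++⁺ʳ as h

module Tour (Q : Square → Set) (B : List Square) (Q⊆B : ∀ {a} → Q a → a ∈ B) where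

  record SimpleWalk (a b : Square) : Set where
    field
      moves  : List Direction
      inside : All Q (trace a moves)
      ends   : end a moves ≡ b
      simple : Unique (trace a moves)

  open SimpleWalk

  shortcut : ∀ {a b x} (w : SimpleWalk a b) → x ∈ trace a (moves w) → SimpleWalk x b
  shortcut w x∈ = go _ (moves w) (inside w) (ends w) (simple w) x∈
    where
    go : ∀ {x b} a ds → All Q (trace a ds) → end a ds ≡ b → Unique (trace a ds) → x ∈ trace a ds → SimpleWalk x b
    go a []       ps e u (here refl) = record { moves = [] ; inside = ps ; ends = e ; simple = u }
    go a (d ∷ ds) ps e u (here refl) = record { moves = d ∷ ds ; inside = ps ; ends = e ; simple = u }
    go a (d ∷ ds) (_ ∷ ps) e (_ ∷ u) (there x∈) = go (neighbour d a) ds ps e u x∈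

  -- Loop erasure, starting from the far end: if the new first square already occurs on the
  -- simplified rest, the walk is cut down to begin at that occurrence.
  simplify : ∀ {a b} → Q a → Joined Q a b → SimpleWalk a b
  simplify Qa ε = record { moves = [] ; inside = Qa ∷ [] ; ends = refl ; simple = [] ∷ [] }
  simplify {a} Qa ((_ , Qa′ , d , refl) ◅ j) with simplify Qa′ j
  ... | w with ∈-or-∉ a (trace (neighbour d a) (moves w))
  ...   | inj₁ a∈ = shortcut w a∈
  ...   | inj₂ a∉ = record
    { moves = d ∷ moves w ; inside = Qa ∷ inside w ; ends = ends w ; simple = ¬Any⇒All¬ _ a∉ ∷ simple w }

  moves-length : ∀ {a b} (w : SimpleWalk a b) → length (moves w) ≤ length B
  moves-length {a} w = ≤-trans (n≤1+n _) (≤-trans (≤-reflexive (sym (length-trace a (moves w))))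
    (Unique-length (simple w) (All.map Q⊆B (inside w))))

  trace-++ˡ : ∀ {x} a ds es → x ∈ trace a ds → x ∈ trace a (ds ++ es)
  trace-++ˡ a []       es (here refl) = start∈trace es
  trace-++ˡ a (d ∷ ds) es (here refl) = here refl
  trace-++ˡ a (d ∷ ds) es (there h)   = there (trace-++ˡ _ ds es h)

  trace-++ʳ : ∀ {x} a ds es → x ∈ trace (end a ds) es → x ∈ trace a (ds ++ es)
  trace-++ʳ a []       es h = h
  trace-++ʳ a (d ∷ ds) es h = there (trace-++ʳ _ ds es h)

  trace-++-All : ∀ a ds es → All Q (trace a ds) → All Q (trace (end a ds) es) → All Q (trace a (ds ++ es))
  trace-++-All a []       es _        qs = qs
  trace-++-All a (d ∷ ds) es (p ∷ ps) qs = p ∷ trace-++-All _ ds es ps qs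

  -- Only the legs between consecutive targets are made simple, and each is then at most as long as
  -- B; the tour itself may visit a square many times.
  tour : (∀ {a b} → Q a → Q b → Joined Q a b) → ∀ a ts → Q a → All Q ts →
         ∃[ ds ] (length ds ≤ length ts * length B × All Q (trace a ds) × All (_∈ trace a ds) ts)
  tour conn a []       Qa []        = [] , z≤n , Qa ∷ [] , []
  tour conn a (t ∷ ts) Qa (Qt ∷ Qs) =
    let w = simplify Qa (conn Qa Qt)
        es , es≤ , qs , ts∈ = tour conn t ts Qt Qs
        qs′ = subst (λ b → All Q (trace b es)) (sym (ends w)) qs
        ts∈′ = subst (λ b → All (_∈ trace b es) ts) (sym (ends w)) ts∈
    in moves w ++ es ,
       ≤-trans (≤-reflexive (length-++ (moves w))) (+-mono-≤ (moves-length w) es≤) ,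
       trace-++-All a (moves w) es (inside w) qs′ ,
       trace-++ˡ a (moves w) es (subst (_∈ trace a (moves w)) (ends w) (end∈trace (moves w))) ∷
       All.map (trace-++ʳ a (moves w) es) ts∈′

length-product : ∀ {A B : Set} (xs : List A) (ys : List B) → length (cartesianProduct xs ys) ≡ length xs * length ys
length-product []       ys = refl
length-product (x ∷ xs) ys = trans (length-++ (map (x ,_) ys)) (cong₂ _+_ (length-map (x ,_) ys) (length-product xs ys))

module Clamp (n : ℕ) where

  offset : ℤ → ℕ
  offset (pos k)  = k ⊓ n
  offset -[1+ _ ] = 0

  offset-suc : ∀ u → offset (sucℤ u) ≡ offset u ⊎ offset (sucℤ u) ≡ suc (offset u)
  offset-suc (pos k) = go k n
    where
    go : ∀ k n → suc k ⊓ n ≡ k ⊓ n ⊎ suc k ⊓ n ≡ suc (k ⊓ n)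
    go zero    zero    = inj₁ refl
    go zero    (suc n) = inj₂ refl
    go (suc k) zero    = inj₁ refl
    go (suc k) (suc n) with go k n
    ... | inj₁ eq = inj₁ (cong suc eq)
    ... | inj₂ eq = inj₂ (cong suc eq)
  offset-suc -[1+ zero ]  = inj₁ refl
  offset-suc -[1+ suc _ ] = inj₁ refl

  offset≤ : ∀ u → offset u ≤ n
  offset≤ (pos k)  = m⊓n≤n k n
  offset≤ -[1+ _ ] = z≤n

  clamp : ℤ → ℤ → ℤ
  clamp lo x = lo ℤ.+ pos (offset (x ℤ.- lo))

  shift-suc : ∀ lo k → lo ℤ.+ pos (suc k) ≡ sucℤ (lo ℤ.+ pos k)
  shift-suc lo k = trans (sym (ℤ.+-assoc lo (pos 1) (pos k))) (trans (cong (ℤ._+ pos k) (ℤ.+-comm lo (pos 1))) (ℤ.+-assoc (pos 1) lo (pos k)))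

  suc-minus : ∀ x lo → sucℤ x ℤ.- lo ≡ sucℤ (x ℤ.- lo)
  suc-minus x lo = ℤ.+-assoc (pos 1) x (ℤ.- lo)

  clamp-suc : ∀ lo x → clamp lo (sucℤ x) ≡ clamp lo x ⊎ clamp lo (sucℤ x) ≡ sucℤ (clamp lo x)
  clamp-suc lo x rewrite suc-minus x lo with offset-suc (x ℤ.- lo)
  ... | inj₁ eq = inj₁ (cong (λ k → lo ℤ.+ pos k) eq)
  ... | inj₂ eq = inj₂ (trans (cong (λ k → lo ℤ.+ pos k) eq) (shift-suc lo _))

  clamp-pred : ∀ lo x → clamp lo (predℤ x) ≡ clamp lo x ⊎ clamp lo (predℤ x) ≡ predℤ (clamp lo x)
  clamp-pred lo x with clamp-suc lo (predℤ x)
  ... | inj₁ eq = inj₁ (trans (sym eq) (cong (clamp lo) (sucℤ-predℤ x)))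
  ... | inj₂ eq = inj₂ (trans (sym (predℤ-sucℤ _)) (cong predℤ (trans (sym eq) (cong (clamp lo) (sucℤ-predℤ x)))))

  Inner : ℤ → ℤ → Set
  Inner lo x = ∃[ k ] (x ℤ.- lo ≡ pos (suc k) × suc k < n)

  minus-plus : ∀ x lo → lo ℤ.+ (x ℤ.- lo) ≡ x
  minus-plus x lo = trans (ℤ.+-comm lo _) (trans (ℤ.+-assoc x (ℤ.- lo) lo) (trans (cong (λ z → x ℤ.+ z) (ℤ.+-inverseˡ lo)) (ℤ.+-identityʳ x)))

  clamp-fixes : ∀ lo x {k} → x ℤ.- lo ≡ pos k → k ≤ n → clamp lo x ≡ x
  clamp-fixes lo x {k} eq k≤n =
    trans (cong (λ u → lo ℤ.+ pos (offset u)) eq)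
      (trans (cong (λ j → lo ℤ.+ pos j) (m≤n⇒m⊓n≡m k≤n)) (trans (cong (λ u → lo ℤ.+ u) (sym eq)) (minus-plus x lo)))

  plus-minus : ∀ lo z → (lo ℤ.+ z) ℤ.- lo ≡ z
  plus-minus lo z = trans (cong (λ u → u ℤ.- lo) (ℤ.+-comm lo z)) (trans (ℤ.+-assoc z lo (ℤ.- lo)) (trans (cong (λ u → z ℤ.+ u) (ℤ.+-inverseʳ lo)) (ℤ.+-identityʳ z)))

  clamp-idem : ∀ lo x → clamp lo (clamp lo x) ≡ clamp lo x
  clamp-idem lo x = clamp-fixes lo (clamp lo x) (plus-minus lo _) (offset≤ (x ℤ.- lo))

  -- Clamping moves a coordinate only onto an end of the interval, and `Inner` excludes both ends.
  inner-clamp : ∀ lo x → Inner lo (clamp lo x) → clamp lo x ≡ x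
  inner-clamp lo x (k , eq , k<n) = go (x ℤ.- lo) refl (ℤ.+-injective (trans (sym (plus-minus lo (pos (offset (x ℤ.- lo))))) eq))
    where
    go : ∀ u → x ℤ.- lo ≡ u → offset u ≡ suc k → clamp lo x ≡ x
    go (pos j) e h = clamp-fixes lo x e (≮⇒≥ λ n<j → <-irrefl (trans (sym h) (m≥n⇒m⊓n≡n (<⇒≤ n<j))) k<n)

  module Plane (lx ly : ℤ) (S : List Square) (inner : ∀ {x y} → (x , y) ∈ S → Inner lx x × Inner ly y) where

    range : ℤ → List ℤ
    range lo = map (λ i → lo ℤ.+ pos i) (upTo (suc n))

    length-range : ∀ lo → length (range lo) ≡ suc n
    length-range lo = trans (length-map (λ i → lo ℤ.+ pos i) (upTo (suc n))) (length-upTo (suc n))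

    box : List Square
    box = cartesianProduct (range lx) (range ly)

    length-box : length box ≡ suc n * suc n
    length-box = trans (length-product (range lx) (range ly)) (cong₂ _*_ (length-range lx) (length-range ly))

    clampSquare : Square → Square
    clampSquare (x , y) = clamp lx x , clamp ly y

    Q : Square → Set
    Q a = a ∉ S × clampSquare a ≡ a

    clamp∈box : ∀ a → clampSquare a ∈ box
    clamp∈box (x , y) = ∈-cartesianProduct⁺ (∈-map⁺ _ (∈-upTo⁺ (s≤s (offset≤ (x ℤ.- lx))))) (∈-map⁺ _ (∈-upTo⁺ (s≤s (offset≤ (y ℤ.- ly)))))

    -- Because S lies strictly inside the box, no square of S is the image of a square that was
    -- moved. This is why clamping a path in the complement gives a path in the complement.
    clamp∉ : ∀ a → a ∉ S → clampSquare a ∉ S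
    clamp∉ (x , y) a∉ h = let ix , iy = inner h in
      a∉ (subst (_∈ S) (cong₂ _,_ (inner-clamp lx x ix) (inner-clamp ly y iy)) h)

    clampQ : ∀ {a} → a ∉ S → Q (clampSquare a)
    clampQ {x , y} a∉ = clamp∉ (x , y) a∉ , cong₂ _,_ (clamp-idem lx x) (clamp-idem ly y)

    Q⊆box : ∀ {a} → Q a → a ∈ box
    Q⊆box {a} (_ , eq) = subst (_∈ box) eq (clamp∈box a)

    clamp-step : ∀ {a b} → Adjacent (_∉ S) a b → Joined Q (clampSquare a) (clampSquare b)
    clamp-step {x , y} (a∉ , b∉ , north , refl) with clamp-suc ly y
    ... | inj₁ eq = subst (λ z → Joined Q (clampSquare (x , y)) (clamp lx x , z)) (sym eq) ε
    ... | inj₂ eq = (clampQ a∉ , clampQ b∉ , north , cong (clamp lx x ,_) eq) ◅ ε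
    clamp-step {x , y} (a∉ , b∉ , south , refl) with clamp-pred ly y
    ... | inj₁ eq = subst (λ z → Joined Q (clampSquare (x , y)) (clamp lx x , z)) (sym eq) ε
    ... | inj₂ eq = (clampQ a∉ , clampQ b∉ , south , cong (clamp lx x ,_) eq) ◅ ε
    clamp-step {x , y} (a∉ , b∉ , west , refl) with clamp-pred lx x
    ... | inj₁ eq = subst (λ z → Joined Q (clampSquare (x , y)) (z , clamp ly y)) (sym eq) ε
    ... | inj₂ eq = (clampQ a∉ , clampQ b∉ , west , cong (_, clamp ly y) eq) ◅ ε
    clamp-step {x , y} (a∉ , b∉ , east , refl) with clamp-suc lx x
    ... | inj₁ eq = subst (λ z → Joined Q (clampSquare (x , y)) (z , clamp ly y)) (sym eq) ε
    ... | inj₂ eq = (clampQ a∉ , clampQ b∉ , east , cong (_, clamp ly y) eq) ◅ ε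

    clamp-joined : ∀ {a b} → Joined (_∉ S) a b → Joined Q (clampSquare a) (clampSquare b)
    clamp-joined ε       = ε
    clamp-joined (e ◅ j) = clamp-step e ◅◅ clamp-joined j

  pred-minus : ∀ x lo → predℤ x ℤ.- lo ≡ predℤ (x ℤ.- lo)
  pred-minus x lo = ℤ.+-assoc -[1+ 0 ] x (ℤ.- lo)

  -- Each move changes one offset by one and leaves one move less, so the distance to every edge of
  -- the box stays larger than the number of moves that remain. A walk through all squares thus
  -- bounds the region without minima and maxima of coordinates.
  trace-inner : ∀ {lx ly} x y ds c c′ → x ℤ.- lx ≡ pos c → y ℤ.- ly ≡ pos c′ →
                length ds < c → length ds < c′ → c + length ds < n → c′ + length ds < n →
                All (λ a → Inner lx (proj₁ a) × Inner ly (proj₂ a)) (trace (x , y) ds)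
  trace-inner {lx} {ly} x y ds (suc c) (suc c′) ex ey h h′ k k′ = go ds h h′ k k′
    where
    point : ∀ l → suc c + l < n → suc c′ + l < n → Inner lx x × Inner ly y
    point l k k′ = (c , ex , ≤-trans (s≤s (m≤m+n (suc c) l)) k) , (c′ , ey , ≤-trans (s≤s (m≤m+n (suc c′) l)) k′)
    less : ∀ {l m} → m + suc l < n → m + l < n
    less {l} {m} k = ≤-trans (s≤s (+-monoʳ-≤ m (n≤1+n l))) k
    moved : ∀ {l m} → m + suc l < n → suc m + l < n
    moved {l} {m} k = subst (_< n) (+-suc m l) k
    go : ∀ ds → length ds < suc c → length ds < suc c′ → suc c + length ds < n → suc c′ + length ds < n →
         All (λ a → Inner lx (proj₁ a) × Inner ly (proj₂ a)) (trace (x , y) ds)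
    go [] h h′ k k′ = point 0 k k′ ∷ []
    go (north ∷ ds) h h′ k k′ = point _ k k′ ∷
      trace-inner x (sucℤ y) ds (suc c) (suc (suc c′)) ex (trans (suc-minus y ly) (cong sucℤ ey))
        (<⇒≤ h) (<-trans (n<1+n _) (m≤n⇒m≤1+n h′)) (less {m = suc c} k) (moved {m = suc c′} k′)
    go (south ∷ ds) h h′ k k′ = point _ k k′ ∷
      trace-inner x (predℤ y) ds (suc c) c′ ex (trans (pred-minus y ly) (cong predℤ ey))
        (<⇒≤ h) (≤-pred h′) (less {m = suc c} k) (≤-trans (n≤1+n _) (less {m = suc c′} k′))
    go (west ∷ ds) h h′ k k′ = point _ k k′ ∷
      trace-inner (predℤ x) y ds c (suc c′) (trans (pred-minus x lx) (cong predℤ ex)) ey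
        (≤-pred h) (<⇒≤ h′) (≤-trans (n≤1+n _) (less {m = suc c} k)) (less {m = suc c′} k′)
    go (east ∷ ds) h h′ k k′ = point _ k k′ ∷
      trace-inner (sucℤ x) y ds (suc (suc c)) (suc c′) (trans (suc-minus x lx) (cong sucℤ ex)) ey
        (<-trans (n<1+n _) (m≤n⇒m≤1+n h)) (<⇒≤ h′) (moved {m = suc c} k) (less {m = suc c′} k′)

-- The check of a certificate and its soundness.

all⇒ : ∀ {A : Set} {p : A → Bool} xs → all p xs ≡ true → ∀ {x} → x ∈ xs → p x ≡ true
all⇒ (x ∷ xs) h (here refl) = proj₁ (∧-true h)
all⇒ (x ∷ xs) h (there x∈)  = all⇒ xs (proj₂ (∧-true h)) x∈

⇒all : ∀ {A : Set} {p : A → Bool} xs → (∀ {x} → x ∈ xs → p x ≡ true) → all p xs ≡ true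
⇒all []       h = refl
⇒all (x ∷ xs) h = ∧-intro (h (here refl)) (⇒all xs (h ∘ there))

∨-true : ∀ {a b} → a ∨ b ≡ true → a ≡ true ⊎ b ≡ true
∨-true {true}  h = inj₁ refl
∨-true {false} h = inj₂ h

∨-introˡ : ∀ {a b} → a ≡ true → a ∨ b ≡ true
∨-introˡ refl = refl

∨-introʳ : ∀ {a b} → b ≡ true → a ∨ b ≡ true
∨-introʳ {true}  h = refl
∨-introʳ {false} h = h

not-true : ∀ {a} → not a ≡ true → a ≡ true → ⊥
not-true {true} ()

module _ {A : Set} {{_ : Code A}} {{_ : Eq A}} where

  not-elem : ∀ {x : A} {xs} → not (elem x xs) ≡ true → x ∉ xs
  not-elem h x∈ = not-true h (∈⇒elem x∈)

  elem-not : ∀ {x : A} {xs} → x ∉ xs → not (elem x xs) ≡ true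
  elem-not {x} {xs} x∉ with elem x xs in eqn
  ... | false = refl
  ... | true  = ⊥-elim (x∉ (elem⇒∈ x xs eqn))

  implies⇒ : ∀ {a b : A} {c} → not (eq a b) ∨ c ≡ true → a ≡ b → c ≡ true
  implies⇒ {a} h refl with eq a a | eq-refl a
  ... | true | refl = h

  ⇒implies : ∀ {a b : A} {c} → (a ≡ b → c ≡ true) → not (eq a b) ∨ c ≡ true
  ⇒implies {a} {b} h with eq a b in eqn
  ... | false = refl
  ... | true  = h (eq⇒≡ eqn)

Colouring : Set
Colouring = (ℕᵇ × ℕᵇ) × (ℕᵇ × ℕᵇ)

toTile : Colouring → Tile
toTile ((n , s) , (w , e)) = tile (Bin.toℕ n) (Bin.toℕ s) (Bin.toℕ w) (Bin.toℕ e)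

fromTile : Tile → Colouring
fromTile (tile n s w e) = (fromℕ n , fromℕ s) , (fromℕ w , fromℕ e)

to-from : ∀ t → toTile (fromTile t) ≡ t
to-from (tile n s w e) rewrite Bin.toℕ-fromℕ n | Bin.toℕ-fromℕ s | Bin.toℕ-fromℕ w | Bin.toℕ-fromℕ e = refl

colourAt : Direction → Colouring → ℕᵇ
colourAt north ((n , s) , (w , e)) = n
colourAt south ((n , s) , (w , e)) = s
colourAt west  ((n , s) , (w , e)) = w
colourAt east  ((n , s) , (w , e)) = e

side-toTile : ∀ d t → side d (toTile t) ≡ Bin.toℕ (colourAt d t)
side-toTile north t = refl
side-toTile south t = refl
side-toTile west  t = refl
side-toTile east  t = refl

side-fromTile : ∀ d t → colourAt d (fromTile t) ≡ fromℕ (side d t)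
side-fromTile north t = refl
side-fromTile south t = refl
side-fromTile west  t = refl
side-fromTile east  t = refl

colourAt′ : PT (λ (i : Direction × Colouring) → colourAt (proj₁ i) (proj₂ i))
colourAt′ = (λ { (north , t) → refl ; (south , t) → refl ; (west , t) → refl ; (east , t) → refl }) ≗⇒
  if′ (fst ∙ directionBits′ ∙ fst)
    (if′ (snd ∙ directionBits′ ∙ fst) (snd ∙ snd ∙ snd) (fst ∙ snd ∙ snd))
    (if′ (snd ∙ directionBits′ ∙ fst) (snd ∙ fst ∙ snd) (fst ∙ fst ∙ snd))

opposite′ : PT opposite
opposite′ = (λ { north → refl ; south → refl ; west → refl ; east → refl }) ≗⇒
  direction′ ∙ (fst ▵ not′ snd) ∙ directionBits′

directions : List Direction
directions = north ∷ south ∷ west ∷ east ∷ []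

∈-directions : ∀ d → d ∈ directions
∈-directions north = here refl
∈-directions south = there (here refl)
∈-directions west  = there (there (here refl))
∈-directions east  = there (there (there (here refl)))

firstOr : ∀ {A : Set} → A → List A → A
firstOr a []      = a
firstOr _ (x ∷ _) = x

firstOr′ : ∀ {A : Set} {{_ : Code A}} (a : A) → PT (firstOr a)
firstOr′ a = (λ { [] → refl ; (x ∷ xs) → refl }) ≗⇒ case′ {E = ⊤} (const′ a) (fst ∙ snd) ∙ (const′ tt ▵ id′)

origin : Square
origin = pos 0 , pos 0

neighbourOf : Segment → Square
neighbourOf (a , d) = neighbour d a

neighbourOf′ : PT neighbourOf
neighbourOf′ = neighbour′ ∙ (snd ▵ fst)

module Verify (W : List Tile) where

  Assignment : Set
  Assignment = List (Square × Colouring)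

  Border : Set
  Border = List (Segment × ℕᵇ)

  -- The certificate repeats the region. The check encodes it again and compares the result with the
  -- input, so that the input word never has to be parsed.
  Cert : Set
  Cert = (Assignment × Border) × (List Direction × List Direction)

  domain : Assignment → List Square
  domain = map proj₁

  segments : Border → List Segment
  segments = map proj₁

  domain′ : PT domain
  domain′ = map′ {E = ⊤} (fst ∙ snd) ∙ (const′ tt ▵ id′)

  segments′ : PT segments
  segments′ = map′ {E = ⊤} (fst ∙ snd) ∙ (const′ tt ▵ id′)

  encodes : List Bool × (List Square × Border) → Bool
  encodes (w , D) = eq w (encodeRegion (toRegion D))

  bordering : List Square × List Segment → Bool
  bordering (S , B) = all (λ s → elem (proj₁ s) S ∧ not (elem (neighbourOf s) S)) B

  Shape : Set
  Shape = List Square × List Segment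

  sideClosed : (Shape × Square) × Direction → Bool
  sideClosed (((S , B) , a) , d) = elem (neighbour d a) S ∨ elem (a , d) B

  squareClosed : Shape × Square → Bool
  squareClosed i = all (λ d → sideClosed (i , d)) directions

  closed : Shape → Bool
  closed i = all (λ a → squareClosed (i , a)) (proj₁ i)

  linked : List Square × List Direction → Bool
  linked (S , ds) = all (λ a → elem a S) (trace (firstOr origin S) ds) ∧
                    all (λ a → elem a (trace (firstOr origin S) ds)) S

  -- The walk starts at the first square across the boundary and has to visit only such squares;
  -- `complement-connected` extends the conclusion to the whole infinite complement.
  linkedOutside : (List Square × List Segment) × List Direction → Bool
  linkedOutside ((S , B) , ds) = null B ∨
    all (λ a → not (elem a S)) (trace (firstOr origin (map neighbourOf B)) ds) ∧
    all (λ a → elem a (trace (firstOr origin (map neighbourOf B)) ds)) (map neighbourOf B)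

  usesTiles : Assignment → Bool
  usesTiles A = all (λ p → elem (proj₂ p) (map fromTile W)) A

  Placed : Set
  Placed = Square × Colouring

  -- An implication that is tested against every placed square takes the place of a lookup by
  -- position.
  fits : (Placed × Direction) × Placed → Bool
  fits ((p , d) , q) = not (eq (proj₁ q) (neighbour d (proj₁ p))) ∨ eq (colourAt d (proj₂ p)) (colourAt (opposite d) (proj₂ q))

  sideFits : (Assignment × Placed) × Direction → Bool
  sideFits ((A , p) , d) = all (λ q → fits ((p , d) , q)) A

  placedFits : Assignment × Placed → Bool
  placedFits i = all (λ d → sideFits (i , d)) directions

  agrees : Assignment → Bool
  agrees A = all (λ p → placedFits (A , p)) A

  fitsBorder : (Segment × ℕᵇ) × Placed → Bool
  fitsBorder (((a , d) , c) , q) = not (eq (proj₁ q) a) ∨ eq (colourAt d (proj₂ q)) c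

  sideFitsBorder : Assignment × (Segment × ℕᵇ) → Bool
  sideFitsBorder (A , b) = all (λ q → fitsBorder (b , q)) A

  agreesBorder : Assignment × Border → Bool
  agreesBorder (A , B) = all (λ b → sideFitsBorder (A , b)) B

  encodes′ : PT encodes
  encodes′ = eq-PT ∙ (fst ▵ encodeRegion′ ∙ snd)

  bordering′ : PT bordering
  bordering′ = all′ {E = List Square} (elem′ ∙ (fst ∙ snd ▵ fst) ∧′ not′ (elem′ ∙ (neighbourOf′ ∙ snd ▵ fst)))

  sideClosed′ : PT sideClosed
  sideClosed′ = elem′ ∙ (neighbour′ ∙ (snd ▵ square) ▵ fst ∙ shape) ∨′ elem′ ∙ ((square ▵ snd) ▵ snd ∙ shape)
    where
    shape : PT (λ (i : (Shape × Square) × Direction) → proj₁ (proj₁ i))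
    shape = fst ∙ fst
    square : PT (λ (i : (Shape × Square) × Direction) → proj₂ (proj₁ i))
    square = snd ∙ fst

  squareClosed′ : PT squareClosed
  squareClosed′ = all′ {f = sideClosed} sideClosed′ ∙ (id′ ▵ const′ directions)

  closed′ : PT closed
  closed′ = all′ {f = squareClosed} squareClosed′ ∙ (id′ ▵ fst)

  linked′ : PT linked
  linked′ = (all′ {E = List Square} (elem′ ∙ (snd ▵ fst)) ∙ (fst ▵ path)) ∧′ (all′ {E = List Square} (elem′ ∙ (snd ▵ fst)) ∙ (path ▵ fst))
    where
    path : PT (λ (i : List Square × List Direction) → trace (firstOr origin (proj₁ i)) (proj₂ i))
    path = trace′ ∙ (firstOr′ origin ∙ fst ▵ snd)

  linkedOutside′ : PT linkedOutside
  linkedOutside′ = null′ ∙ snd ∙ fst ∨′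
    ((all′ {E = List Square} (not′ (elem′ ∙ (snd ▵ fst))) ∙ (fst ∙ fst ▵ path)) ∧′ (all′ {E = List Square} (elem′ ∙ (snd ▵ fst)) ∙ (path ▵ outers)))
    where
    outers : PT (λ (i : (List Square × List Segment) × List Direction) → map neighbourOf (proj₂ (proj₁ i)))
    outers = map′ {E = ⊤} (neighbourOf′ ∙ snd) ∙ (const′ tt ▵ snd ∙ fst)
    path : PT (λ (i : (List Square × List Segment) × List Direction) → trace (firstOr origin (map neighbourOf (proj₂ (proj₁ i)))) (proj₂ i))
    path = trace′ ∙ (firstOr′ origin ∙ outers ▵ snd)

  usesTiles′ : PT usesTiles
  usesTiles′ = all′ {E = ⊤} (elem′ ∙ (snd ∙ snd ▵ const′ (map fromTile W))) ∙ (const′ tt ▵ id′)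

  fits′ : PT fits
  fits′ = not′ (eq-PT ∙ (fst ∙ snd ▵ neighbour′ ∙ (side′ ▵ fst ∙ placed))) ∨′
          eq-PT ∙ (colourAt′ ∙ (side′ ▵ snd ∙ placed) ▵ colourAt′ ∙ (_∙_ {g = opposite} opposite′ side′ ▵ snd ∙ snd))
    where
    placed : PT (λ (i : (Placed × Direction) × Placed) → proj₁ (proj₁ i))
    placed = fst ∙ fst
    side′ : PT (λ (i : (Placed × Direction) × Placed) → proj₂ (proj₁ i))
    side′ = snd ∙ fst

  sideFits′ : PT sideFits
  sideFits′ = all′ {f = fits} fits′ ∙ ((snd ∙ fst ▵ snd) ▵ fst ∙ fst)

  placedFits′ : PT placedFits
  placedFits′ = all′ {f = sideFits} sideFits′ ∙ (id′ ▵ const′ directions)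

  agrees′ : PT agrees
  agrees′ = all′ {f = placedFits} placedFits′ ∙ (id′ ▵ id′)

  fitsBorder′ : PT fitsBorder
  fitsBorder′ = not′ (eq-PT ∙ (fst ∙ snd ▵ fst ∙ segment)) ∨′ eq-PT ∙ (colourAt′ ∙ (snd ∙ segment ▵ snd ∙ snd) ▵ snd ∙ fst)
    where
    segment : PT (λ (i : (Segment × ℕᵇ) × Placed) → proj₁ (proj₁ i))
    segment = fst ∙ fst

  sideFitsBorder′ : PT sideFitsBorder
  sideFitsBorder′ = all′ {f = fitsBorder} fitsBorder′ ∙ (snd ▵ fst)

  agreesBorder′ : PT agreesBorder
  agreesBorder′ = all′ {f = sideFitsBorder} sideFitsBorder′

  Input : Set
  Input = List Bool × Cert

  assignmentOf : Input → Assignment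
  assignmentOf (w , ((A , B) , (ds , es))) = A

  borderOf : Input → Border
  borderOf (w , ((A , B) , (ds , es))) = B

  domainOf : Input → List Square
  domainOf i = domain (assignmentOf i)

  segmentsOf : Input → List Segment
  segmentsOf i = segments (borderOf i)

  assignmentOf′ : PT assignmentOf
  assignmentOf′ = fst ∙ fst ∙ snd

  borderOf′ : PT borderOf
  borderOf′ = snd ∙ fst ∙ snd

  domainOf′ : PT domainOf
  domainOf′ = _∙_ {g = domain} {f = assignmentOf} domain′ assignmentOf′

  segmentsOf′ : PT segmentsOf
  segmentsOf′ = _∙_ {g = segments} {f = borderOf} segments′ borderOf′

  shapeOf : Input → List Square × List Segment
  shapeOf i = domainOf i , segmentsOf i

  shapeOf′ : PT shapeOf
  shapeOf′ = _▵_ {f = domainOf} {g = segmentsOf} domainOf′ segmentsOf′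

  infixr 6 _&_ _&′_

  _&_ : (Input → Bool) → (Input → Bool) → Input → Bool
  (f & g) i = f i ∧ g i

  _&′_ : ∀ {f g} → PT f → PT g → PT (f & g)
  _&′_ {f} {g} p q = _∧′_ {f = f} {g = g} p q

  test₁ test₂ test₃ test₄ test₅ test₆ test₇ test₈ test₉ test₁₀ test₁₁ check : Input → Bool
  test₁ i = encodes (proj₁ i , (domainOf i , borderOf i))
  test₂ i = not (null (domainOf i))
  test₃ i = distinct (domainOf i)
  test₄ i = distinct (segmentsOf i)
  test₅ i = bordering (shapeOf i)
  test₆ i = closed (shapeOf i)
  test₇ i = linked (domainOf i , proj₁ (proj₂ (proj₂ i)))
  test₈ i = linkedOutside (shapeOf i , proj₂ (proj₂ (proj₂ i)))
  test₉ i = usesTiles (assignmentOf i)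
  test₁₀ i = agrees (assignmentOf i)
  test₁₁ i = agreesBorder (assignmentOf i , borderOf i)
  check = test₁ & test₂ & test₃ & test₄ & test₅ & test₆ & test₇ & test₈ & test₉ & test₁₀ & test₁₁

  test₁′ : PT test₁
  test₁′ = _∙_ {g = encodes} encodes′ (_▵_ {f = proj₁} fst (_▵_ {f = domainOf} {g = borderOf} domainOf′ borderOf′))

  test₂′ : PT test₂
  test₂′ = not′ {f = λ i → null (domainOf i)} (_∙_ {g = null} {f = domainOf} null′ domainOf′)

  test₃′ : PT test₃
  test₃′ = _∙_ {g = distinct} {f = domainOf} distinct′ domainOf′

  test₄′ : PT test₄
  test₄′ = _∙_ {g = distinct} {f = segmentsOf} distinct′ segmentsOf′

  test₅′ : PT test₅
  test₅′ = _∙_ {g = bordering} {f = shapeOf} bordering′ shapeOf′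

  test₆′ : PT test₆
  test₆′ = _∙_ {g = closed} {f = shapeOf} closed′ shapeOf′

  test₇′ : PT test₇
  test₇′ = _∙_ {g = linked} linked′ (_▵_ {f = domainOf} {g = λ i → proj₁ (proj₂ (proj₂ i))} domainOf′ (fst ∙ snd ∙ snd))

  test₈′ : PT test₈
  test₈′ = _∙_ {g = linkedOutside} linkedOutside′ (_▵_ {f = shapeOf} {g = λ i → proj₂ (proj₂ (proj₂ i))} shapeOf′ (snd ∙ snd ∙ snd))

  test₉′ : PT test₉
  test₉′ = _∙_ {g = usesTiles} {f = assignmentOf} usesTiles′ assignmentOf′

  test₁₀′ : PT test₁₀
  test₁₀′ = _∙_ {g = agrees} {f = assignmentOf} agrees′ assignmentOf′

  test₁₁′ : PT test₁₁
  test₁₁′ = _∙_ {g = agreesBorder} agreesBorder′ (_▵_ {f = assignmentOf} {g = borderOf} assignmentOf′ borderOf′)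

  check′ : PT check
  check′ = test₁′ &′ test₂′ &′ test₃′ &′ test₄′ &′ test₅′ &′ test₆′ &′ test₇′ &′ test₈′ &′ test₉′ &′ test₁₀′ &′ test₁₁′

module Soundness (W : List Tile) where
  open Verify W

  pick : Square → Assignment → Colouring
  pick a []            = (ℕᵇ.zero , ℕᵇ.zero) , (ℕᵇ.zero , ℕᵇ.zero)
  pick a ((b , t) ∷ A) = if eq a b then t else pick a A

  pick∈ : ∀ {a} A → a ∈ domain A → (a , pick a A) ∈ A
  pick∈ {a} ((b , t) ∷ A) a∈ with eq a b in eqn
  ... | true = here (cong (_, t) (eq⇒≡ eqn))
  pick∈ {a} ((b , t) ∷ A) (here refl) | false = case trans (sym eqn) (eq-refl a) of λ ()
  pick∈ {a} ((b , t) ∷ A) (there a∈)  | false = there (pick∈ A a∈)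

  module _ (A : Assignment) (B : Border)
           (nonEmpty′ : not (null (domain A)) ≡ true) (uniqueS : distinct (domain A) ≡ true)
           (uniqueB : distinct (segments B) ≡ true) (borders : bordering (domain A , segments B) ≡ true)
           (closes : closed (domain A , segments B) ≡ true) where

    S : List Square
    S = domain A

    D : Region
    D = toRegion (S , B)

    segments-D : map proj₁ (Region.boundary D) ≡ segments B
    segments-D = sym (map-∘ B)

    border : ∀ {a d} → (a , d) ∈ segments B → a ∈ S × neighbour d a ∉ S
    border h = let p = ∧-true (all⇒ (segments B) borders h) in elem⇒∈ _ S (proj₁ p) , not-elem (proj₂ p)

    listed : ∀ d a → a ∈ S → neighbour d a ∉ S → (a , d) ∈ segments B
    listed d a a∈ b∉ with ∨-true (all⇒ {p = λ d → sideClosed (((S , segments B) , a) , d)} directions (all⇒ S closes a∈) (∈-directions d))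
    ... | inj₁ h = ⊥-elim (b∉ (elem⇒∈ _ S h))
    ... | inj₂ h = elem⇒∈ _ (segments B) h

    first∈ : ∀ xs {x : Square} → not (null xs) ≡ true → firstOr x xs ∈ xs
    first∈ (x ∷ xs) h = here refl

    module _ (ds es : List Direction) (links : linked (S , ds) ≡ true)
             (links′ : linkedOutside ((S , segments B) , es) ≡ true) where

      inside : Connected (_∈ S)
      inside {a} {b} a∈ b∈ = joined-sym (to a a∈) ◅◅ to b b∈
        where
        p = ∧-true links
        to : ∀ x → x ∈ S → Joined (_∈ S) (firstOr origin S) x
        to x x∈ = trace-joined ds
          (All.tabulate λ y∈ → elem⇒∈ _ S (all⇒ (trace (firstOr origin S) ds) (proj₁ p) y∈))
          (elem⇒∈ x (trace (firstOr origin S) ds) (all⇒ S (proj₂ p) x∈))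

      outside : Connected (_∉ S)
      outside = complement-connected S (firstOr origin S) (first∈ S nonEmpty′) (firstOr origin (map neighbourOf (segments B))) outer
        where
        o = firstOr origin (map neighbourOf (segments B))
        outer : ∀ d a → a ∈ S → neighbour d a ∉ S → Joined (_∉ S) (neighbour d a) o
        outer d a a∈ b∉ with ∨-true links′ | listed d a a∈ b∉
        ... | inj₁ h | l = ⊥-elim (nonempty (segments B) h l)
          where
          nonempty : ∀ (xs : List Segment) {x} → null xs ≡ true → x ∉ xs
          nonempty [] h ()
        ... | inj₂ h | l = let p = ∧-true h in joined-sym (trace-joined es
          (All.tabulate λ y∈ → not-elem (all⇒ (trace o es) (proj₁ p) y∈))
          (elem⇒∈ (neighbour d a) (trace o es) (all⇒ (map neighbourOf (segments B)) (proj₂ p) (∈-map⁺ neighbourOf l))))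

      simplyConnected : IsSimplyConnectedRegion D
      simplyConnected = record
        { uniqueSquares = distinct⇒Unique S uniqueS
        ; polyomino     = record
          { nonEmpty = λ eq → case trans (sym (cong (not ∘ null) eq)) nonEmpty′ of λ ()
          ; connected = inside
          ; noHoles   = outside }
        ; uniqueColour  = subst Unique (sym segments-D) (distinct⇒Unique (segments B) uniqueB)
        ; coloured      = λ (a , d) → mk⇔ (λ h → border (subst ((a , d) ∈_) segments-D h))
                                          (λ (a∈ , b∉) → subst ((a , d) ∈_) (sym segments-D) (listed d a a∈ b∉)) }

    module _ (uses : usesTiles A ≡ true) (agree : agrees A ≡ true) (agreeB : agreesBorder (A , B) ≡ true) where

      fromW : ∀ t → t ∈ map fromTile W → toTile t ∈ W
      fromW t h with ∈-map⁻ fromTile h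
      ... | u , u∈ , refl = subst (_∈ W) (sym (to-from u)) u∈

      match : ∀ {a} d → a ∈ S → neighbour d a ∈ S →
              colourAt d (pick a A) ≡ colourAt (opposite d) (pick (neighbour d a) A)
      match {a} d a∈ b∈ = eq⇒≡ (implies⇒ {a = neighbour d a} {b = neighbour d a}
        (all⇒ {p = λ q → fits (((a , pick a A) , d) , q)} A (all⇒ {p = λ d → sideFits ((A , (a , pick a A)) , d)} directions (all⇒ A agree (pick∈ A a∈)) (∈-directions d)) (pick∈ A b∈)) refl)

      matchBorder : ∀ {a d c} → ((a , d) , c) ∈ B → colourAt d (pick a A) ≡ c
      matchBorder {a} b∈ = eq⇒≡ (implies⇒ {a = a} {b = a} (all⇒ A (all⇒ B agreeB b∈) (pick∈ A (proj₁ (border (∈-map⁺ proj₁ b∈))))) refl)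

      onBorder : ∀ {a d c} → ((a , d) , c) ∈ Region.boundary D → side d (toTile (pick a A)) ≡ c
      onBorder {a} {d} h with ∈-map⁻ (λ (s , c) → s , Bin.toℕ c) h
      ... | ((a , d) , c) , b∈ , refl = trans (side-toTile d (pick a A)) (cong Bin.toℕ (matchBorder b∈))

      tiles : Tiles W D
      tiles = (λ a → toTile (pick a A)) , record
        { fromSet = λ {a} a∈ → fromW (pick a A) (elem⇒∈ (pick a A) (map fromTile W) (all⇒ A uses (pick∈ A a∈)))
        ; matching = λ {a} d a∈ b∈ → trans (side-toTile d (pick a A)) (trans (cong Bin.toℕ (match d a∈ b∈))
            (sym (side-toTile (opposite d) (pick (neighbour d a) A))))
        ; matchesBoundary = onBorder }

  check-sound : ∀ w c → check (w , c) ≡ true → TilingProblem W w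
  check-sound w ((A , B) , (ds , es)) h₀ =
    let t₁ , h₁ = ∧-true h₀ ; t₂ , h₂ = ∧-true h₁ ; t₃ , h₃ = ∧-true h₂ ; t₄ , h₄ = ∧-true h₃ ; t₅ , h₅ = ∧-true h₄
        t₆ , h₆ = ∧-true h₅ ; t₇ , h₇ = ∧-true h₆ ; t₈ , h₈ = ∧-true h₇ ; t₉ , h₉ = ∧-true h₈ ; t₁₀ , t₁₁ = ∧-true h₉
    in toRegion (domain A , B) , sym (eq⇒≡ t₁) , simplyConnected A B t₂ t₃ t₄ t₅ t₆ ds es t₇ t₈ , tiles A B t₂ t₃ t₄ t₅ t₆ t₉ t₁₀ t₁₁

-- Short certificates for tileable regions.

length-encodeBits : ∀ ds → length (encodeBits ds) ≡ 2 * length ds + 1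
length-encodeBits []       = refl
length-encodeBits (d ∷ ds) = trans (cong (2 +_) (length-encodeBits ds)) (lemma (length ds))
  where
  lemma : ∀ n → 2 + (2 * n + 1) ≡ 2 * (1 + n) + 1
  lemma = solve-∀

size-encodeBits : ∀ (ds : List Bool) → ⌈ ds ⌉ ≤ 4 * length (encodeBits ds)
size-encodeBits ds = ≤-trans (word-size ds) (≤-trans (m≤m+n _ (4 * length ds + 3))
  (≤-reflexive (trans (lemma (length ds)) (cong (4 *_) (sym (length-encodeBits ds))))))
  where
  lemma : ∀ n → 4 * n + 1 + (4 * n + 3) ≡ 4 * (2 * n + 1)
  lemma = solve-∀

size-encodeℤ : ∀ (z : ℤ) → ⌈ z ⌉ ≤ 4 * length (encodeℤ z)
size-encodeℤ z = ≤-trans (s≤s (+-mono-≤ (size-Bool (proj₁ (signed z))) (size-encodeBits (proj₂ (signed z)))))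
  (≤-reflexive (trans (lemma (length (encodeBits (proj₂ (signed z))))) (cong (λ l → 4 * length l) (as-encodeℤ z))))
  where
  lemma : ∀ n → 1 + (3 + 4 * n) ≡ 4 * (1 + n)
  lemma = solve-∀
  as-encodeℤ : ∀ z → proj₁ (signed z) ∷ encodeBits (proj₂ (signed z)) ≡ encodeℤ z
  as-encodeℤ (pos n)  = refl
  as-encodeℤ -[1+ n ] = refl

size-encodeSquare : ∀ (a : Square) → ⌈ a ⌉ ≤ 1 + 4 * length (encodeSquare a)
size-encodeSquare (x , y) = s≤s (≤-trans (+-mono-≤ (size-encodeℤ x) (size-encodeℤ y))
  (≤-reflexive (trans (sym (*-distribˡ-+ 4 (length (encodeℤ x)) _)) (cong (4 *_) (sym (length-++ (encodeℤ x)))))))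

size-Direction : ∀ (d : Direction) → ⌈ d ⌉ ≤ 7
size-Direction north = ≤ᵇ⇒≤ 3 7 _
size-Direction south = ≤ᵇ⇒≤ 5 7 _
size-Direction west  = ≤ᵇ⇒≤ 5 7 _
size-Direction east  = ≤-refl

size-Directions : ∀ (ds : List Direction) → ⌈ ds ⌉ ≤ 8 * length ds + 1
size-Directions []       = ≤-refl
size-Directions (d ∷ ds) = ≤-trans (s≤s (+-mono-≤ (size-Direction d) (size-Directions ds))) (≤-reflexive (lemma (length ds)))
  where
  lemma : ∀ n → 1 + (7 + (8 * n + 1)) ≡ 8 * (1 + n) + 1
  lemma = solve-∀

-- The two added ones match: the list vertex that precedes each entry of the tree is paid for by the
-- bit that precedes it in the word.
size-encodeList : ∀ {X Y : Set} {{_ : Code Y}} (e : X → List Bool) (g : X → Y) k xs →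
                  (∀ {x} → x ∈ xs → 1 + ⌈ g x ⌉ ≤ suc k * (1 + length (e x))) →
                  ⌈ map g xs ⌉ ≤ suc k * length (encodeList e xs)
size-encodeList e g k []       h = s≤s z≤n
size-encodeList e g k (x ∷ xs) h = ≤-trans (+-mono-≤ (h (here refl)) (size-encodeList e g k xs (h ∘ there)))
  (≤-reflexive (trans (sym (*-distribˡ-+ (suc k) (1 + length (e x)) _)) (cong (λ l → suc k * suc l) (sym (length-++ (e x))))))

length-encodeList : ∀ {X : Set} (e : X → List Bool) xs → length xs ≤ length (encodeList e xs)
length-encodeList e []       = z≤n
length-encodeList e (x ∷ xs) = s≤s (≤-trans (length-encodeList e xs) (≤-trans (m≤n+m _ (length (e x))) (≤-reflexive (sym (length-++ (e x))))))

module Completeness (W : List Tile) where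
  open Verify W

  tileSize : ℕ
  tileSize = ⌈ map fromTile W ⌉

  tileSize≤ : ∀ {t} → t ∈ W → ⌈ fromTile t ⌉ ≤ tileSize
  tileSize≤ h = go W h
    where
    go : ∀ ts {t} → t ∈ ts → ⌈ fromTile t ⌉ ≤ ⌈ map fromTile ts ⌉
    go (t ∷ ts) (here refl) = m≤n⇒m≤1+n (m≤m+n _ _)
    go (t ∷ ts) (there h)   = m≤n⇒m≤1+n (≤-trans (go ts h) (m≤n+m _ _))

  -- The inner tour has k moves, where k is at most the square of the length of the word, and the
  -- intervals of `Clamp (2 + k + k)` contain 3+2k integers.
  boxSide : Poly
  boxSide = con 3 ⊕ var ⊗ var ⊕ var ⊗ var

  certBound : Poly
  certBound = con 3 ⊕ ((con (5 + tileSize) ⊗ var ⊕ con 15 ⊗ var) ⊕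
              ((con 8 ⊗ (var ⊗ var) ⊕ con 1) ⊕ (con 8 ⊗ (var ⊗ (boxSide ⊗ boxSide)) ⊕ con 1)))

  module _ (squares : List Square) (boundary : List (Segment × ℕ))
           (connectedRegion : IsSimplyConnectedRegion (region squares boundary))
           (f : Square → Tile) (tiling : IsTiling W (region squares boundary) f) where

    open IsSimplyConnectedRegion connectedRegion
    open IsSimplyConnectedPolyomino polyomino
    open IsTiling tiling

    word : List Bool
    word = encodeRegion (region squares boundary)

    n : ℕ
    n = length word

    A : Assignment
    A = map (λ a → a , fromTile (f a)) squares

    B : Border
    B = map (λ (s , c) → s , fromℕ c) boundary

    domain-A : domain A ≡ squares
    domain-A = trans (sym (map-∘ squares)) (map-id squares)

    segments-B : segments B ≡ map proj₁ boundary
    segments-B = sym (map-∘ boundary)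

    region-AB : toRegion (domain A , B) ≡ region squares boundary
    region-AB = cong₂ region domain-A (trans (sym (map-∘ boundary)) (trans (map-cong (λ (s , c) → cong (s ,_) (Bin.toℕ-fromℕ c)) boundary) (map-id boundary)))

    length-word : n ≡ length (encodeList encodeSquare squares) + length (encodeList (encodePair encodeSegment encodeℕ) boundary)
    length-word = length-++ (encodeList encodeSquare squares)

    squaresPart≤ : length (encodeList encodeSquare squares) ≤ n
    squaresPart≤ = subst (length (encodeList encodeSquare squares) ≤_) (sym length-word) (m≤m+n _ _)

    boundaryPart≤ : length (encodeList (encodePair encodeSegment encodeℕ) boundary) ≤ n
    boundaryPart≤ = subst (length (encodeList (encodePair encodeSegment encodeℕ) boundary) ≤_) (sym length-word) (m≤n+m _ _)

    squares≤ : length squares ≤ n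
    squares≤ = ≤-trans (length-encodeList encodeSquare squares) squaresPart≤

    boundary≤ : length boundary ≤ n
    boundary≤ = ≤-trans (length-encodeList (encodePair encodeSegment encodeℕ) boundary) boundaryPart≤

    size-A : ⌈ A ⌉ ≤ (5 + tileSize) * n
    size-A = ≤-trans (size-encodeList encodeSquare (λ a → a , fromTile (f a)) (4 + tileSize) squares entry≤)
      (*-monoʳ-≤ (5 + tileSize) squaresPart≤)
      where
      entry≤ : ∀ {a} → a ∈ squares → 1 + ⌈ a , fromTile (f a) ⌉ ≤ (5 + tileSize) * (1 + length (encodeSquare a))
      entry≤ {a} a∈ = ≤-trans (+-monoʳ-≤ 2 (+-mono-≤ (size-encodeSquare a) (tileSize≤ (fromSet a∈))))
        (≤-trans (m≤m+n _ (2 + length (encodeSquare a) + tileSize * length (encodeSquare a))) (≤-reflexive (lemma tileSize (length (encodeSquare a)))))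
        where
        lemma : ∀ t l → 2 + (1 + 4 * l + t) + (2 + l + t * l) ≡ (5 + t) * (1 + l)
        lemma = solve-∀

    size-B : ⌈ B ⌉ ≤ 15 * n
    size-B = ≤-trans (size-encodeList (encodePair encodeSegment encodeℕ) (λ (s , c) → s , fromℕ c) 14 boundary (λ {x} _ → entry≤ x))
      (*-monoʳ-≤ 15 boundaryPart≤)
      where
      entry≤ : ∀ x → 1 + ⌈ proj₁ x , fromℕ (proj₂ x) ⌉ ≤ 15 * (1 + length (encodePair encodeSegment encodeℕ x))
      entry≤ ((a , d) , c) = ≤-trans (+-monoʳ-≤ 2 (+-mono-≤ (s≤s (+-mono-≤ (size-encodeSquare a) (size-Direction d))) (size-encodeBits (digits (fromℕ c)))))
        (≤-trans (m≤m+n _ (4 + 11 * la + 15 * length (encodeDirection d) + 11 * lc)) (≤-reflexive (trans (lemma la (length (encodeDirection d)) lc)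
          (cong (λ l → 15 * (1 + l)) (sym (trans (length-++ (encodeSegment (a , d))) (cong (_+ lc) (length-++ (encodeSquare a)))))))))
        where
        la = length (encodeSquare a)
        lc = length (encodeℕ c)
        lemma : ∀ a d c → 2 + (1 + (1 + 4 * a + 7) + 4 * c) + (4 + 11 * a + 15 * d + 11 * c) ≡ 15 * (1 + (a + d + c))
        lemma = solve-∀

    start : Square
    start = firstOr origin squares

    start∈ : start ∈ squares
    start∈ = go squares nonEmpty
      where
      go : ∀ xs → xs ≢ [] → firstOr origin xs ∈ xs
      go []       h = ⊥-elim (h refl)
      go (x ∷ xs) h = here refl

    insideTour : ∃[ ds ] (length ds ≤ length squares * length squares × All (_∈ squares) (trace start ds) × All (_∈ trace start ds) squares)
    insideTour = Tour.tour (_∈ squares) squares id connected start squares start∈ (All.tabulate id)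

    ds : List Direction
    ds = proj₁ insideTour

    k : ℕ
    k = length ds

    k≤ : k ≤ n * n
    k≤ = ≤-trans (proj₁ (proj₂ insideTour)) (*-mono-≤ squares≤ squares≤)

    -- The start is given the offset k+1 in both coordinates. Since the tour of k moves meets all
    -- squares, these have offsets from 1 to 2k+1, strictly between 0 and 2k+2.
    open Clamp (2 + k + k)

    lx ly : ℤ
    lx = proj₁ start ℤ.- pos (suc k)
    ly = proj₂ start ℤ.- pos (suc k)

    middle : ∀ z → z ℤ.- (z ℤ.- pos (suc k)) ≡ pos (suc k)
    middle z = trans (cong (λ w → z ℤ.+ w) (ℤ.neg-distrib-+ z (ℤ.- pos (suc k))))
      (trans (sym (ℤ.+-assoc z (ℤ.- z) _)) (trans (cong (λ w → w ℤ.+ _) (ℤ.+-inverseʳ z)) (trans (ℤ.+-identityˡ _) (ℤ.neg-involutive (pos (suc k))))))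

    inner : ∀ {x y} → (x , y) ∈ squares → Inner lx x × Inner ly y
    inner a∈ = All.lookup (trace-inner (proj₁ start) (proj₂ start) ds (suc k) (suc k) (middle (proj₁ start)) (middle (proj₂ start)) ≤-refl ≤-refl ≤-refl ≤-refl)
                          (All.lookup (proj₂ (proj₂ (proj₂ insideTour))) a∈)

    open Plane lx ly squares inner

    outers : List Square
    outers = map neighbourOf (map proj₁ boundary)

    -- The region lies strictly inside the box, so a single step across its boundary does not leave
    -- the box.
    outerQ : ∀ {b} → b ∈ outers → Q b
    outerQ {b} b∈ with ∈-map⁻ neighbourOf b∈
    ... | (a , d) , s∈ , refl = let a∈ , b∉ = Equivalence.to (coloured (a , d)) s∈ in b∉ , near d a a∈
      where
      up : ∀ lo x → Inner lo x → clamp lo (sucℤ x) ≡ sucℤ x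
      up lo x (j , e , j<) = clamp-fixes lo (sucℤ x) (trans (suc-minus x lo) (cong sucℤ e)) j<
      down : ∀ lo x → Inner lo x → clamp lo (predℤ x) ≡ predℤ x
      down lo x (j , e , j<) = clamp-fixes lo (predℤ x) (trans (pred-minus x lo) (cong predℤ e)) (≤-trans (n≤1+n j) (<⇒≤ j<))
      same : ∀ lo x → Inner lo x → clamp lo x ≡ x
      same lo x (j , e , j<) = clamp-fixes lo x e (<⇒≤ j<)
      near : ∀ d a → a ∈ squares → clampSquare (neighbour d a) ≡ neighbour d a
      near north (x , y) a∈ = let ix , iy = inner a∈ in cong₂ _,_ (same lx x ix) (up ly y iy)
      near south (x , y) a∈ = let ix , iy = inner a∈ in cong₂ _,_ (same lx x ix) (down ly y iy)
      near west  (x , y) a∈ = let ix , iy = inner a∈ in cong₂ _,_ (down lx x ix) (same ly y iy)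
      near east  (x , y) a∈ = let ix , iy = inner a∈ in cong₂ _,_ (up lx x ix) (same ly y iy)

    -- `noHoles` gives a path of unknown length. Clamped to the box it keeps its ends, which are
    -- fixed by `Q`, and loop erasure can then bound it by the number of squares of the box.
    joinedQ : ∀ {a b} → Q a → Q b → Joined Q a b
    joinedQ (a∉ , ca) (b∉ , cb) = subst₂ (Joined Q) ca cb (clamp-joined (noHoles a∉ b∉))

    outsideTour : ∀ segs → (∀ {b} → b ∈ map neighbourOf segs → Q b) →
                  ∃[ es ] (length es ≤ length segs * length box × linkedOutside ((squares , segs) , es) ≡ true)
    outsideTour []         h = [] , z≤n , refl
    outsideTour (s ∷ segs) h =
      let es , es≤ , qs , ts∈ = Tour.tour Q box Q⊆box joinedQ (neighbourOf s) (map neighbourOf (s ∷ segs)) (h (here refl)) (All.tabulate h)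
          t = trace (neighbourOf s) es
      in es , ≤-trans es≤ (*-monoˡ-≤ (length box) (≤-reflexive (length-map neighbourOf (s ∷ segs)))) ,
         ∧-intro (⇒all t λ x∈ → elem-not (proj₁ (All.lookup qs x∈)))
                 (⇒all (map neighbourOf (s ∷ segs)) λ x∈ → ∈⇒elem (All.lookup ts∈ x∈))

    outsideWalk : ∃[ es ] (length es ≤ length (map proj₁ boundary) * length box × linkedOutside ((squares , map proj₁ boundary) , es) ≡ true)
    outsideWalk = outsideTour (map proj₁ boundary) outerQ

    es : List Direction
    es = proj₁ outsideWalk

    es≤ : length es ≤ ⟦ var ⊗ (boxSide ⊗ boxSide) ⟧ n
    es≤ = ≤-trans (proj₁ (proj₂ outsideWalk)) (*-mono-≤ (≤-trans (≤-reflexive (length-map proj₁ boundary)) boundary≤)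
      (≤-trans (≤-reflexive length-box) (*-mono-≤ side≤ side≤)))
      where
      side≤ : 3 + k + k ≤ ⟦ boxSide ⟧ n
      side≤ = +-mono-≤ (+-monoʳ-≤ 3 k≤) k≤

    cert : Cert
    cert = (A , B) , (ds , es)

    size-cert : ⌈ cert ⌉ ≤ ⟦ certBound ⟧ n
    size-cert = ≤-trans (≤-reflexive (lemma ⌈ A ⌉ ⌈ B ⌉ ⌈ ds ⌉ ⌈ es ⌉)) (+-monoʳ-≤ 3 (+-mono-≤ (+-mono-≤ size-A size-B)
      (+-mono-≤ (≤-trans (size-Directions ds) (+-monoˡ-≤ 1 (*-monoʳ-≤ 8 k≤)))
                (≤-trans (size-Directions es) (+-monoˡ-≤ 1 (*-monoʳ-≤ 8 es≤))))))
      where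
      lemma : ∀ a b c d → 1 + (1 + (a + b) + (1 + (c + d))) ≡ 3 + ((a + b) + (c + d))
      lemma = solve-∀

    at-domain : (P : List Square → Bool) → P squares ≡ true → P (domain A) ≡ true
    at-domain P = subst (λ S → P S ≡ true) (sym domain-A)

    at-segments : (P : List Segment → Bool) → P (map proj₁ boundary) ≡ true → P (segments B) ≡ true
    at-segments P = subst (λ S → P S ≡ true) (sym segments-B)

    at-shape : (P : List Square × List Segment → Bool) → P (squares , map proj₁ boundary) ≡ true → P (domain A , segments B) ≡ true
    at-shape P h = at-domain (λ S → P (S , segments B)) (at-segments (λ T → P (squares , T)) h)

    ok-encodes : encodes (word , (domain A , B)) ≡ true
    ok-encodes = subst (λ D → eq word (encodeRegion D) ≡ true) (sym region-AB) (eq-refl word)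

    ok-null : not (null (domain A)) ≡ true
    ok-null = at-domain (not ∘ null) (go squares nonEmpty)
      where
      go : ∀ (xs : List Square) → xs ≢ [] → not (null xs) ≡ true
      go []       h = ⊥-elim (h refl)
      go (x ∷ xs) h = refl

    ok-bordering : bordering (domain A , segments B) ≡ true
    ok-bordering = at-shape bordering (⇒all (map proj₁ boundary) λ {s} s∈ →
      let a∈ , b∉ = Equivalence.to (coloured s) s∈ in ∧-intro (∈⇒elem a∈) (elem-not b∉))

    ok-closed : closed (domain A , segments B) ≡ true
    ok-closed = at-shape closed (⇒all squares λ {a} a∈ → ⇒all directions λ {d} _ → either a d a∈)
      where
      either : ∀ a d → a ∈ squares → elem (neighbour d a) squares ∨ elem (a , d) (map proj₁ boundary) ≡ true
      either a d a∈ with ∈-or-∉ (neighbour d a) squares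
      ... | inj₁ b∈ = ∨-introˡ (∈⇒elem b∈)
      ... | inj₂ b∉ = ∨-introʳ {elem (neighbour d a) squares} (∈⇒elem (Equivalence.from (coloured (a , d)) (a∈ , b∉)))

    ok-linked : linked (domain A , ds) ≡ true
    ok-linked = at-domain (λ S → linked (S , ds)) (∧-intro
      (⇒all (trace start ds) λ x∈ → ∈⇒elem (All.lookup (proj₁ (proj₂ (proj₂ insideTour))) x∈))
      (⇒all squares λ x∈ → ∈⇒elem (All.lookup (proj₂ (proj₂ (proj₂ insideTour))) x∈)))

    ok-uses : usesTiles A ≡ true
    ok-uses = ⇒all A go
      where
      go : ∀ {p} → p ∈ A → elem (proj₂ p) (map fromTile W) ≡ true
      go p∈ with ∈-map⁻ (λ a → a , fromTile (f a)) p∈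
      ... | a , a∈ , refl = ∈⇒elem (∈-map⁺ fromTile (fromSet a∈))

    ≡⇒eq : ∀ {c c′ : ℕᵇ} → c ≡ c′ → eq c c′ ≡ true
    ≡⇒eq {c} refl = eq-refl c

    ok-agrees : agrees A ≡ true
    ok-agrees = ⇒all A λ {p} p∈ → ⇒all directions λ {d} _ → ⇒all A λ {q} q∈ → go d p∈ q∈
      where
      go : ∀ d {p q} → p ∈ A → q ∈ A → not (eq (proj₁ q) (neighbour d (proj₁ p))) ∨ eq (colourAt d (proj₂ p)) (colourAt (opposite d) (proj₂ q)) ≡ true
      go d p∈ q∈ with ∈-map⁻ (λ a → a , fromTile (f a)) p∈ | ∈-map⁻ (λ a → a , fromTile (f a)) q∈
      ... | a , a∈ , refl | b , b∈ , refl = ⇒implies {a = b} {b = neighbour d a} λ { refl → ≡⇒eq (trans (side-fromTile d (f a))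
        (trans (cong fromℕ (matching d a∈ b∈)) (sym (side-fromTile (opposite d) (f b))))) }

    ok-border : agreesBorder (A , B) ≡ true
    ok-border = ⇒all B λ {b} b∈ → ⇒all A λ {q} q∈ → go b∈ q∈
      where
      go : ∀ {b q} → b ∈ B → q ∈ A → not (eq (proj₁ q) (proj₁ (proj₁ b))) ∨ eq (colourAt (proj₂ (proj₁ b)) (proj₂ q)) (proj₂ b) ≡ true
      go b∈ q∈ with ∈-map⁻ (λ (s , c) → s , fromℕ c) b∈ | ∈-map⁻ (λ a → a , fromTile (f a)) q∈
      ... | ((a , d) , c) , b∈′ , refl | b , _ , refl = ⇒implies {a = b} {b = a} λ { refl → ≡⇒eq (trans (side-fromTile d (f b)) (cong fromℕ (matchesBoundary b∈′))) }

    check-cert : check (word , cert) ≡ true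
    check-cert = ∧-intro ok-encodes (∧-intro ok-null (∧-intro (at-domain distinct (Unique⇒distinct uniqueSquares))
      (∧-intro (at-segments distinct (Unique⇒distinct uniqueColour)) (∧-intro ok-bordering (∧-intro ok-closed (∧-intro ok-linked
      (∧-intro (at-shape (λ s → linkedOutside (s , es)) (proj₂ (proj₂ outsideWalk))) (∧-intro ok-uses (∧-intro ok-agrees ok-border)))))))))

TilingProblem-NP : ∀ W → NP (TilingProblem W)
TilingProblem-NP W = Checker⇒NP record
  { Certificate = Cert
  ; check       = check
  ; check-PT    = check′
  ; sound       = Soundness.check-sound W
  ; size-bound  = certBound
  ; complete    = λ { _ (region squares boundary , refl , simple , f , tiling) →
                      cert squares boundary simple f tiling , size-cert squares boundary simple f tiling , check-cert squares boundary simple f tiling } }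
  where
  open Verify W
  open Completeness W

-- Unique readability of encoded regions.

PrefixFree : {A : Set} → (A → List Bool) → Set
PrefixFree e = ∀ x y {u v} → e x ++ u ≡ e y ++ v → x ≡ y × u ≡ v

module _ {A : Set} {e : A → List Bool} (free : PrefixFree e) where

  prefixFree-List : PrefixFree (encodeList e)
  prefixFree-List []       []       eq = refl , ∷-injectiveʳ eq
  prefixFree-List (x ∷ xs) (y ∷ ys) {u} {v} eq
    with free x y (trans (sym (++-assoc (e x) _ u)) (trans (∷-injectiveʳ eq) (++-assoc (e y) _ v)))
  ... | refl , eq′ with prefixFree-List xs ys eq′
  ...   | refl , eq″ = refl , eq″

module _ {A B : Set} {e : A → List Bool} {e′ : B → List Bool} (free : PrefixFree e) (free′ : PrefixFree e′) where

  prefixFree-Pair : PrefixFree (encodePair e e′)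
  prefixFree-Pair (x , y) (x′ , y′) {u} {v} eq
    with free x x′ (trans (sym (++-assoc (e x) _ u)) (trans eq (++-assoc (e x′) _ v)))
  ... | refl , eq′ with free′ y y′ eq′
  ...   | refl , eq″ = refl , eq″

prefixFree-Bits : PrefixFree encodeBits
prefixFree-Bits = prefixFree-List λ { x y refl → refl , refl }

prefixFree-ℕ : PrefixFree encodeℕ
prefixFree-ℕ m n eq with prefixFree-Bits (digits (fromℕ m)) (digits (fromℕ n)) eq
... | eq′ , eq″ = Bin.fromℕ-injective (trans (sym (undigits-digits (fromℕ m))) (trans (cong undigits eq′) (undigits-digits (fromℕ n)))) , eq″

prefixFree-ℤ : PrefixFree encodeℤ
prefixFree-ℤ (pos m)  (pos n)  eq with prefixFree-ℕ m n (∷-injectiveʳ eq)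
... | refl , eq′ = refl , eq′
prefixFree-ℤ -[1+ m ] -[1+ n ] eq with prefixFree-ℕ m n (∷-injectiveʳ eq)
... | refl , eq′ = refl , eq′

prefixFree-Direction : PrefixFree encodeDirection
prefixFree-Direction north north refl = refl , refl
prefixFree-Direction south south refl = refl , refl
prefixFree-Direction west  west  refl = refl , refl
prefixFree-Direction east  east  refl = refl , refl

-- `TilingProblem` speaks of some region with the given word. Injectivity makes sure that the tiling
-- found is one of the rectangle that the reduction has written.
encodeRegion-injective : ∀ D E → encodeRegion D ≡ encodeRegion E → D ≡ E
encodeRegion-injective (region s b) (region s′ b′) eq
  with prefixFree-List prefixFree-Square s s′ eq
  where
  prefixFree-Square : PrefixFree encodeSquare
  prefixFree-Square = prefixFree-Pair prefixFree-ℤ prefixFree-ℤ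
... | refl , eq′
  with prefixFree-List (prefixFree-Pair (prefixFree-Pair (prefixFree-Pair prefixFree-ℤ prefixFree-ℤ) prefixFree-Direction) prefixFree-ℕ) b b′
         (cong (_++ []) eq′)
...   | refl , _ = refl

-- The tile set and the behaviour of its rows.

plain : Bool → Colour
plain false = 0
plain true  = 1

tokenOn : Bool → Bool → Colour
tokenOn false false = 2
tokenOn false true  = 3
tokenOn true  false = 4
tokenOn true  true  = 5

guess₁ guess₂ sink : Colour
guess₁ = 6
guess₂ = 7
sink   = 8

-- From here on the colours are those of west and east sides. They are numbered afresh: a horizontal
-- neighbour is never compared with a vertical one, so sharing numbers with the colours above does
-- no harm.
use : Bool → Colour
use false = 0
use true  = 1

token : Bool → Colour
token false = 2
token true  = 3

guessed : Bool → Colour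
guessed false = 4
guessed true  = 5

sinking : Colour
sinking = 6

bools : List Bool
bools = false ∷ true ∷ []

-- Values travel north in the columns, literals x and ¬x in neighbouring ones.
-- A row whose west colour is `use o` lets the token, which records whether the
-- current clause is satisfied, look at one value and step one column east.
tileTable : List ((ℕ × ℕ) × (ℕ × ℕ))
tileTable =
  concatMap (λ b → ((plain b , guess₁) , (use false , guessed b)) ∷ []) bools ++
  concatMap (λ b → ((plain (not b) , guess₂) , (guessed b , use false)) ∷ []) bools ++
  concatMap (λ b → ((tokenOn b false , plain b) , (token false , use false)) ∷ ((tokenOn b true , plain b) , (token true , use false)) ∷ []) bools ++
  concatMap (λ b → concatMap (λ o → ((plain b , plain b) , (use o , use o)) ∷ []) bools) bools ++
  concatMap (λ b → concatMap (λ o → concatMap (λ s → ((plain b , tokenOn b s) , (use o , token (s ∨ (o ∧ b)))) ∷ []) bools) bools) bools ++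
  concatMap (λ b → ((sink , plain b) , (sinking , sinking)) ∷ []) bools ++
  ((9 , 9) , (9 , 9)) ∷ []

mkTile : (ℕ × ℕ) × (ℕ × ℕ) → Tile
mkTile ((n , s) , (w , e)) = tile n s w e

W : List Tile
W = map mkTile tileTable

W-unique : Unique W
W-unique = Unique.map⁺ {f = mkTile} (λ { refl → refl }) (distinct⇒Unique tileTable refl)

-- Rows are read from the west and from below, so the south and west colours of a square are known.
-- Evaluating this list leaves the possible tiles, and the `forced` lemmas become case analyses with
-- a single case.
outputs : List Tile → Colour → Colour → List (Colour × Colour)
outputs []                    s w = []
outputs (tile n s′ w′ e ∷ ts) s w = if eq s′ s ∧ eq w′ w then (n , e) ∷ outputs ts s w else outputs ts s w

∈-outputs : ∀ ts {n s w e} → tile n s w e ∈ ts → (n , e) ∈ outputs ts s w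
∈-outputs (tile _ s w _ ∷ ts) (here refl) rewrite eq-refl s | eq-refl w = here refl
∈-outputs (tile _ s′ w′ _ ∷ ts) {s = s} {w} (there t∈) with eq s′ s ∧ eq w′ w
... | true  = there (∈-outputs ts t∈)
... | false = ∈-outputs ts t∈

outputs-∈ : ∀ ts {n s w e} → (n , e) ∈ outputs ts s w → tile n s w e ∈ ts
outputs-∈ (tile _ s′ w′ _ ∷ ts) {s = s} {w} h with eq s′ s in eqs | eq w′ w in eqw
outputs-∈ (tile _ s′ w′ _ ∷ ts) {s = s} {w} (here refl) | true | true with eq⇒≡ {a = s′} {b = s} eqs | eq⇒≡ {a = w′} {b = w} eqw
... | refl | refl = here refl
outputs-∈ (_ ∷ ts) (there h)   | true  | true  = there (outputs-∈ ts h)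
outputs-∈ (_ ∷ ts) h           | true  | false = there (outputs-∈ ts h)
outputs-∈ (_ ∷ ts) h           | false | _     = there (outputs-∈ ts h)

data Row : Colour → Colour → List Colour → List Colour → Set where
  []  : ∀ {w} → Row w w [] []
  _∷_ : ∀ {w m e n s ss ns} → tile n s w m ∈ W → Row m e ss ns → Row w e (s ∷ ss) (n ∷ ns)

data Rows : List (Colour × Colour) → List Colour → List Colour → Set where
  []  : ∀ {ss} → Rows [] ss ss
  _∷_ : ∀ {w e r ss ms ns} → Row w e ss ms → Rows r ms ns → Rows ((w , e) ∷ r) ss ns

Rows-++⁺ : ∀ {r r′ ss ms ns} → Rows r ss ms → Rows r′ ms ns → Rows (r ++ r′) ss ns
Rows-++⁺ []       q = q
Rows-++⁺ (x ∷ p) q = x ∷ Rows-++⁺ p q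

Rows-++⁻ : ∀ r {r′ ss ns} → Rows (r ++ r′) ss ns → ∃[ ms ] (Rows r ss ms × Rows r′ ms ns)
Rows-++⁻ []      q = _ , [] , q
Rows-++⁻ (_ ∷ r) (x ∷ q) = let _ , p , q′ = Rows-++⁻ r q in _ , x ∷ p , q′

given : ∀ {n s w e} → (n , e) ∈ outputs W s w → tile n s w e ∈ W
given = outputs-∈ W

forced-cross : ∀ b o {n e} → tile n (plain b) (use o) e ∈ W → n ≡ plain b × e ≡ use o
forced-cross false false h with ∈-outputs W h
... | here refl = refl , refl
forced-cross false true  h with ∈-outputs W h
... | here refl = refl , refl
forced-cross true  false h with ∈-outputs W h
... | here refl = refl , refl
forced-cross true  true  h with ∈-outputs W h
... | here refl = refl , refl

cross : ∀ b o → tile (plain b) (plain b) (use o) (use o) ∈ W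
cross false false = given (here refl)
cross false true  = given (here refl)
cross true  false = given (here refl)
cross true  true  = given (here refl)

forced-token : ∀ b s o {n e} → tile n (tokenOn b s) (use o) e ∈ W → n ≡ plain b × e ≡ token (s ∨ (o ∧ b))
forced-token false false false h with ∈-outputs W h
... | here refl = refl , refl
forced-token false false true  h with ∈-outputs W h
... | here refl = refl , refl
forced-token false true  false h with ∈-outputs W h
... | here refl = refl , refl
forced-token false true  true  h with ∈-outputs W h
... | here refl = refl , refl
forced-token true  false false h with ∈-outputs W h
... | here refl = refl , refl
forced-token true  false true  h with ∈-outputs W h
... | here refl = refl , refl
forced-token true  true  false h with ∈-outputs W h
... | here refl = refl , refl
forced-token true  true  true  h with ∈-outputs W h
... | here refl = refl , refl

pass : ∀ b s o → tile (plain b) (tokenOn b s) (use o) (token (s ∨ (o ∧ b))) ∈ W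
pass false false false = given (here refl)
pass false false true  = given (here refl)
pass false true  false = given (here refl)
pass false true  true  = given (here refl)
pass true  false false = given (here refl)
pass true  false true  = given (here refl)
pass true  true  false = given (here refl)
pass true  true  true  = given (here refl)

forced-prepare : ∀ b s {n e} → tile n (plain b) (token s) e ∈ W → n ≡ tokenOn b s × e ≡ use false
forced-prepare false false h with ∈-outputs W h
... | here refl = refl , refl
forced-prepare false true  h with ∈-outputs W h
... | here refl = refl , refl
forced-prepare true  false h with ∈-outputs W h
... | here refl = refl , refl
forced-prepare true  true  h with ∈-outputs W h
... | here refl = refl , refl

prepare : ∀ b s → tile (tokenOn b s) (plain b) (token s) (use false) ∈ W
prepare false false = given (here refl)
prepare false true  = given (here refl)
prepare true  false = given (here refl)
prepare true  true  = given (here refl)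

values : List Bool → List Colour
values = map plain

forced-crosses : ∀ o bs {e ns} → Row (use o) e (values bs) ns → e ≡ use o × ns ≡ values bs
forced-crosses o []       []      = refl , refl
forced-crosses o (b ∷ bs) (t ∷ r) with forced-cross b o t
... | refl , refl with forced-crosses o bs r
...   | refl , refl = refl , refl

crosses : ∀ o bs → Row (use o) (use o) (values bs) (values bs)
crosses o []       = []
crosses o (b ∷ bs) = cross b o ∷ crosses o bs

satisfies : List Bool → List Bool → Bool
satisfies (o ∷ os) (b ∷ bs) = o ∧ b ∨ satisfies os bs
satisfies _        _        = false

-- One row per column. The colour `use o` crosses the columns to the west of the token and tells it
-- whether to count the value it stands on. Only in the last row is there no further column to take
-- up the token, so there it must come out at the east side.
tokenRows : List Bool → List (Colour × Colour)
tokenRows []           = []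
tokenRows (o ∷ [])     = (use o , token true) ∷ []
tokenRows (o ∷ p ∷ os) = (use o , use false) ∷ tokenRows (p ∷ os)

clauseRows : List Bool → List (Colour × Colour)
clauseRows os = (token false , use false) ∷ tokenRows os

token-injective : ∀ {s} → token s ≡ token true → s ≡ true
token-injective {true} _ = refl

skip-crosses : ∀ {o e} bs {ss ns} → Row (use o) e (values bs ++ ss) ns →
               ∃[ ns′ ] (ns ≡ values bs ++ ns′ × Row (use o) e ss ns′)
skip-crosses []       r       = _ , refl , r
skip-crosses {o} (b ∷ bs) (t ∷ r) with forced-cross b o t
... | refl , refl with skip-crosses bs r
...   | _ , refl , r′ = _ , refl , r′

add-crosses : ∀ {o e} bs {ss ns} → Row (use o) e ss ns → Row (use o) e (values bs ++ ss) (values bs ++ ns)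
add-crosses []       r = r
add-crosses (b ∷ bs) r = cross b _ ∷ add-crosses bs r

rearrange : ∀ {A B : Set} (f : A → B) as b cs → map f as ++ f b ∷ cs ≡ map f (as ++ b ∷ []) ++ cs
rearrange f as b cs = trans (sym (++-assoc (map f as) (f b ∷ []) cs)) (cong (_++ cs) (sym (map-++ f as (b ∷ []))))

-- The induction follows the token: `pre` are the columns passed, `b` is the value under it, and `s`
-- says whether a true literal has been met. In the last row the token leaves with its final state,
-- and the prescribed east colour makes that state `true`.
tokenRows⇒ : ∀ o os pre b post s {ns} → length os ≡ length post →
             Rows (tokenRows (o ∷ os)) (values pre ++ tokenOn b s ∷ values post) ns →
             ns ≡ values (pre ++ b ∷ post) × s ∨ satisfies (o ∷ os) (b ∷ post) ≡ true
tokenRows⇒ o [] pre b [] s len (r ∷ []) with skip-crosses pre r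
... | _ , refl , t ∷ q with forced-token b s o t
tokenRows⇒ o [] pre b [] s len (r ∷ []) | _ , refl , t ∷ q | refl , eqe = finish q eqe
  where
  finish : ∀ {m ns′} → Row m (token true) [] ns′ → m ≡ token (s ∨ (o ∧ b)) →
           values pre ++ plain b ∷ ns′ ≡ values (pre ++ b ∷ []) × s ∨ (o ∧ b ∨ false) ≡ true
  finish [] eqe = sym (map-++ plain pre (b ∷ [])) , trans (cong (s ∨_) (∨-identityʳ (o ∧ b))) (token-injective (sym eqe))
tokenRows⇒ o (p ∷ os) pre b (c ∷ post) s len (r ∷ rs) with skip-crosses pre r
... | _ , refl , t ∷ t′ ∷ q with forced-token b s o t
...   | refl , refl with forced-prepare c (s ∨ (o ∧ b)) t′
...     | refl , refl with forced-crosses false post q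
...       | refl , refl with tokenRows⇒ p os (pre ++ b ∷ []) c post (s ∨ (o ∧ b)) (suc-injective len)
                               (subst (λ ss → Rows (tokenRows (p ∷ os)) ss _) (rearrange plain pre b _) rs)
...         | eq , sat = trans eq (cong values (++-assoc pre (b ∷ []) (c ∷ post))) , trans (sym (∨-assoc s (o ∧ b) _)) sat

⇒tokenRows : ∀ o os pre b post s → length os ≡ length post → s ∨ satisfies (o ∷ os) (b ∷ post) ≡ true →
             Rows (tokenRows (o ∷ os)) (values pre ++ tokenOn b s ∷ values post) (values (pre ++ b ∷ post))
⇒tokenRows o [] pre b [] s len sat =
  subst (λ e → Row (use o) e (values pre ++ tokenOn b s ∷ []) (values (pre ++ b ∷ []))) (cong token (trans (sym (cong (s ∨_) (∨-identityʳ (o ∧ b)))) sat))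
    (subst (Row (use o) _ _) (sym (map-++ plain pre (b ∷ []))) (add-crosses pre (pass b s o ∷ []))) ∷ []
⇒tokenRows o (p ∷ os) pre b (c ∷ post) s len sat =
  add-crosses pre (pass b s o ∷ prepare c (s ∨ (o ∧ b)) ∷ crosses false post) ∷
  subst₂ (Rows (tokenRows (p ∷ os))) (sym (rearrange plain pre b _)) (cong values (++-assoc pre (b ∷ []) (c ∷ post)))
    (⇒tokenRows p os (pre ++ b ∷ []) c post (s ∨ (o ∧ b)) (suc-injective len) (trans (∨-assoc s (o ∧ b) _) sat))

clauseRows⇒ : ∀ o os b bs {ns} → length os ≡ length bs → Rows (clauseRows (o ∷ os)) (values (b ∷ bs)) ns →
              ns ≡ values (b ∷ bs) × satisfies (o ∷ os) (b ∷ bs) ≡ true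
clauseRows⇒ o os b bs len ((t ∷ r) ∷ rs) with forced-prepare b false t
... | refl , refl with forced-crosses false bs r
...   | _ , refl = tokenRows⇒ o os [] b bs false len rs

⇒clauseRows : ∀ o os b bs → length os ≡ length bs → satisfies (o ∷ os) (b ∷ bs) ≡ true →
              Rows (clauseRows (o ∷ os)) (values (b ∷ bs)) (values (b ∷ bs))
⇒clauseRows o os b bs len sat = (prepare b false ∷ crosses false bs) ∷ ⇒tokenRows o os [] b bs false len sat

clausesRows : List (List Bool) → List (Colour × Colour)
clausesRows = concatMap clauseRows

clausesRows⇒ : ∀ css b bs {ns} → All (λ os → length os ≡ suc (length bs)) css → Rows (clausesRows css) (values (b ∷ bs)) ns →
               ns ≡ values (b ∷ bs) × All (λ os → satisfies os (b ∷ bs) ≡ true) css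
clausesRows⇒ []               b bs []          []  = refl , []
clausesRows⇒ ((o ∷ os) ∷ css) b bs (len ∷ lens) rs with Rows-++⁻ (clauseRows (o ∷ os)) rs
... | _ , p , q with clauseRows⇒ o os b bs (suc-injective len) p
...   | refl , sat = let eq , sats = clausesRows⇒ css b bs lens q in eq , sat ∷ sats

⇒clausesRows : ∀ css b bs → All (λ os → length os ≡ suc (length bs)) css → All (λ os → satisfies os (b ∷ bs) ≡ true) css →
               Rows (clausesRows css) (values (b ∷ bs)) (values (b ∷ bs))
⇒clausesRows []               b bs []           []           = []
⇒clausesRows ((o ∷ os) ∷ css) b bs (len ∷ lens) (sat ∷ sats) =
  Rows-++⁺ (⇒clauseRows o os b bs (suc-injective len) sat) (⇒clausesRows css b bs lens sats)

double : List Bool → List Bool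
double []       = []
double (a ∷ as) = a ∷ not a ∷ double as

length-double′ : ∀ as → length (double as) ≡ length as + length as
length-double′ []       = refl
length-double′ (a ∷ as) = trans (cong (2 +_) (length-double′ as)) (sym (cong suc (+-suc (length as) (length as))))

guesses : ℕ → List Colour
guesses zero    = []
guesses (suc n) = guess₁ ∷ guess₂ ∷ guesses n

-- A tile on `guess₁` chooses the value and shows it to its eastern neighbour as `guessed b`; the
-- tile on `guess₂` has no choice but to emit the negation.
guessRow⇒ : ∀ n {e ns} → Row (use false) e (guesses n) ns → ∃[ as ] (length as ≡ n × ns ≡ values (double as))
guessRow⇒ zero    []           = [] , refl , refl
guessRow⇒ (suc n) (t ∷ t′ ∷ r) = first (∈-outputs W t) t′ r
  where
  second : ∀ a {n₂ m e ns} → (n₂ , m) ∈ outputs W guess₂ (guessed a) → Row m e (guesses n) ns →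
           ∃[ as ] (length as ≡ suc n × plain a ∷ n₂ ∷ ns ≡ values (double as))
  second false (here refl) r = let as , len , eq = guessRow⇒ n r in false ∷ as , cong suc len , cong (λ l → 0 ∷ 1 ∷ l) eq
  second true  (here refl) r = let as , len , eq = guessRow⇒ n r in true ∷ as , cong suc len , cong (λ l → 1 ∷ 0 ∷ l) eq
  first : ∀ {n₁ n₂ m m′ e ns} → (n₁ , m) ∈ outputs W guess₁ (use false) → tile n₂ guess₂ m m′ ∈ W → Row m′ e (guesses n) ns →
          ∃[ as ] (length as ≡ suc n × n₁ ∷ n₂ ∷ ns ≡ values (double as))
  first (here refl)         t′ r = second false (∈-outputs W t′) r
  first (there (here refl)) t′ r = second true (∈-outputs W t′) r

⇒guessRow : ∀ as → Row (use false) (use false) (guesses (length as)) (values (double as))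
⇒guessRow []           = []
⇒guessRow (false ∷ as) = given (here refl) ∷ given (here refl) ∷ ⇒guessRow as
⇒guessRow (true ∷ as)  = given (there (here refl)) ∷ given (here refl) ∷ ⇒guessRow as

⇒sinkRow : ∀ bs → Row sinking sinking (values bs) (replicate (length bs) sink)
⇒sinkRow []           = []
⇒sinkRow (false ∷ bs) = given (here refl) ∷ ⇒sinkRow bs
⇒sinkRow (true ∷ bs)  = given (here refl) ∷ ⇒sinkRow bs

formulaRows : List (List Bool) → List (Colour × Colour)
formulaRows css = (use false , use false) ∷ clausesRows css ++ (sinking , sinking) ∷ []

-- There is at least one variable because the token needs a first column to start in. The values
-- survive all clauses unchanged, so all clauses are tested against the same assignment.
formulaRows⇒ : ∀ n css {ns} → All (λ os → length os ≡ suc n + suc n) css → Rows (formulaRows css) (guesses (suc n)) ns →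
               ∃[ as ] (length as ≡ suc n × All (λ os → satisfies os (double as) ≡ true) css)
formulaRows⇒ n css lens (g ∷ rs) with guessRow⇒ (suc n) g
... | a ∷ as , len , refl with Rows-++⁻ (clausesRows css) rs
...   | _ , p , _ = a ∷ as , len , proj₂ (clausesRows⇒ css a (not a ∷ double as)
          (subst (λ m → All (λ os → length os ≡ m) css) (sym (trans (length-double′ (a ∷ as)) (cong₂ _+_ len len))) lens) p)

⇒formulaRows : ∀ n css as → All (λ os → length os ≡ suc n + suc n) css → length as ≡ suc n →
               All (λ os → satisfies os (double as) ≡ true) css →
               Rows (formulaRows css) (guesses (suc n)) (replicate (suc n + suc n) sink)
⇒formulaRows n css (a ∷ as) lens refl sats =
  ⇒guessRow (a ∷ as) ∷ Rows-++⁺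
    (⇒clausesRows css a (not a ∷ double as) (subst (λ m → All (λ os → length os ≡ m) css) (sym (length-double′ (a ∷ as))) lens) sats)
    (subst (λ m → Row sinking sinking (values (double (a ∷ as))) (replicate m sink)) (length-double′ (a ∷ as)) (⇒sinkRow (double (a ∷ as))) ∷ [])

-- Rectangles as simply connected regions, and their tilings as stacks of rows.

map-elim : ∀ {A B : Set} (P : B → Set) (f : A → B) {xs} → (∀ {x} → x ∈ xs → P (f x)) → ∀ {y} → y ∈ map f xs → P y
map-elim P f h y∈ with ∈-map⁻ f y∈
... | x , x∈ , refl = h x∈

++-elim : ∀ {A : Set} (P : A → Set) xs {ys} → (∀ {y} → y ∈ xs → P y) → (∀ {y} → y ∈ ys → P y) → ∀ {y} → y ∈ xs ++ ys → P y
++-elim P xs h h′ y∈ with ∈-++⁻ xs y∈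
... | inj₁ p = h p
... | inj₂ q = h′ q

data At {A : Set} : List A → ℕ → A → Set where
  here  : ∀ {x xs} → At (x ∷ xs) 0 x
  there : ∀ {x y xs i} → At xs i x → At (y ∷ xs) (suc i) x

indexed⇒At : ∀ {A : Set} xs {i} {x : A} → (i , x) ∈ indexed xs → At xs i x
indexed⇒At (x ∷ xs) (here refl) = here
indexed⇒At (x ∷ xs) (there h) with ∈-map⁻ (λ (i , y) → suc i , y) h
... | _ , h′ , refl = there (indexed⇒At xs h′)

At⇒indexed : ∀ {A : Set} {xs i} {x : A} → At xs i x → (i , x) ∈ indexed xs
At⇒indexed here      = here refl
At⇒indexed (there h) = there (∈-map⁺ (λ (i , y) → suc i , y) (At⇒indexed h))

At-< : ∀ {A : Set} {xs i} {x : A} → At xs i x → i < length xs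
At-< here      = s≤s z≤n
At-< (there h) = s≤s (At-< h)

At-∃ : ∀ {A : Set} (xs : List A) {i} → i < length xs → ∃ (At xs i)
At-∃ (x ∷ xs) {zero}  h       = x , here
At-∃ (x ∷ xs) {suc i} (s≤s h) = let y , a = At-∃ xs h in y , there a

At-extensional : ∀ {A : Set} (xs ys : List A) → length xs ≡ length ys →
                 (∀ i {x y} → At xs i x → At ys i y → x ≡ y) → xs ≡ ys
At-extensional []       []       _   _ = refl
At-extensional (x ∷ xs) (y ∷ ys) len h =
  cong₂ _∷_ (h 0 here here) (At-extensional xs ys (suc-injective len) (λ i a b → h (suc i) (there a) (there b)))

firsts : ∀ {A : Set} (xs : List A) → map proj₁ (indexed xs) ≡ upTo (length xs)
firsts []       = refl
firsts (x ∷ xs) = cong (0 ∷_) (trans (trans (sym (map-∘ (indexed xs))) (map-∘ (indexed xs)))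
  (trans (cong (map suc) (firsts xs)) (map-upTo suc (length xs))))

indices-upTo : ∀ n → indices n ≡ upTo n
indices-upTo n = trans (firsts (replicate n tt)) (cong upTo (length-replicate n))

grid : ℕ → ℕ → List Square
grid l h = concatMap (λ i → map (λ j → pos i , pos j) (indices h)) (indices l)

southBorder northBorder : ℕ → List Colour → List (Segment × Colour)
southBorder h cs = map (λ (i , c) → ((pos i , pos 0) , south) , c) (indexed cs)
northBorder h cs = map (λ (i , c) → ((pos i , pos (pred h)) , north) , c) (indexed cs)

westBorder eastBorder : ℕ → List (Colour × Colour) → List (Segment × Colour)
westBorder l r = map (λ (j , we) → ((pos 0 , pos j) , west) , proj₁ we) (indexed r)
eastBorder l r = map (λ (j , we) → ((pos (pred l) , pos j) , east) , proj₂ we) (indexed r)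

rectangle : List Colour → List (Colour × Colour) → List Colour → List Square × List (Segment × Colour)
rectangle ss r ns = grid (length ss) (length r) ,
  (southBorder (length r) ss ++ northBorder (length r) ns ++ westBorder (length ss) r ++ eastBorder (length ss) r)

module Rectangle (ss ns : List Colour) (r : List (Colour × Colour)) (l h : ℕ)
                 (len-s : length ss ≡ suc l) (len-n : length ns ≡ suc l) (len-r : length r ≡ suc h) where

  squares : List Square
  squares = proj₁ (rectangle ss r ns)

  boundary : List (Segment × Colour)
  boundary = proj₂ (rectangle ss r ns)

  D : Region
  D = region squares boundary

  squares-product : squares ≡ cartesianProduct (map pos (upTo (suc l))) (map pos (upTo (suc h)))
  squares-product = trans (cong₂ grid len-s len-r) (trans (cong₂ (λ is js → concatMap (λ i → map (λ j → pos i , pos j) js) is) (indices-upTo (suc l)) (indices-upTo (suc h)))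
                      (product (upTo (suc l)) (upTo (suc h))))
    where
    product : ∀ is js → concatMap (λ i → map (λ j → pos i , pos j) js) is ≡ cartesianProduct (map pos is) (map pos js)
    product []       js = refl
    product (i ∷ is) js = cong₂ _++_ (map-∘ js) (product is js)

  inside⁺ : ∀ {i j} → i ≤ l → j ≤ h → (pos i , pos j) ∈ squares
  inside⁺ i≤ j≤ = subst (_ ∈_) (sym squares-product) (∈-cartesianProduct⁺ (∈-map⁺ pos (∈-upTo⁺ (s≤s i≤))) (∈-map⁺ pos (∈-upTo⁺ (s≤s j≤))))

  Inside : Square → Set
  Inside a = ∃[ i ] ∃[ j ] (a ≡ (pos i , pos j) × i ≤ l × j ≤ h)

  inside⁻ : ∀ {a} → a ∈ squares → Inside a
  inside⁻ a∈ with ∈-cartesianProduct⁻ (map pos (upTo (suc l))) (map pos (upTo (suc h))) (subst (_ ∈_) squares-product a∈)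
  ... | x∈ , y∈ with ∈-map⁻ pos x∈ | ∈-map⁻ pos y∈
  ...   | i , i∈ , refl | j , j∈ , refl = i , j , refl , ≤-pred (∈-upTo⁻ i∈) , ≤-pred (∈-upTo⁻ j∈)

  left-of : ∀ {n y} → (-[1+ n ] , y) ∉ squares
  left-of h with inside⁻ h
  ... | _ , _ , () , _

  below : ∀ {n x} → (x , -[1+ n ]) ∉ squares
  below h with inside⁻ h
  ... | _ , _ , () , _

  right-of : ∀ {y} → (pos (suc l) , y) ∉ squares
  right-of h with inside⁻ h
  ... | _ , _ , refl , l< , _ = <-irrefl refl l<

  above : ∀ {x} → (x , pos (suc h)) ∉ squares
  above h with inside⁻ h
  ... | _ , _ , refl , _ , h< = <-irrefl refl h<

  southSide northSide westSide eastSide : ℕ → Segment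
  southSide i = (pos i , pos 0) , south
  northSide i = (pos i , pos h) , north
  westSide  j = (pos 0 , pos j) , west
  eastSide  j = (pos l , pos j) , east

  sides : List Segment
  sides = map southSide (upTo (suc l)) ++ map northSide (upTo (suc l)) ++ map westSide (upTo (suc h)) ++ map eastSide (upTo (suc h))

  border-segments : ∀ {A : Set} (c : A → Colour) (xs : List A) {n} → length xs ≡ n → (f g : ℕ → Segment) → (∀ i → f i ≡ g i) →
                    map proj₁ (map (λ (i , x) → f i , c x) (indexed xs)) ≡ map g (upTo n)
  border-segments c xs {n} len f g eq = trans (sym (map-∘ (indexed xs))) (trans (map-∘ {g = f} {f = proj₁} (indexed xs))
    (trans (cong (map f) (trans (firsts xs) (cong upTo len))) (map-cong eq (upTo n))))

  segments-sides : map proj₁ boundary ≡ sides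
  segments-sides = trans (map-++ proj₁ (southBorder (length r) ss) _) (cong₂ _++_ (border-segments id ss len-s southSide southSide λ _ → refl)
    (trans (map-++ proj₁ (northBorder (length r) ns) _) (cong₂ _++_
      (border-segments id ns len-n (λ i → (pos i , pos (pred (length r))) , north) northSide λ i → cong (λ k → (pos i , pos (pred k)) , north) len-r)
    (trans (map-++ proj₁ (westBorder (length ss) r) _) (cong₂ _++_ (border-segments proj₁ r len-r westSide westSide λ _ → refl)
      (border-segments proj₂ r len-r (λ j → (pos (pred (length ss)) , pos j) , east) eastSide λ j → cong (λ k → (pos (pred k) , pos j) , east) len-s))))))

  disjoint : ∀ (f g : ℕ → Segment) xs ys → (∀ i j → f i ≢ g j) → Disjoint (map f xs) (map g ys)
  disjoint f g xs ys ne (p , q) with ∈-map⁻ f p | ∈-map⁻ g q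
  ... | i , _ , refl | j , _ , eq = ne i j eq

  disjoint-++ : ∀ (xs ys zs : List Segment) → Disjoint xs ys → Disjoint xs zs → Disjoint xs (ys ++ zs)
  disjoint-++ xs ys zs d e (p , q) with ∈-++⁻ ys q
  ... | inj₁ h = d (p , h)
  ... | inj₂ h = e (p , h)

  sides-unique : Unique sides
  sides-unique = Unique.++⁺ (one southSide λ { refl → refl })
    (Unique.++⁺ (one northSide λ { refl → refl }) (Unique.++⁺ (one westSide λ { refl → refl }) (one eastSide λ { refl → refl })
        (disjoint westSide eastSide ys ys λ _ _ ()))
      (disjoint-++ (map northSide xs) (map westSide ys) (map eastSide ys) (disjoint northSide westSide xs ys λ _ _ ()) (disjoint northSide eastSide xs ys λ _ _ ())))
    (disjoint-++ (map southSide xs) (map northSide xs) (map westSide ys ++ map eastSide ys) (disjoint southSide northSide xs xs λ _ _ ())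
      (disjoint-++ (map southSide xs) (map westSide ys) (map eastSide ys) (disjoint southSide westSide xs ys λ _ _ ()) (disjoint southSide eastSide xs ys λ _ _ ())))
    where
    xs = upTo (suc l)
    ys = upTo (suc h)
    one : ∀ {n} (f : ℕ → Segment) → (∀ {i j} → f i ≡ f j → i ≡ j) → Unique (map f (upTo n))
    one {n} f inj = Unique.map⁺ inj (Unique.upTo⁺ n)

  sides-elim : (P : Segment → Set) → (∀ {i} → i ≤ l → P (southSide i)) → (∀ {i} → i ≤ l → P (northSide i)) →
               (∀ {j} → j ≤ h → P (westSide j)) → (∀ {j} → j ≤ h → P (eastSide j)) → ∀ {s} → s ∈ sides → P s
  sides-elim P s n w e = ++-elim P (map southSide (upTo (suc l))) (map-elim P southSide (s ∘ index≤))
    (++-elim P (map northSide (upTo (suc l))) (map-elim P northSide (n ∘ index≤))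
      (++-elim P (map westSide (upTo (suc h))) (map-elim P westSide (w ∘ index≤)) (map-elim P eastSide (e ∘ index≤))))
    where
    index≤ : ∀ {i n} → i ∈ upTo (suc n) → i ≤ n
    index≤ i∈ = ≤-pred (∈-upTo⁻ i∈)

  sides⇒ : ∀ {s} → s ∈ sides → IsBoundary squares s
  sides⇒ = sides-elim (IsBoundary squares) (λ i≤ → inside⁺ i≤ z≤n , below) (λ i≤ → inside⁺ i≤ ≤-refl , above)
    (λ j≤ → inside⁺ z≤n j≤ , left-of) (λ j≤ → inside⁺ ≤-refl j≤ , right-of)

  private
    inS : ∀ {i} → i ≤ l → southSide i ∈ sides
    inS i≤ = ∈-++⁺ˡ (∈-map⁺ southSide (∈-upTo⁺ (s≤s i≤)))
    inN : ∀ {i} → i ≤ l → northSide i ∈ sides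
    inN i≤ = ∈-++⁺ʳ (map southSide (upTo (suc l))) (∈-++⁺ˡ (∈-map⁺ northSide (∈-upTo⁺ (s≤s i≤))))
    inW : ∀ {j} → j ≤ h → westSide j ∈ sides
    inW j≤ = ∈-++⁺ʳ (map southSide (upTo (suc l))) (∈-++⁺ʳ (map northSide (upTo (suc l))) (∈-++⁺ˡ (∈-map⁺ westSide (∈-upTo⁺ (s≤s j≤)))))
    inE : ∀ {j} → j ≤ h → eastSide j ∈ sides
    inE j≤ = ∈-++⁺ʳ (map southSide (upTo (suc l))) (∈-++⁺ʳ (map northSide (upTo (suc l))) (∈-++⁺ʳ (map westSide (upTo (suc h))) (∈-map⁺ eastSide (∈-upTo⁺ (s≤s j≤)))))

  side-of : ∀ d i j → i ≤ l → j ≤ h → neighbour d (pos i , pos j) ∉ squares → ((pos i , pos j) , d) ∈ sides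
  side-of south i zero    i≤ j≤ b∉ = inS i≤
  side-of south i (suc j) i≤ j≤ b∉ = ⊥-elim (b∉ (inside⁺ i≤ (<⇒≤ j≤)))
  side-of west  zero j    i≤ j≤ b∉ = inW j≤
  side-of west  (suc i) j i≤ j≤ b∉ = ⊥-elim (b∉ (inside⁺ (<⇒≤ i≤) j≤))
  side-of north i j       i≤ j≤ b∉ = last (m≤n⇒m<n∨m≡n j≤)
    where
    last : suc j ≤ h ⊎ j ≡ h → ((pos i , pos j) , north) ∈ sides
    last (inj₁ j<)   = ⊥-elim (b∉ (inside⁺ i≤ j<))
    last (inj₂ refl) = inN i≤
  side-of east  i j       i≤ j≤ b∉ = last (m≤n⇒m<n∨m≡n i≤)
    where
    last : suc i ≤ l ⊎ i ≡ l → ((pos i , pos j) , east) ∈ sides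
    last (inj₁ i<)   = ⊥-elim (b∉ (inside⁺ i< j≤))
    last (inj₂ refl) = inE j≤

  ⇒sides : ∀ a d → IsBoundary squares (a , d) → (a , d) ∈ sides
  ⇒sides a d (a∈ , b∉) =
    let i , j , eq , i≤ , j≤ = inside⁻ a∈
    in subst (λ a → (a , d) ∈ sides) (sym eq) (side-of d i j i≤ j≤ (subst (λ a → neighbour d a ∉ squares) eq b∉))

  toCorner : ∀ {i j} → i ≤ l → j ≤ h → Joined (_∈ squares) (pos i , pos j) (pos 0 , pos 0)
  toCorner {zero}  {zero}  i≤ j≤ = ε
  toCorner {zero}  {suc j} i≤ j≤ = (inside⁺ i≤ j≤ , inside⁺ i≤ (<⇒≤ j≤) , south , refl) ◅ toCorner i≤ (<⇒≤ j≤)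
  toCorner {suc i} {j}     i≤ j≤ = (inside⁺ i≤ j≤ , inside⁺ (<⇒≤ i≤) j≤ , west , refl) ◅ toCorner (<⇒≤ i≤) j≤

  fromInside : ∀ {a} → a ∈ squares → Joined (_∈ squares) a (pos 0 , pos 0)
  fromInside a∈ = let i , j , eq , i≤ , j≤ = inside⁻ a∈ in subst (λ a → Joined (_∈ squares) a _) (sym eq) (toCorner i≤ j≤)

  connected : Connected (_∈ squares)
  connected a∈ b∈ = fromInside a∈ ◅◅ joined-sym (fromInside b∈)

  Out : Square → Square → Set
  Out = Joined (_∉ squares)

  westward : ∀ {y} → (∀ {x} → (x , y) ∉ squares) → ∀ i → Out (pos i , y) (-[1+ 0 ] , y)
  westward out zero    = (out , out , west , refl) ◅ ε
  westward out (suc i) = (out , out , west , refl) ◅ westward out i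

  southward : ∀ {x} → (∀ {y} → (x , y) ∉ squares) → ∀ j → Out (x , pos j) (x , -[1+ 0 ])
  southward out zero    = (out , out , south , refl) ◅ ε
  southward out (suc j) = (out , out , south , refl) ◅ southward out j

  -- A square across a side lies in a row or a column that misses the rectangle. Along it, and after
  -- at most one turn, a path leads to the square south-west of the corner.
  outer : ∀ d a → a ∈ squares → neighbour d a ∉ squares → Out (neighbour d a) (-[1+ 0 ] , -[1+ 0 ])
  outer d a a∈ b∉ = sides-elim (λ (a , d) → Out (neighbour d a) (-[1+ 0 ] , -[1+ 0 ]))
    (λ {i} _ → westward below i) (λ {i} _ → westward above i ◅◅ southward left-of (suc h))
    (λ {j} _ → southward left-of j) (λ {j} _ → southward right-of j ◅◅ westward below (suc l)) (⇒sides a d (a∈ , b∉))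

  simplyConnected : IsSimplyConnectedRegion D
  simplyConnected = record
    { uniqueSquares = subst Unique (sym squares-product)
        (Unique.cartesianProduct⁺ (Unique.map⁺ ℤ.+-injective (Unique.upTo⁺ (suc l))) (Unique.map⁺ ℤ.+-injective (Unique.upTo⁺ (suc h))))
    ; polyomino = record
      { nonEmpty  = λ eq → case subst ((pos 0 , pos 0) ∈_) eq (inside⁺ z≤n z≤n) of λ ()
      ; connected = connected
      ; noHoles   = complement-connected squares (pos 0 , pos 0) (inside⁺ z≤n z≤n) (-[1+ 0 ] , -[1+ 0 ]) outer }
    ; uniqueColour = subst Unique (sym segments-sides) sides-unique
    ; coloured = λ (a , d) → mk⇔ (λ s∈ → sides⇒ (subst (_ ∈_) segments-sides s∈)) (λ b → subst (_ ∈_) (sym segments-sides) (⇒sides a d b)) }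

-- The tiling conditions in natural coordinates, with border colours given by position in a list.
-- They separate the arithmetic of squares from the induction on rows.
record Grid (ss : List Colour) (r : List (Colour × Colour)) (ns : List Colour) (t : ℕ → ℕ → Tile) : Set where
  field
    fromW   : ∀ {x y} → x < length ss → y < length r → t x y ∈ W
    across  : ∀ {x y} → suc x < length ss → y < length r → side east (t x y) ≡ side west (t (suc x) y)
    upward  : ∀ {x y} → x < length ss → suc y < length r → side north (t x y) ≡ side south (t x (suc y))
    onSouth : ∀ {x c} → 0 < length r → At ss x c → side south (t x 0) ≡ c
    onNorth : ∀ {x y c} → At ns x c → suc y ≡ length r → side north (t x y) ≡ c
    onWest  : ∀ {y we} → 0 < length ss → At r y we → side west (t 0 y) ≡ proj₁ we
    onEast  : ∀ {x y we} → At r y we → suc x ≡ length ss → side east (t x y) ≡ proj₂ we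

row-length : ∀ {w e ss ns} → Row w e ss ns → length ss ≡ length ns
row-length []      = refl
row-length (_ ∷ r) = cong suc (row-length r)

rows-length : ∀ {r ss ns} → Rows r ss ns → length ss ≡ length ns
rows-length []       = refl
rows-length (x ∷ rs) = trans (row-length x) (rows-length rs)

rowTile : ∀ {w e ss ns} → Row w e ss ns → ℕ → Tile
rowTile []      _       = tile 0 0 0 0
rowTile (_∷_ {w} {m} {e} {n} {s} _ r) zero    = tile n s w m
rowTile (_ ∷ r) (suc i) = rowTile r i

rowTile∈ : ∀ {w e ss ns} (r : Row w e ss ns) {i} → i < length ss → rowTile r i ∈ W
rowTile∈ (t ∷ r) {zero}  _       = t
rowTile∈ (t ∷ r) {suc i} (s≤s h) = rowTile∈ r h

rowTile-west : ∀ {w e ss ns} (r : Row w e ss ns) → 0 < length ss → side west (rowTile r 0) ≡ w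
rowTile-west (t ∷ r) _ = refl

rowTile-across : ∀ {w e ss ns} (r : Row w e ss ns) {i} → suc i < length ss → side east (rowTile r i) ≡ side west (rowTile r (suc i))
rowTile-across (t ∷ r) {zero}  (s≤s h) = sym (rowTile-west r h)
rowTile-across (t ∷ r) {suc i} (s≤s h) = rowTile-across r h

rowTile-east : ∀ {w e ss ns} (r : Row w e ss ns) {i} → suc i ≡ length ss → side east (rowTile r i) ≡ e
rowTile-east (t ∷ [])    {zero}  _ = refl
rowTile-east (t ∷ r)     {suc i} h = rowTile-east r (suc-injective h)

rowTile-south : ∀ {w e ss ns} (r : Row w e ss ns) {i c} → At ss i c → side south (rowTile r i) ≡ c
rowTile-south (t ∷ r) here      = refl
rowTile-south (t ∷ r) (there h) = rowTile-south r h

rowTile-north : ∀ {w e ss ns} (r : Row w e ss ns) {i c} → At ns i c → side north (rowTile r i) ≡ c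
rowTile-north (t ∷ r) here      = refl
rowTile-north (t ∷ r) (there h) = rowTile-north r h

gridTile : ∀ {r ss ns} → Rows r ss ns → ℕ → ℕ → Tile
gridTile []       x _       = tile 0 0 0 0
gridTile (r ∷ rs) x zero    = rowTile r x
gridTile (r ∷ rs) x (suc y) = gridTile rs x y

gridTile-grid : ∀ {r ss ns} (rs : Rows r ss ns) → Grid ss r ns (gridTile rs)
gridTile-grid [] = record
  { fromW = λ _ () ; across = λ _ () ; upward = λ _ () ; onSouth = λ () ; onNorth = λ _ () ; onWest = λ _ () ; onEast = λ () }
gridTile-grid {ss = ss} (_∷_ {w} {e} {r} {ms = ms} {ns} row rs) = record
  { fromW = λ { {x} {zero} x< y< → rowTile∈ row x< ; {x} {suc y} x< (s≤s y<) → fromW (bound x<) y< }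
  ; across = λ { {x} {zero} x< y< → rowTile-across row x< ; {x} {suc y} x< (s≤s y<) → across (bound x<) y< }
  ; upward = λ { {x} {zero} x< (s≤s y<) → let c , at = At-∃ ms (bound x<) in trans (rowTile-north row at) (sym (onSouth y< at))
               ; {x} {suc y} x< (s≤s y<) → upward (bound x<) y< }
  ; onSouth = λ _ → rowTile-south row
  ; onNorth = λ { {x} {zero} at eq → last at (suc-injective eq) ; {x} {suc y} at eq → onNorth at (suc-injective eq) }
  ; onWest = λ { h here → rowTile-west row h ; h (there at) → onWest (bound h) at }
  ; onEast = λ { here eq → rowTile-east row eq ; (there at) eq → onEast at (trans eq (row-length row)) } }
  where
  open Grid (gridTile-grid rs)
  bound : ∀ {x} → x < length ss → x < length ms
  bound = subst (_ <_) (row-length row)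
  last : ∀ {x c} → At ns x c → 0 ≡ length r → side north (rowTile row x) ≡ c
  last = go rs
    where
    go : ∀ {r ns} → Rows r ms ns → ∀ {x c} → At ns x c → 0 ≡ length r → side north (rowTile row x) ≡ c
    go [] at _ = rowTile-north row at

norths : (ℕ → Tile) → ℕ → List Colour
norths t zero    = []
norths t (suc n) = side north (t 0) ∷ norths (t ∘ suc) n

length-norths : ∀ t n → length (norths t n) ≡ n
length-norths t zero    = refl
length-norths t (suc n) = cong suc (length-norths (t ∘ suc) n)

At-norths : ∀ t n {i c} → At (norths t n) i c → side north (t i) ≡ c
At-norths t (suc n) here      = refl
At-norths t (suc n) (there h) = At-norths (t ∘ suc) n h

row-from : ∀ ss (t : ℕ → Tile) {w e} → (∀ {i} → i < length ss → t i ∈ W) →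
           (∀ {i} → suc i < length ss → side east (t i) ≡ side west (t (suc i))) →
           (∀ {i c} → At ss i c → side south (t i) ≡ c) → (0 < length ss → side west (t 0) ≡ w) →
           (∀ {i} → suc i ≡ length ss → side east (t i) ≡ e) → (0 ≡ length ss → w ≡ e) → Row w e ss (norths t (length ss))
row-from []       t in-W acr south′ west′ east′ nil = subst (λ e → Row _ e [] []) (nil refl) []
row-from (s ∷ ss) t in-W acr south′ west′ east′ nil =
  subst₂ (λ s w → tile (side north (t 0)) s w (side east (t 0)) ∈ W) (south′ here) (west′ (s≤s z≤n)) (in-W (s≤s z≤n)) ∷
  row-from ss (t ∘ suc) (in-W ∘ s≤s) (acr ∘ s≤s) (south′ ∘ there) (λ h → sym (acr (s≤s h))) (east′ ∘ cong suc) (east′ ∘ cong suc)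

-- The bottom row is peeled off, and the north colours of its tiles become the south border of what
-- remains. When no row remains, the south and north borders have to be the same list, which the
-- premise on an empty `r` provides.
rows-from : ∀ ss r ns (t : ℕ → ℕ → Tile) → 0 < length ss → length ns ≡ length ss → (0 ≡ length r → ss ≡ ns) →
            Grid ss r ns t → Rows r ss ns
rows-from ss []            ns t l len nil g = subst (Rows [] ss) (nil refl) []
rows-from ss ((w , e) ∷ r) ns t l len nil g =
  row-from ss (λ x → t x 0) (λ h → fromW h (s≤s z≤n)) (λ h → across h (s≤s z≤n)) (onSouth (s≤s z≤n)) (λ _ → onWest l here)
           (onEast here) (λ eq → ⊥-elim (<-irrefl eq l)) ∷
  rows-from ms r ns (λ x y → t x (suc y)) (subst (0 <_) (sym len-ms) l) (trans len (sym len-ms))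
    -- If the row just removed was the last one, the north border prescribes the colours of its
    -- tiles one by one; this determines the whole list.
    (λ eq → At-extensional ms ns (trans len-ms (sym len)) λ i a b → trans (sym (At-norths _ _ a)) (onNorth b (cong suc eq)))
    record
      { fromW   = λ x< y< → fromW (bound x<) (s≤s y<)
      ; across  = λ x< y< → across (bound x<) (s≤s y<)
      ; upward  = λ x< y< → upward (bound x<) (s≤s y<)
      ; onSouth = λ h at → trans (sym (upward (bound (At-< at)) (s≤s h))) (At-norths _ _ at)
      ; onNorth = λ at eq → onNorth at (cong suc eq)
      ; onWest  = λ _ at → onWest l (there at)
      ; onEast  = λ at eq → onEast (there at) (trans eq len-ms) }
  where
  open Grid g
  ms = norths (λ x → t x 0) (length ss)
  len-ms : length ms ≡ length ss
  len-ms = length-norths _ (length ss)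
  bound : ∀ {x} → x < length ms → x < length ss
  bound = subst (_ <_) len-ms

module _ (ss ns : List Colour) (r : List (Colour × Colour)) (l h : ℕ)
         (len-s : length ss ≡ suc l) (len-n : length ns ≡ suc l) (len-r : length r ≡ suc h) where

  open Rectangle ss ns r l h len-s len-n len-r

  private
    x<⇒ : ∀ {x} → x < length ss → x ≤ l
    x<⇒ x< = ≤-pred (subst (_ <_) len-s x<)

    y<⇒ : ∀ {y} → y < length r → y ≤ h
    y<⇒ y< = ≤-pred (subst (_ <_) len-r y<)

    ⇒x< : ∀ {x} → x ≤ l → x < length ss
    ⇒x< x≤ = subst (_ <_) (sym len-s) (s≤s x≤)

    ⇒y< : ∀ {y} → y ≤ h → y < length r
    ⇒y< y≤ = subst (_ <_) (sym len-r) (s≤s y≤)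

  Tiles⇒Rows : Tiles W D → Rows r ss ns
  Tiles⇒Rows (f , tiling) = rows-from ss r ns (λ x y → f (pos x , pos y)) (⇒x< z≤n) (trans len-n (sym len-s))
    (λ eq → case trans eq len-r of λ ()) record
      { fromW   = λ x< y< → fromSet (inside⁺ (x<⇒ x<) (y<⇒ y<))
      ; across  = λ x< y< → matching east (inside⁺ (<⇒≤ (x<⇒ x<)) (y<⇒ y<)) (inside⁺ (x<⇒ x<) (y<⇒ y<))
      ; upward  = λ x< y< → matching north (inside⁺ (x<⇒ x<) (<⇒≤ (y<⇒ y<))) (inside⁺ (x<⇒ x<) (y<⇒ y<))
      ; onSouth = λ _ at → matchesBoundary (∈-++⁺ˡ (∈-map⁺ _ (At⇒indexed at)))
      ; onNorth = λ {x} {y} at eq → matchesBoundary (∈-++⁺ʳ (southBorder (length r) ss) (∈-++⁺ˡ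
          (subst (λ k → (((pos x , pos k) , north) , _) ∈ northBorder (length r) ns) (cong pred (sym eq)) (∈-map⁺ _ (At⇒indexed at)))))
      ; onWest  = λ {y} _ at → matchesBoundary (∈-++⁺ʳ (southBorder (length r) ss) (∈-++⁺ʳ (northBorder (length r) ns) (∈-++⁺ˡ (∈-map⁺ _ (At⇒indexed at)))))
      ; onEast  = λ {x} {y} at eq → matchesBoundary (∈-++⁺ʳ (southBorder (length r) ss) (∈-++⁺ʳ (northBorder (length r) ns) (∈-++⁺ʳ (westBorder (length ss) r)
          (subst (λ k → (((pos k , pos y) , east) , _) ∈ eastBorder (length ss) r) (cong pred (sym eq)) (∈-map⁺ _ (At⇒indexed at)))))) }
    where open IsTiling tiling

  private
    place : (ℕ → ℕ → Tile) → Square → Tile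
    place t (pos x , pos y) = t x y
    place t _               = t 0 0

  Rows⇒Tiles : Rows r ss ns → Tiles W D
  Rows⇒Tiles rs = place t , record { fromSet = from ; matching = match ; matchesBoundary = onBorder }
    where
    t = gridTile rs
    open Grid (gridTile-grid rs)
    from : ∀ {a} → a ∈ squares → place t a ∈ W
    from a∈ with inside⁻ a∈
    ... | i , j , refl , i≤ , j≤ = fromW (⇒x< i≤) (⇒y< j≤)
    match : ∀ {a} d → a ∈ squares → neighbour d a ∈ squares → side d (place t a) ≡ side (opposite d) (place t (neighbour d a))
    match d a∈ b∈ with inside⁻ a∈
    match north a∈ b∈ | i , j , refl , i≤ , j≤ with inside⁻ b∈
    ... | _ , _ , refl , _ , j< = upward (⇒x< i≤) (⇒y< j<)
    match east  a∈ b∈ | i , j , refl , i≤ , j≤ with inside⁻ b∈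
    ... | _ , _ , refl , i< , _ = across (⇒x< i<) (⇒y< j≤)
    match south a∈ b∈ | i , zero  , refl , i≤ , j≤ = ⊥-elim (below b∈)
    match south a∈ b∈ | i , suc j , refl , i≤ , j≤ = sym (upward (⇒x< i≤) (⇒y< j≤))
    match west  a∈ b∈ | zero  , j , refl , i≤ , j≤ = ⊥-elim (left-of b∈)
    match west  a∈ b∈ | suc i , j , refl , i≤ , j≤ = sym (across (⇒x< i≤) (⇒y< j≤))
    onBorder : ∀ {a d c} → ((a , d) , c) ∈ boundary → side d (place t a) ≡ c
    onBorder b∈ with ∈-++⁻ (southBorder (length r) ss) b∈
    ... | inj₁ p with ∈-map⁻ _ p
    ...   | (i , c) , ic∈ , refl = onSouth (⇒y< z≤n) (indexed⇒At ss ic∈)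
    onBorder b∈ | inj₂ q with ∈-++⁻ (northBorder (length r) ns) q
    ... | inj₁ p with ∈-map⁻ _ p
    ...   | (i , c) , ic∈ , refl = onNorth (indexed⇒At ns ic∈) (trans (cong (λ n → suc (pred n)) len-r) (sym len-r))
    onBorder b∈ | inj₂ q | inj₂ q′ with ∈-++⁻ (westBorder (length ss) r) q′
    ... | inj₁ p with ∈-map⁻ _ p
    ...   | (j , we) , jwe∈ , refl = onWest (⇒x< z≤n) (indexed⇒At r jwe∈)
    onBorder b∈ | inj₂ q | inj₂ q′ | inj₂ p with ∈-map⁻ _ p
    ...   | (j , we) , jwe∈ , refl = onEast (indexed⇒At r jwe∈) (trans (cong (λ n → suc (pred n)) len-s) (sym len-s))

-- From satisfiability to tilings.

Literal : Set
Literal = Bool × ℕ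

CNF : Set
CNF = List (List Literal)

holds : (ℕ → Bool) → Literal → Bool
holds a (s , j) = if s then a j else not (a j)

Satisfiable : CNF → Set
Satisfiable cs = ∃[ a ] (∀ {c} → c ∈ cs → ∃[ l ] (l ∈ c × holds a l ≡ true))

-- The order agrees with `double`: the column of a variable comes before that of its negation.
choices : List Literal → ℕ → List Bool
choices c j = elem (true , j) c ∷ elem (false , j) c ∷ []

choicesUpTo : ℕ → List Literal → List Bool
choicesUpTo n c = concatMap (choices c) (indices n)

length-choices : ∀ c js → length (concatMap (choices c) js) ≡ length js + length js
length-choices c []       = refl
length-choices c (j ∷ js) = trans (cong (2 +_) (length-choices c js)) (sym (cong suc (+-suc (length js) (length js))))

length-choicesUpTo : ∀ n c → length (choicesUpTo n c) ≡ n + n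
length-choicesUpTo n c = trans (length-choices c (indices n))
  (cong₂ _+_ (trans (cong length (indices-upTo n)) (length-upTo n)) (trans (cong length (indices-upTo n)) (length-upTo n)))

satisfies⇒ : ∀ c js as → satisfies (concatMap (choices c) js) (double as) ≡ true →
             ∃[ i ] ∃[ j ] ∃[ b ] (At js i j × At as i b × (b , j) ∈ c)
satisfies⇒ c (j ∷ js) (a ∷ as) h with ∨-true {elem (true , j) c ∧ a} h
satisfies⇒ c (j ∷ js) (true ∷ as)  h | inj₁ p = 0 , j , true , here , here , elem⇒∈ (true , j) c (proj₁ (∧-true {elem (true , j) c} p))
satisfies⇒ c (j ∷ js) (false ∷ as) h | inj₁ p = case proj₂ (∧-true {elem (true , j) c} {false} p) of λ ()
satisfies⇒ c (j ∷ js) (a ∷ as) h | inj₂ q with ∨-true {elem (false , j) c ∧ not a} q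
... | inj₂ s = let i , j′ , b , x , y , z = satisfies⇒ c js as s in suc i , j′ , b , there x , there y , z
satisfies⇒ c (j ∷ js) (false ∷ as) h | inj₂ q | inj₁ p = 0 , j , false , here , here , elem⇒∈ (false , j) c (proj₁ (∧-true {elem (false , j) c} p))
satisfies⇒ c (j ∷ js) (true ∷ as)  h | inj₂ q | inj₁ p = case proj₂ (∧-true {elem (false , j) c} {false} p) of λ ()

⇒satisfies : ∀ {c js as i j b} → At js i j → At as i b → (b , j) ∈ c → satisfies (concatMap (choices c) js) (double as) ≡ true
⇒satisfies {c} {j ∷ js} {b = true}  here here l = ∨-introˡ (∧-intro (∈⇒elem l) refl)
⇒satisfies {c} {j ∷ js} {b = false} here here l = ∨-introʳ {elem (true , j) c ∧ false} (∨-introˡ (∧-intro (∈⇒elem l) refl))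
⇒satisfies {c} {j ∷ js} {a ∷ as} (there x) (there y) l =
  ∨-introʳ {elem (true , j) c ∧ a} (∨-introʳ {elem (false , j) c ∧ not a} (⇒satisfies x y l))

nth : List Bool → ℕ → Bool
nth []       _       = false
nth (a ∷ as) zero    = a
nth (a ∷ as) (suc i) = nth as i

nth-At : ∀ {as i b} → At as i b → nth as i ≡ b
nth-At here      = refl
nth-At (there h) = nth-At h

At-applyUpTo : ∀ {A : Set} (f : ℕ → A) n {i x} → At (applyUpTo f n) i x → x ≡ f i
At-applyUpTo f (suc n) here      = refl
At-applyUpTo f (suc n) (there h) = At-applyUpTo (f ∘ suc) n h

applyUpTo-At : ∀ {A : Set} (f : ℕ → A) {n i} → i < n → At (applyUpTo f n) i (f i)
applyUpTo-At f {suc n} {zero}  _       = here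
applyUpTo-At f {suc n} {suc i} (s≤s h) = there (applyUpTo-At (f ∘ suc) h)

formula : ℕ → CNF → List (Colour × Colour)
formula n cs = formulaRows (map (choicesUpTo n) cs)

picture : ℕ × CNF → List Square × List (Segment × Colour)
picture (n , cs) = rectangle (guesses n) (formula n cs) (replicate (n + n) sink)

asRegion : List Square × List (Segment × Colour) → Region
asRegion (squares , boundary) = region squares boundary

module _ (n : ℕ) (cs : CNF) (small : ∀ {c l} → c ∈ cs → l ∈ c → proj₂ l < suc n) where

  private
    N = suc n

    length-guesses : ∀ n → length (guesses n) ≡ n + n
    length-guesses zero    = refl
    length-guesses (suc n) = trans (cong (2 +_) (length-guesses n)) (sym (cong suc (+-suc n n)))

    lengths : All (λ os → length os ≡ N + N) (map (choicesUpTo N) cs)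
    lengths = All.tabulate λ os∈ → case ∈-map⁻ (choicesUpTo N) os∈ of λ { (c , _ , refl) → length-choicesUpTo N c }

    module R = Rectangle (guesses N) (replicate (N + N) sink) (formula N cs) (n + N) _ (length-guesses N) (length-replicate (N + N)) refl

  Satisfiable⇒Rows : Satisfiable cs → Rows (formula N cs) (guesses N) (replicate (N + N) sink)
  Satisfiable⇒Rows (a , h) = ⇒formulaRows n _ (applyUpTo a N) lengths (length-applyUpTo a N)
    (All.tabulate λ os∈ → case ∈-map⁻ (choicesUpTo N) os∈ of λ { (c , c∈ , refl) → sat c c∈ })
    where
    length-applyUpTo : ∀ {A : Set} (f : ℕ → A) n → length (applyUpTo f n) ≡ n
    length-applyUpTo f zero    = refl
    length-applyUpTo f (suc n) = cong suc (length-applyUpTo (f ∘ suc) n)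
    value : ∀ s b → (if s then b else not b) ≡ true → b ≡ s
    value true  b     eq = eq
    value false false eq = refl
    sat : ∀ c → c ∈ cs → satisfies (choicesUpTo N c) (double (applyUpTo a N)) ≡ true
    sat c c∈ with h c∈
    ... | (s , j) , l∈ , hl = subst (λ js → satisfies (concatMap (choices c) js) (double (applyUpTo a N)) ≡ true) (sym (indices-upTo N))
      (⇒satisfies (applyUpTo-At id (small c∈ l∈)) (subst (At (applyUpTo a N) j) (value s (a j) hl) (applyUpTo-At a (small c∈ l∈))) l∈)

  Rows⇒Satisfiable : Rows (formula N cs) (guesses N) (replicate (N + N) sink) → Satisfiable cs
  Rows⇒Satisfiable rs with formulaRows⇒ n _ lengths rs
  ... | as , len , sats = nth as , λ {c} c∈ → found c (All.lookup sats (∈-map⁺ (choicesUpTo N) c∈))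
    where
    value : ∀ s {b} → b ≡ s → (if s then b else not b) ≡ true
    value true  refl = refl
    value false refl = refl
    found : ∀ c → satisfies (choicesUpTo N c) (double as) ≡ true → ∃[ l ] (l ∈ c × holds (nth as) l ≡ true)
    found c sat with satisfies⇒ c (upTo N) as (subst (λ js → satisfies (concatMap (choices c) js) (double as) ≡ true) (indices-upTo N) sat)
    ... | i , j , b , x , y , l∈ with At-applyUpTo id N x
    ...   | refl = (b , i) , l∈ , value b (nth-At y)

  Satisfiable⇔Tiling : Satisfiable cs ⇔ TilingProblem W (encodeRegion (asRegion (picture (N , cs))))
  Satisfiable⇔Tiling = mk⇔
    (λ s → R.D , refl , R.simplyConnected , Rows⇒Tiles _ _ _ _ _ (length-guesses N) (length-replicate (N + N)) refl (Satisfiable⇒Rows s))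
    (λ (D , eq , _ , t) → Rows⇒Satisfiable (Tiles⇒Rows _ _ _ _ _ (length-guesses N) (length-replicate (N + N)) refl
      (subst (Tiles W) (encodeRegion-injective D R.D eq) t)))

-- Clauses that describe the runs of a machine.

∈-concatMap⁺′ : ∀ {A B : Set} (f : A → List B) {xs x y} → x ∈ xs → y ∈ f x → y ∈ concatMap f xs
∈-concatMap⁺′ f x∈ y∈ = ∈-concat⁺′ y∈ (∈-map⁺ f x∈)

∈-concatMap⁻′ : ∀ {A B : Set} (f : A → List B) xs {y} → y ∈ concatMap f xs → ∃[ x ] (x ∈ xs × y ∈ f x)
∈-concatMap⁻′ f xs y∈ with ∈-concat⁻′ (map f xs) y∈
... | ys , y∈ys , ys∈ with ∈-map⁻ f ys∈
...   | x , x∈ , refl = x , x∈ , y∈ys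

module _ {A : Set} where

  nthSymbol : List (Symbol A) → ℕ → Symbol A
  nthSymbol []       _       = blank
  nthSymbol (s ∷ ss) zero    = s
  nthSymbol (s ∷ ss) (suc n) = nthSymbol ss n

  -- The symbol at a cell, relative to the head.
  look : Tape A → ℤ → Symbol A
  look (tape ls s rs) (pos zero)    = s
  look (tape ls s rs) (pos (suc n)) = nthSymbol rs n
  look (tape ls s rs) -[1+ n ]      = nthSymbol ls n

  look-right : ∀ t z → look (move right t) z ≡ look t (sucℤ z)
  look-right (tape ls s [])       (pos zero)    = refl
  look-right (tape ls s [])       (pos (suc n)) = refl
  look-right (tape ls s [])       -[1+ zero ]   = refl
  look-right (tape ls s [])       -[1+ suc n ]  = refl
  look-right (tape ls s (r ∷ rs)) (pos zero)    = refl
  look-right (tape ls s (r ∷ rs)) (pos (suc n)) = refl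
  look-right (tape ls s (r ∷ rs)) -[1+ zero ]   = refl
  look-right (tape ls s (r ∷ rs)) -[1+ suc n ]  = refl

  look-left : ∀ t z → look (move left t) z ≡ look t (predℤ z)
  look-left (tape [] s rs)       (pos zero)          = refl
  look-left (tape [] s rs)       (pos (suc zero))    = refl
  look-left (tape [] s rs)       (pos (suc (suc n))) = refl
  look-left (tape [] s rs)       -[1+ n ]            = refl
  look-left (tape (l ∷ ls) s rs) (pos zero)          = refl
  look-left (tape (l ∷ ls) s rs) (pos (suc zero))    = refl
  look-left (tape (l ∷ ls) s rs) (pos (suc (suc n))) = refl
  look-left (tape (l ∷ ls) s rs) -[1+ n ]            = refl

  look-write : ∀ s t z → z ≢ pos 0 → look (write s t) z ≡ look t z
  look-write s t (pos zero)    z≢0 = ⊥-elim (z≢0 refl)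
  look-write s t (pos (suc n)) z≢0 = refl
  look-write s t -[1+ n ]      z≢0 = refl

  look-blank : ∀ z → look emptyTape z ≡ blank {A}
  look-blank (pos zero)    = refl
  look-blank (pos (suc n)) = refl
  look-blank -[1+ n ]      = refl

  act′ : Symbol A × Move → Tape A → Tape A
  act′ (s , d) = move d ∘ write s

suc-⊖ : ∀ p c → sucℤ (p ℤ.⊖ c) ≡ suc p ℤ.⊖ c
suc-⊖ p c = ℤ.distribʳ-⊖-+-pos 1 p c

-- Cells are numbered so that the head always has number `c`. Positions in variables are then
-- natural numbers, and a head move is a renumbering of all cells.
cell : ∀ {A} → ℕ → Tape A → ℕ → Symbol A
cell c t p = look t (p ℤ.⊖ c)

-- The cell that is at 1 + p before a move is at shift d + p after it.
shift : Move → ℕ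
shift left  = 2
shift stay  = 1
shift right = 0

cell-act : ∀ {A} c (s : Symbol A) d t p → cell c (act′ (s , d) t) (shift d + p) ≡ cell c (write s t) (suc p)
cell-act c s left t p = trans (look-left (write s t) (suc (suc p) ℤ.⊖ c)) (cong (look (write s t))
  (trans (cong predℤ (sym (suc-⊖ (suc p) c))) (predℤ-sucℤ (suc p ℤ.⊖ c))))
cell-act c s stay t p = refl
cell-act c s right t p = trans (look-right (write s t) (p ℤ.⊖ c)) (cong (look (write s t)) (suc-⊖ p c))

cell-write≢ : ∀ {A} c (s : Symbol A) t p → p ≢ c → cell c (write s t) p ≡ cell c t p
cell-write≢ c s t p p≢c = look-write s t _ λ eq → p≢c (zero-⊖ p c eq)
  where
  zero-⊖ : ∀ p c → p ℤ.⊖ c ≡ pos 0 → p ≡ c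
  zero-⊖ p c eq = ℤ.+-injective (ℤ.i-j≡0⇒i≡j (pos p) (pos c) (trans (ℤ.m-n≡m⊖n p c) eq))

cell-centre : ∀ {A} c (t : Tape A) → cell c t c ≡ current t
cell-centre c t = cong (look t) (ℤ.n⊖n≡0 c)

-- The first letter gets number T+1, the place of the head. In T steps only the T cells on either
-- side can come under the head, and the padding covers these even when the word is empty.
initialCells : ℕ → List Bool → List (Maybe Bool)
initialCells T x = replicate (suc T) nothing ++ map just x ++ replicate (suc (suc T)) nothing

cellSymbol : ∀ {A} → Maybe Bool → Symbol A
cellSymbol nothing  = blank
cellSymbol (just b) = bit b

At-initialCells : ∀ {A} T x {p b} → At (initialCells T x) p b → cellSymbol {A} b ≡ cell (suc T) (inputTape x) p
At-initialCells {A} T x {p} h = go (suc T) p h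
  where
  blanks : ∀ n {i b} → At (replicate n nothing) i b → cellSymbol {A} b ≡ blank
  blanks (suc n) here      = refl
  blanks (suc n) (there h) = blanks n h
  bits : ∀ x n {i b} → At (map just x ++ replicate n nothing) i b → cellSymbol {A} b ≡ nthSymbol (map bit x) i
  bits []      n h         = blanks n h
  bits (b ∷ x) n here      = refl
  bits (b ∷ x) n (there h) = bits x n h
  nonneg : ∀ x i → nthSymbol (map bit x) i ≡ look (inputTape x) (pos i)
  nonneg []      zero    = refl
  nonneg []      (suc i) = refl
  nonneg (b ∷ x) zero    = refl
  nonneg (b ∷ x) (suc i) = refl
  neg : ∀ (x : List Bool) i → look {A} (inputTape x) -[1+ i ] ≡ blank
  neg []      i = refl
  neg (b ∷ x) i = refl
  go : ∀ m p {b} → At (replicate m nothing ++ map just x ++ replicate (suc (suc T)) nothing) p b → cellSymbol {A} b ≡ look (inputTape x) (p ℤ.⊖ m)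
  go zero    p       h         = trans (bits x (suc (suc T)) h) (nonneg x p)
  go (suc m) zero    here      = sym (neg x m)
  go (suc m) (suc p) (there h) = trans (go m p h) (cong (look (inputTape x)) (sym (ℤ.[1+m]⊖[1+n]≡m⊖n p m)))

Variable : Set
Variable = ℕ × (ℕ × ℕ)

Clause : Set
Clause = List (Bool × Variable)

value : (Variable → Bool) → Bool × Variable → Bool
value a (s , v) = if s then a v else not (a v)

Solves : (Variable → Bool) → Clause → Set
Solves a c = ∃[ l ] (l ∈ c × value a l ≡ true)

-- A literal relative to a time t and a cell p: sign, whether the time is t + 1,
-- whether the position counts from p, position, kind.
Pattern : Set
Pattern = Bool × (Bool × (Bool × (ℕ × ℕ)))

place : ℕ × ℕ → Pattern → Bool × Variable
place (t , p) (s , (later , (relative , (i , c)))) =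
  s , ((if later then suc t else t) , (i + (if relative then p else 0) , c))

instances : List (ℕ × ℕ) × List (List Pattern) → List Clause
instances (dom , table) = concatMap (λ tp → map (λ c → map (place tp) c) table) dom

module _ {dom : List (ℕ × ℕ)} {table : List (List Pattern)} where

  instances-∈ : ∀ {tp c} → tp ∈ dom → c ∈ table → map (place tp) c ∈ instances (dom , table)
  instances-∈ {tp} tp∈ c∈ = ∈-concatMap⁺′ (λ tp → map (λ c → map (place tp) c) table) tp∈ (∈-map⁺ (map (place tp)) c∈)

  ∈-instances : ∀ {d} → d ∈ instances (dom , table) → ∃[ tp ] ∃[ c ] (tp ∈ dom × c ∈ table × d ≡ map (place tp) c)
  ∈-instances d∈ with ∈-concatMap⁻′ (λ tp → map (λ c → map (place tp) c) table) dom d∈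
  ... | tp , tp∈ , d∈′ with ∈-map⁻ (map (place tp)) d∈′
  ...   | c , c∈ , refl = tp , c , tp∈ , c∈ , refl

solve-∈ : ∀ {a tp c} l → l ∈ c → value a (place tp l) ≡ true → Solves a (map (place tp) c)
solve-∈ {tp = tp} l l∈ v = place tp l , ∈-map⁺ (place tp) l∈ , v

module _ {A : Set} (fin : Finite A) where

  codeOf : A → ℕ
  codeOf a = toℕ (Inverse.to (proj₂ fin) a)

  codeOf-injective : ∀ {a b} → codeOf a ≡ codeOf b → a ≡ b
  codeOf-injective {a} {b} eq = trans (sym (Inverse.strictlyInverseʳ (proj₂ fin) a))
    (trans (cong (Inverse.from (proj₂ fin)) (toℕ-injective eq)) (Inverse.strictlyInverseʳ (proj₂ fin) b))

  enumerate : List A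
  enumerate = map (Inverse.from (proj₂ fin)) (allFin (proj₁ fin))

  ∈-enumerate : ∀ a → a ∈ enumerate
  ∈-enumerate a = subst (_∈ enumerate) (Inverse.strictlyInverseʳ (proj₂ fin) a) (∈-map⁺ _ (∈-allFin (Inverse.to (proj₂ fin) a)))

vectors : ∀ {A : Set} → List A → ∀ k → List (Vec A k)
vectors as zero    = [] ∷ []
vectors as (suc k) = concatMap (λ a → map (a ∷_) (vectors as k)) as

∈-vectors : ∀ {A : Set} {as : List A} → (∀ a → a ∈ as) → ∀ {k} (v : Vec A k) → v ∈ vectors as k
∈-vectors h []      = here refl
∈-vectors {as = as} h {suc k} (a ∷ v) = ∈-concatMap⁺′ (λ a → map (a ∷_) (vectors as k)) (h a) (∈-map⁺ (a ∷_) (∈-vectors h v))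

module Tableau (M : Machine) where
  open Machine M

  k : ℕ
  k = suc extraTapes

  Letter : Set
  Letter = Symbol Mark

  finLetter : Finite Letter
  finLetter = 3 + proj₁ finMark , mk↔ₛ′ to from to∘from from∘to
    where
    open Inverse (proj₂ finMark) renaming (to to toMark; from to fromMark)
    to : Letter → Fin (3 + proj₁ finMark)
    to blank       = zero
    to (bit false) = suc zero
    to (bit true)  = suc (suc zero)
    to (mark m)    = suc (suc (suc (toMark m)))
    from : Fin (3 + proj₁ finMark) → Letter
    from zero                = blank
    from (suc zero)          = bit false
    from (suc (suc zero))    = bit true
    from (suc (suc (suc i))) = mark (fromMark i)
    to∘from : ∀ i → to (from i) ≡ i
    to∘from zero                = refl
    to∘from (suc zero)          = refl
    to∘from (suc (suc zero))    = refl
    to∘from (suc (suc (suc i))) = cong (λ j → suc (suc (suc j))) (strictlyInverseˡ i)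
    from∘to : ∀ s → from (to s) ≡ s
    from∘to blank       = refl
    from∘to (bit false) = refl
    from∘to (bit true)  = refl
    from∘to (mark m)    = cong mark (strictlyInverseʳ m)

  -- A rule includes the state and the symbols to which it applies. The variables for the rule used
  -- at a time therefore also record the state, and consecutive states are compared through the
  -- rules.
  Rule : Set
  Rule = (State × Vec Letter k) × (State × Vec (Letter × Move) k)

  source target : Rule → State
  source ((q , _) , _) = q
  target (_ , (q , _)) = q

  reads : Rule → Vec Letter k
  reads ((_ , ss) , _) = ss

  actions : Rule → Vec (Letter × Move) k
  actions (_ , (_ , as)) = as

  resting : Vec Letter k → Vec (Letter × Move) k
  resting = Vec.map (_, stay)

  -- The machine is made to rest in an accepting state for as long as needed.
  rulesAt : State × Vec Letter k → List (State × Vec (Letter × Move) k)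
  rulesAt (q , ss) = δ q ss ++ (if accepting q then (q , resting ss) ∷ [] else [])

  situations : List (State × Vec Letter k)
  situations = cartesianProduct (enumerate finState) (vectors (enumerate finLetter) k)

  rules : List Rule
  rules = concatMap (λ i → map (i ,_) (rulesAt i)) situations

  rule∈ : ∀ {i o} → o ∈ rulesAt i → (i , o) ∈ rules
  rule∈ {i} o∈ = ∈-concatMap⁺′ (λ i → map (i ,_) (rulesAt i))
    (∈-cartesianProduct⁺ (∈-enumerate finState (proj₁ i)) (∈-vectors (∈-enumerate finLetter) (proj₂ i))) (∈-map⁺ (i ,_) o∈)

  ∈rule : ∀ {i o} → (i , o) ∈ rules → o ∈ rulesAt i
  ∈rule {i} {o} h with ∈-concatMap⁻′ (λ i → map (i ,_) (rulesAt i)) situations h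
  ... | j , _ , h′ with ∈-map⁻ (j ,_) h′
  ...   | _ , o∈ , refl = o∈

  ruleCount : ℕ
  ruleCount = length rules

  -- Kinds below `ruleCount` number the rules. The shift keeps symbols apart from them, and
  -- `combine` packs tape and symbol injectively.
  symbolKind : Fin k → Letter → ℕ
  symbolKind j s = ruleCount + toℕ (combine j (Inverse.to (proj₂ finLetter) s))

  symbolKind-injective : ∀ {i j s t} → symbolKind i s ≡ symbolKind j t → i ≡ j × s ≡ t
  symbolKind-injective {i} {j} {s} {t} eq =
    let p , q = combine-injective i (Inverse.to (proj₂ finLetter) s) j (Inverse.to (proj₂ finLetter) t)
                  (toℕ-injective (+-cancelˡ-≡ ruleCount _ _ eq))
    in p , codeOf-injective finLetter (cong toℕ q)

  tapes : List (Fin k)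
  tapes = allFin k

  letters : List Letter
  letters = enumerate finLetter

  usesRule avoidsRule : Bool → ℕ → Pattern
  usesRule   later i = true , (later , (false , (0 , i)))
  avoidsRule later i = false , (later , (false , (0 , i)))

  hasSymbol lacksSymbol : Bool → ℕ → Fin k → Letter → Pattern
  hasSymbol   later i j s = true , (later , (true , (i , symbolKind j s)))
  lacksSymbol later i j s = false , (later , (true , (i , symbolKind j s)))

  Table : Set
  Table = List (List Pattern)

  perRule : (ℕ × Rule → Table) → Table
  perRule f = concatMap f (indexed rules)

  perTape : (Fin k → Table) → Table
  perTape f = concatMap f tapes

  sameState : State → State → Bool
  sameState p q = eq (codeOf finState p) (codeOf finState q)

  sameLetter : Letter → Letter → Bool
  sameLetter s t = eq (codeOf finLetter s) (codeOf finLetter t)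

  successionClauses : ℕ × Rule → ℕ × Rule → Table
  successionClauses (i , r) (i′ , r′) =
    if sameState (target r) (source r′) then [] else (avoidsRule false i ∷ avoidsRule true i′ ∷ []) ∷ []

  beginningClauses endingClauses : ℕ × Rule → Table
  beginningClauses (i , r) = if sameState (source r) start then [] else (avoidsRule false i ∷ []) ∷ []
  endingClauses    (i , r) = if accepting (source r) then [] else (avoidsRule false i ∷ []) ∷ []

  writingClause : ℕ × Rule → Fin k → List Pattern
  writingClause (i , r) j =
    avoidsRule false i ∷ hasSymbol true (shift (proj₂ (lookup (actions r) j))) j (proj₁ (lookup (actions r) j)) ∷ []

  readingClauses : ℕ × Rule → Fin k → Letter → Table
  readingClauses (i , r) j s =
    if sameLetter s (lookup (reads r) j) then [] else (avoidsRule false i ∷ lacksSymbol false 1 j s ∷ []) ∷ []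

  movingClause : ℕ × Rule → Fin k → Letter → List Pattern
  movingClause (i , r) j s =
    avoidsRule false i ∷ lacksSymbol false 1 j s ∷ hasSymbol true (shift (proj₂ (lookup (actions r) j))) j s ∷ []

  blankClause : Fin extraTapes → List Pattern
  blankClause j = hasSymbol false 0 (suc j) blank ∷ []

  inputClause : ℕ × Maybe Bool → Clause
  inputClause (p , b) = (true , (0 , (p , symbolKind zero (cellSymbol b)))) ∷ []

  -- These tables depend on the machine alone. The input and the time enter only when `families`
  -- places the patterns, so for the reduction the tables are constants.
  someRule succession beginning ending reading moving writing blanks : Table
  someRule   = map (λ ir → usesRule false (proj₁ ir)) (indexed rules) ∷ []
  succession = perRule λ ir → perRule (successionClauses ir)
  beginning  = perRule beginningClauses
  ending     = perRule endingClauses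
  reading    = perRule λ ir → perTape λ j → concatMap (readingClauses ir j) letters
  moving     = perRule λ ir → perTape λ j → map (movingClause ir j) letters
  writing    = perRule λ ir → perTape λ j → writingClause ir j ∷ []
  blanks     = map blankClause (allFin extraTapes)

  module _ (T : ℕ) (x : List Bool) where

    width : ℕ
    width = length (initialCells T x)

    early throughout : List ℕ
    early      = indices T
    throughout = indices (suc T)

    -- Patterns address cell 1+p, so p = T stands for the cell under the head. It is left out
    -- because `writing` prescribes its new symbol, whereas all other cells keep theirs.
    offCentre : List ℕ
    offCentre = indices T ++ map (suc T +_) (indices T)

    centred : List ℕ → List (ℕ × ℕ)
    centred = map (_, T)

    families : List (List (ℕ × ℕ) × Table)
    families =
      (centred throughout , someRule ++ reading) ∷
      (centred early , succession ++ writing) ∷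
      ((0 , T) ∷ [] , beginning) ∷
      ((T , T) ∷ [] , ending) ∷
      (concatMap (λ t → map (t ,_) offCentre) early , moving) ∷
      (map (0 ,_) (indices width) , blanks) ∷ []

    inputClauses : List Clause
    inputClauses = map inputClause (indexed (initialCells T x))

    clauses : List Clause
    clauses = concatMap instances families ++ inputClauses

-- Solutions of the clauses and accepting runs.

if-[] : ∀ {A : Set} {b} {c d : A} → d ∈ (if b then [] else c ∷ []) → b ≡ false × d ≡ c
if-[] {b = false} (here refl) = refl , refl

[]-if : ∀ {A : Set} {b} {c : A} → b ≡ false → c ∈ (if b then [] else c ∷ [])
[]-if refl = here refl

true-or-false : ∀ b → b ≡ true ⊎ b ≡ false
true-or-false true  = inj₁ refl
true-or-false false = inj₂ refl

any⇒ : ∀ {A : Set} {p : A → Bool} xs → any p xs ≡ true → ∃[ x ] (x ∈ xs × p x ≡ true)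
any⇒ {p = p} (x ∷ xs) h with p x in e
... | true  = x , here refl , e
... | false = let y , y∈ , py = any⇒ xs h in y , there y∈ , py

⇒any : ∀ {A : Set} {p : A → Bool} {xs x} → x ∈ xs → p x ≡ true → any p xs ≡ true
⇒any {p = p} {y ∷ xs} (here refl) h = ∨-introˡ h
⇒any {p = p} {y ∷ xs} (there x∈)  h = ∨-introʳ {p y} (⇒any x∈ h)

∈-indices : ∀ {i n} → i < n → i ∈ indices n
∈-indices {n = n} h = subst (_ ∈_) (sym (indices-upTo n)) (∈-upTo⁺ h)

indices-< : ∀ {i n} → i ∈ indices n → i < n
indices-< {n = n} h = ∈-upTo⁻ (subst (_ ∈_) (indices-upTo n) h)

At-functional : ∀ {A : Set} {xs : List A} {i x y} → At xs i x → At xs i y → x ≡ y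
At-functional here      here      = refl
At-functional (there p) (there q) = At-functional p q

∈⇒At : ∀ {A : Set} {xs : List A} {x} → x ∈ xs → ∃[ i ] At xs i x
∈⇒At (here refl) = 0 , here
∈⇒At (there h)   = let i , a = ∈⇒At h in suc i , there a

At⇒∈ : ∀ {A : Set} {xs : List A} {i x} → At xs i x → x ∈ xs
At⇒∈ here      = here refl
At⇒∈ (there h) = there (At⇒∈ h)

∈-offCentre : ∀ {T p} → p ≤ T + T → p ≢ T → p ∈ indices T ++ map (suc T +_) (indices T)
∈-offCentre {T} {p} p≤ p≢ with <-cmp p T
... | tri< p< _ _ = ∈-++⁺ˡ (∈-indices p<)
... | tri≈ _ e _  = ⊥-elim (p≢ e)
... | tri> _ _ p> = ∈-++⁺ʳ (indices T) (subst (_∈ map (suc T +_) (indices T)) (m+[n∸m]≡n p>)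
      (∈-map⁺ (suc T +_) (∈-indices (+-cancelˡ-< T (p ∸ suc T) T (≤-trans (≤-reflexive (m+[n∸m]≡n p>)) p≤)))))

-- The cell that a move brings to number 1+p had a number one smaller, equal or one larger before.
-- So a window that is narrower by one cell at each end draws only on the previous window.
sourceCell : ∀ {T} t d p → suc t ≤ p → p + suc t ≤ T + T → ∃[ q ] (shift d + q ≡ suc p × t ≤ q × q + t ≤ T + T)
sourceCell t left  (suc p) (s≤s t≤) p≤ = p , refl , t≤ , ≤-trans (+-mono-≤ (n≤1+n p) (n≤1+n t)) p≤
sourceCell t stay  p       t≤       p≤ = p , refl , ≤-trans (n≤1+n t) t≤ , ≤-trans (+-monoʳ-≤ p (n≤1+n t)) p≤
sourceCell t right p       t≤       p≤ = suc p , refl , ≤-trans (≤-trans (n≤1+n t) t≤) (n≤1+n p) , ≤-trans (≤-reflexive (sym (+-suc p t))) p≤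

solves-map : ∀ {A : Set} {a} (f : A → Bool × Variable) {xs} → Solves a (map f xs) → ∃[ y ] (y ∈ xs × value a (f y) ≡ true)
solves-map f (_ , l∈ , v) with ∈-map⁻ f l∈
... | y , y∈ , refl = y , y∈ , v

equal-or-not : ∀ (m n : ℕ) → m ≡ n ⊎ m ≢ n
equal-or-not m n with m ≟ n
... | yes e = inj₁ e
... | no ne = inj₂ ne

module Correct (M : Machine) (T : ℕ) (x : List Bool) where
  open Machine M
  open Tableau M

  perRule-∈ : ∀ (f : ℕ × Rule → Table) {i r c} → (i , r) ∈ indexed rules → c ∈ f (i , r) → c ∈ perRule f
  perRule-∈ f = ∈-concatMap⁺′ f

  perTape-∈ : ∀ (f : Fin k → Table) {c} j → c ∈ f j → c ∈ perTape f
  perTape-∈ f j = ∈-concatMap⁺′ f (∈-allFin j)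

  lookup-act : ∀ {m} (as : Vec (Letter × Move) m) (ts : Vec (Tape Mark) m) j → lookup (Vec.zipWith act as ts) j ≡ act (lookup as j) (lookup ts j)
  lookup-act as ts j = Vec.lookup-zipWith act j as ts

  vec-ext : ∀ {A : Set} {m} {u v : Vec A m} → (∀ j → lookup u j ≡ lookup v j) → u ≡ v
  vec-ext {u = u} {v} h = trans (sym (Vec.tabulate∘lookup u)) (trans (Vec.tabulate-cong h) (Vec.tabulate∘lookup v))

  module Sound (a : Variable → Bool) (solves : ∀ {c} → c ∈ clauses T x → Solves a c) where

    family : ∀ dom table → (dom , table) ∈ families T x → ∀ tp c → tp ∈ dom → c ∈ table → Solves a (map (place tp) c)
    family dom table F∈ tp c tp∈ c∈ = solves (∈-++⁺ˡ (∈-concatMap⁺′ instances F∈ (instances-∈ tp∈ c∈)))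

    at-throughout : ∀ {t} c → t ≤ T → c ∈ someRule ++ reading → Solves a (map (place (t , T)) c)
    at-throughout {t} c t≤ = family _ _ (here refl) (t , T) c (∈-map⁺ (_, T) (∈-indices (s≤s t≤)))

    at-early : ∀ {t} c → t < T → c ∈ succession ++ writing → Solves a (map (place (t , T)) c)
    at-early {t} c t< = family _ _ (there (here refl)) (t , T) c (∈-map⁺ (_, T) (∈-indices t<))

    at-beginning : ∀ c → c ∈ beginning → Solves a (map (place (0 , T)) c)
    at-beginning c = family _ _ (there (there (here refl))) (0 , T) c (here refl)

    at-ending : ∀ c → c ∈ ending → Solves a (map (place (T , T)) c)
    at-ending c = family _ _ (there (there (there (here refl)))) (T , T) c (here refl)

    at-moving : ∀ {t p} c → t < T → p ∈ offCentre T x → c ∈ moving → Solves a (map (place (t , p)) c)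
    at-moving {t} {p} c t< p∈ = family _ _ (there (there (there (there (here refl))))) (t , p) c
      (∈-concatMap⁺′ (λ t → map (t ,_) (offCentre T x)) (∈-indices t<) (∈-map⁺ (t ,_) p∈))

    at-blanks : ∀ {p} c → p < width T x → c ∈ blanks → Solves a (map (place (0 , p)) c)
    at-blanks {p} c p< = family _ _ (there (there (there (there (there (here refl)))))) (0 , p) c (∈-map⁺ (0 ,_) (∈-indices p<))

    not-both : ∀ {l l′} → Solves a (l ∷ l′ ∷ []) → value a l ≡ false → value a l′ ≡ true
    not-both (_ , here refl , v)         h = case trans (sym v) h of λ ()
    not-both (_ , there (here refl) , v) h = v

    single : ∀ {l} → Solves a (l ∷ []) → value a l ≡ true
    single (_ , here refl , v) = v

    third : ∀ {l l′ l″} → Solves a (l ∷ l′ ∷ l″ ∷ []) → value a l ≡ false → value a l′ ≡ false → value a l″ ≡ true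
    third (_ , here refl , v)                 h h′ = case trans (sym v) h of λ ()
    third (_ , there (here refl) , v)         h h′ = case trans (sym v) h′ of λ ()
    third (_ , there (there (here refl)) , v) h h′ = v

    Chosen : ℕ → ℕ → Rule → Set
    Chosen t i r = (i , r) ∈ indexed rules × a (t , (0 , i)) ≡ true

    -- A solution may mark several rules at one time. The remaining clauses bind every marked rule,
    -- so any choice of one per time leads to a run.
    choose : ∀ t → t ≤ T → ∃[ i ] ∃[ r ] Chosen t i r
    choose t t≤ =
      let f = λ (ir : ℕ × Rule) → usesRule false (proj₁ ir)
          l , l∈ , v = solves-map (place (t , T)) (at-throughout (map f (indexed rules)) t≤ (∈-++⁺ˡ {xs = someRule} {ys = reading} (here refl)))
          (i , r) , ir∈ , eq = ∈-map⁻ f l∈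
      in i , r , ir∈ , subst (λ l → value a (place (t , T) l) ≡ true) eq v

    not-false : ∀ {b} → b ≡ true → not b ≡ false
    not-false refl = refl

    equal-states : ∀ {p q} → sameState p q ≡ true → p ≡ q
    equal-states h = codeOf-injective finState (eq⇒≡ h)

    contradicts : ∀ {A : Set} {b} → b ≡ true → not b ≡ true → A
    contradicts refl ()

    follows : ∀ {t i r i′ r′} → t < T → Chosen t i r → Chosen (suc t) i′ r′ → target r ≡ source r′
    follows {t} {i} {r} {i′} {r′} t< (ir∈ , h) (ir′∈ , h′) = go (true-or-false (sameState (target r) (source r′)))
      where
      go : sameState (target r) (source r′) ≡ true ⊎ sameState (target r) (source r′) ≡ false → target r ≡ source r′
      go (inj₁ same) = equal-states same
      go (inj₂ diff) = contradicts h′ (not-both (at-early (avoidsRule false i ∷ avoidsRule true i′ ∷ []) t<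
        (∈-++⁺ˡ {xs = succession} {ys = writing} (perRule-∈ (λ ir → perRule (successionClauses ir)) ir∈
          (perRule-∈ (successionClauses (i , r)) ir′∈ ([]-if diff))))) (not-false h))

    starts : ∀ {i r} → Chosen 0 i r → source r ≡ start
    starts {i} {r} (ir∈ , h) = go (true-or-false (sameState (source r) start))
      where
      go : sameState (source r) start ≡ true ⊎ sameState (source r) start ≡ false → source r ≡ start
      go (inj₁ same) = equal-states same
      go (inj₂ diff) = contradicts h (single (at-beginning (avoidsRule false i ∷ []) (perRule-∈ beginningClauses ir∈ ([]-if diff))))

    finishes : ∀ {i r} → Chosen T i r → accepting (source r) ≡ true
    finishes {i} {r} (ir∈ , h) = go (true-or-false (accepting (source r)))
      where
      go : accepting (source r) ≡ true ⊎ accepting (source r) ≡ false → accepting (source r) ≡ true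
      go (inj₁ acc) = acc
      go (inj₂ rej) = contradicts h (single (at-ending (avoidsRule false i ∷ []) (perRule-∈ endingClauses ir∈ ([]-if rej))))

    -- At time t the solution is known to show the true tapes only for p from t to 2T-t, since
    -- unconstrained symbols may be shifted in from beyond. At time T the window has shrunk to p =
    -- T, the cell under the head.
    Agree : ℕ → Vec (Tape Mark) k → Set
    Agree t ts = ∀ p j → t ≤ p → p + t ≤ T + T → a (t , (suc p , symbolKind j (cell (suc T) (lookup ts j) (suc p)))) ≡ true

    reads-current : ∀ {t i r ts} → t ≤ T → Chosen t i r → Agree t ts → reads r ≡ Vec.map current ts
    reads-current {t} {i} {r} {ts} t≤ (ir∈ , h) agree = vec-ext λ j → trans (same j) (sym (Vec.lookup-map j current ts))
      where
      same : ∀ j → lookup (reads r) j ≡ current (lookup ts j)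
      same j = go (true-or-false (sameLetter (current (lookup ts j)) (lookup (reads r) j)))
        where
        s = current (lookup ts j)
        seen : a (t , (suc T , symbolKind j (current (lookup ts j)))) ≡ true
        seen = subst (λ s → a (t , (suc T , symbolKind j s)) ≡ true) (cell-centre (suc T) (lookup ts j)) (agree T j t≤ (+-monoʳ-≤ T t≤))
        go : sameLetter s (lookup (reads r) j) ≡ true ⊎ sameLetter s (lookup (reads r) j) ≡ false → lookup (reads r) j ≡ s
        go (inj₁ e) = sym (codeOf-injective finLetter (eq⇒≡ e))
        go (inj₂ d) = contradicts seen (not-both (at-throughout (avoidsRule false i ∷ lacksSymbol false 1 j s ∷ []) t≤
          (∈-++⁺ʳ someRule (perRule-∈ (λ ir → perTape λ j → concatMap (readingClauses ir j) letters) ir∈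
            (perTape-∈ (λ j → concatMap (readingClauses (i , r) j) letters) j
              (∈-concatMap⁺′ (readingClauses (i , r) j) (∈-enumerate finLetter s) ([]-if d)))))) (not-false h))

    moving-∈ : ∀ {i r} j s → (i , r) ∈ indexed rules → movingClause (i , r) j s ∈ moving
    moving-∈ {i} {r} j s ir∈ = perRule-∈ (λ ir → perTape λ j → map (movingClause ir j) letters) ir∈
      (perTape-∈ (λ j → map (movingClause (i , r) j) letters) j (∈-map⁺ (movingClause (i , r) j) (∈-enumerate finLetter s)))

    writing-∈ : ∀ {i r} j → (i , r) ∈ indexed rules → writingClause (i , r) j ∈ writing
    writing-∈ {i} {r} j ir∈ = perRule-∈ (λ ir → perTape λ j → writingClause ir j ∷ []) ir∈
      (perTape-∈ (λ j → writingClause (i , r) j ∷ []) j (here refl))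

    Shows : ℕ → ℕ → Fin k → Letter → Set
    Shows t p j s = a (t , (p , symbolKind j s)) ≡ true

    centre-written : ∀ {t i r} j → t < T → Chosen t i r →
                     Shows (suc t) (shift (proj₂ (lookup (actions r) j)) + T) j (proj₁ (lookup (actions r) j))
    centre-written {t} {i} {r} j t< (ir∈ , h) = not-both (at-early (writingClause (i , r) j) t< (∈-++⁺ʳ succession (writing-∈ j ir∈))) (not-false h)

    cell-moved : ∀ {t i r p} j s → t < T → p ≤ T + T → p ≢ T → Chosen t i r → Shows t (suc p) j s →
                 Shows (suc t) (shift (proj₂ (lookup (actions r) j)) + p) j s
    cell-moved {t} {i} {r} j s t< p≤ p≢ (ir∈ , h) seen =
      third (at-moving (movingClause (i , r) j s) t< (∈-offCentre p≤ p≢) (moving-∈ j s ir∈)) (not-false h) (not-false seen)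

    step-agree : ∀ {t i r ts} → t < T → Chosen t i r → Agree t ts → Agree (suc t) (Vec.zipWith act (actions r) ts)
    step-agree {t} {i} {r} {ts} t< chosen agree p′ j t≤p′ p′≤ =
      subst (λ tp → Shows (suc t) (suc p′) j (cell (suc T) tp (suc p′))) (sym (lookup-act (actions r) ts j))
        (moved (sourceCell {T} t d p′ t≤p′ p′≤))
      where
      tp = lookup ts j
      w = proj₁ (lookup (actions r) j)
      d = proj₂ (lookup (actions r) j)
      written : ∀ p → t ≤ p → p + t ≤ T + T → p ≡ T ⊎ p ≢ T → Shows (suc t) (shift d + p) j (cell (suc T) (write w tp) (suc p))
      written p t≤p p≤ (inj₁ refl) = subst (Shows (suc t) (shift d + T) j) (sym (cell-centre (suc T) (write w tp))) (centre-written j t< chosen)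
      written p t≤p p≤ (inj₂ p≢) = subst (Shows (suc t) (shift d + p) j) (sym (cell-write≢ (suc T) w tp (suc p) (p≢ ∘ suc-injective)))
        (cell-moved j (cell (suc T) tp (suc p)) t< (≤-trans (m≤m+n p t) p≤) p≢ chosen (agree p j t≤p p≤))
      moved : ∃[ p ] (shift d + p ≡ suc p′ × t ≤ p × p + t ≤ T + T) → Shows (suc t) (suc p′) j (cell (suc T) (act (w , d) tp) (suc p′))
      moved (p , eq , t≤p , p≤) = subst (λ q → Shows (suc t) q j (cell (suc T) (act (w , d) tp) q)) eq
        (subst (Shows (suc t) (shift d + p) j) (sym (cell-act (suc T) w d tp p)) (written p t≤p p≤ (equal-or-not p T)))

    width≤ : ∀ {p} → p ≤ T + T → suc p < length (initialCells T x)
    width≤ {p} p≤ = ≤-trans (s≤s (s≤s p≤)) (≤-trans (≤-trans (m≤m+n _ (suc (length x))) (≤-reflexive (lemma T (length x)))) (≤-reflexive (sym len)))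
      where
      lemma : ∀ t n → 2 + (t + t) + (1 + n) ≡ 1 + t + (n + (2 + t))
      lemma = solve-∀
      len : length (initialCells T x) ≡ suc T + (length x + suc (suc T))
      len = trans (length-++ (replicate (suc T) nothing)) (cong₂ _+_ (length-replicate (suc T))
              (trans (length-++ (map just x)) (cong₂ _+_ (length-map just x) (length-replicate (suc (suc T))))))

    agree₀ : Agree 0 (proj₂ (initial x))
    agree₀ p zero _ p≤ =
      let b , at = At-∃ (initialCells T x) (width≤ (subst (_≤ T + T) (+-identityʳ p) p≤))
      in subst (λ s → a (0 , (suc p , symbolKind zero s)) ≡ true) (At-initialCells T x at)
           (single (solves (∈-++⁺ʳ (concatMap instances (families T x)) (∈-map⁺ inputClause (At⇒indexed at)))))
    agree₀ p (suc j) _ p≤ = subst (λ s → a (0 , (suc p , symbolKind (suc j) s)) ≡ true)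
      (sym (trans (cong (λ t → cell (suc T) t (suc p)) (Vec.lookup-replicate j emptyTape)) (look-blank (suc p ℤ.⊖ suc T))))
      (single (at-blanks (blankClause j) (width≤ (subst (_≤ T + T) (+-identityʳ p) p≤)) (∈-map⁺ blankClause (∈-allFin j))))

    snoc : ∀ {c d e n} → c ⟶[ n ] d → e ∈ successors d → c ⟶[ suc n ] e
    snoc done       e∈ = step e∈ done
    snoc (step m s) e∈ = step m (snoc s e∈)

    -- The marked rules are carried out on a real configuration. A transition of the machine extends
    -- the run; a resting rule occurs only in an accepting state, and then the run may stop early.
    follow : ∀ n t {q ts i r} → n + t ≡ T → initial x ⟶[ t ] (q , ts) → Chosen t i r → source r ≡ q → Agree t ts →
             ∃[ s ] AcceptsIn s x
    follow zero    t refl run chosen refl agree = t , _ , run , finishes chosen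
    follow (suc n) t {q} {ts} {i} {r} eq run chosen refl agree = act-or-rest (∈-++⁻ (δ (source r) (reads r)) (∈rule (At⇒∈ (indexed⇒At rules (proj₁ chosen)))))
      where
      t< : t < T
      t< = ≤-trans (s≤s (m≤n+m t n)) (≤-reflexive eq)
      act-or-rest : _ ⊎ _ → ∃[ s ] AcceptsIn s x
      act-or-rest (inj₁ o∈) =
        let i′ , r′ , chosen′ = choose (suc t) t<
        in follow n (suc t) (trans (+-suc n t) eq)
             (snoc run (∈-map⁺ (λ (q′ , as) → q′ , Vec.zipWith act as ts) (subst (λ ss → _ ∈ δ (source r) ss) (reads-current (<⇒≤ t<) chosen agree) o∈)))
             chosen′ (sym (follows t< chosen chosen′)) (step-agree t< chosen agree)
      act-or-rest (inj₂ o∈) = t , _ , run , rests (accepting (source r)) refl o∈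
        where
        rests : ∀ b → accepting (source r) ≡ b → proj₂ r ∈ (if b then (source r , resting (reads r)) ∷ [] else []) → accepting (source r) ≡ true
        rests true e _ = e

    accepted : ∃[ s ] AcceptsIn s x
    accepted = let i , r , chosen = choose 0 z≤n in follow T 0 (+-identityʳ T) done chosen (starts chosen) agree₀

concatMap-elim : ∀ {A B : Set} (P : B → Set) (f : A → List B) {xs} → (∀ {x y} → x ∈ xs → y ∈ f x → P y) →
                 ∀ {y} → y ∈ concatMap f xs → P y
concatMap-elim P f {xs} h y∈ with ∈-concatMap⁻′ f xs y∈
... | x , x∈ , y∈′ = h x∈ y∈′

if-elim : ∀ {A : Set} (P : A → Set) b {c} → (b ≡ false → P c) → ∀ {d} → d ∈ (if b then [] else c ∷ []) → P d
if-elim P b h d∈ with if-[] {b = b} d∈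
... | e , refl = h e

one-elim : ∀ {A : Set} (P : A → Set) {c} → P c → ∀ {d} → d ∈ c ∷ [] → P d
one-elim P h (here refl) = h

instances-elim : ∀ (P : Clause → Set) {dom table} → (∀ {tp c} → tp ∈ dom → c ∈ table → P (map (place tp) c)) →
                 ∀ {c} → c ∈ instances (dom , table) → P c
instances-elim P {dom} {table} h c∈ with ∈-instances {dom} {table} c∈
... | tp , c , tp∈ , c∈′ , refl = h tp∈ c∈′

module Complete (M : Machine) (T : ℕ) (x : List Bool) where
  open Machine M
  open Tableau M
  open Correct M T x using (lookup-act)

  -- The run is continued forever by resting in its accepting configuration. All components are
  -- total functions of time, so the clauses need no distinction between the length of the run and
  -- `T`.
  record History (c : Config) (n : ℕ) : Set where
    field
      config      : ℕ → Config
      rule        : ℕ → Rule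
      number      : ℕ → ℕ
      first       : config 0 ≡ c
      numbered    : ∀ t → At rules (number t) (rule t)
      same-source : ∀ t → source (rule t) ≡ proj₁ (config t)
      same-reads  : ∀ t → reads (rule t) ≡ Vec.map current (proj₂ (config t))
      next        : ∀ t → config (suc t) ≡ (target (rule t) , Vec.zipWith act (actions (rule t)) (proj₂ (config t)))
      accepts     : ∀ t → n ≤ t → Accepting (config t)

  open History

  rest-same : ∀ {m} (ts : Vec (Tape Mark) m) → Vec.zipWith act (Vec.map (_, stay) (Vec.map current ts)) ts ≡ ts
  rest-same []       = refl
  rest-same (t ∷ ts) = cong (t ∷_) (rest-same ts)

  prepend : ∀ {X : Set} → X → (ℕ → X) → ℕ → X
  prepend y f zero    = y
  prepend y f (suc t) = f t

  history : ∀ {c d n} → c ⟶[ n ] d → Accepting d → History c n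
  history {c} {q , ts} done acc = record
    { config = λ _ → q , ts ; rule = λ _ → r ; number = λ _ → proj₁ (∈⇒At r∈) ; first = refl
    ; numbered = λ _ → proj₂ (∈⇒At r∈) ; same-source = λ _ → refl ; same-reads = λ _ → refl
    ; next = λ _ → cong (q ,_) (sym (rest-same ts)) ; accepts = λ _ _ → acc }
    where
    r : Rule
    r = (q , Vec.map current ts) , (q , resting (Vec.map current ts))
    r∈ : r ∈ rules
    r∈ = rule∈ (∈-++⁺ʳ (δ q (Vec.map current ts)) (subst (λ b → proj₂ r ∈ (if b then proj₂ r ∷ [] else [])) (sym acc) (here refl)))
  history {q , ts} (step c′∈ run) acc with ∈-map⁻ (λ (q′ , as) → q′ , Vec.zipWith act as ts) c′∈
  ... | o , o∈ , refl = record
    { config = prepend (q , ts) (config h) ; rule = prepend r (rule h) ; number = prepend (proj₁ (∈⇒At r∈)) (number h) ; first = refl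
    ; numbered = λ { zero → proj₂ (∈⇒At r∈) ; (suc t) → numbered h t }
    ; same-source = λ { zero → refl ; (suc t) → same-source h t } ; same-reads = λ { zero → refl ; (suc t) → same-reads h t }
    ; next = λ { zero → first h ; (suc t) → next h t } ; accepts = λ { zero () ; (suc t) (s≤s n≤) → accepts h t n≤ } }
    where
    h = history run acc
    r : Rule
    r = (q , Vec.map current ts) , o
    r∈ : r ∈ rules
    r∈ = rule∈ (∈-++⁺ˡ o∈)

  module _ {n} (n≤T : n ≤ T) (h : History (initial x) n) where

    tapesAt : ℕ → Vec (Tape Mark) k
    tapesAt t = proj₂ (config h t)

    symbolAt : ℕ → ℕ → Fin k → Letter
    symbolAt t p j = cell (suc T) (lookup (tapesAt t) j) p

    -- Symbols are taken from the true, infinite tapes at every position, so no clause near the ends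
    -- of the window is exceptional. A rule variable has the same value at every position; the
    -- clauses use position 0.
    a : Variable → Bool
    a (t , (p , c)) = eq c (number h t) ∨ any (λ j → eq c (symbolKind j (symbolAt t p j))) tapes

    rule⁺ : ∀ t p → a (t , (p , number h t)) ≡ true
    rule⁺ t p = ∨-introˡ (eq-refl (number h t))

    rule⁻ : ∀ {t p i r} → (i , r) ∈ indexed rules → a (t , (p , i)) ≡ true → rule h t ≡ r
    rule⁻ {t} {p} {i} {r} ir∈ eqn = go (∨-true {eq i (number h t)} eqn)
      where
      at : At rules i r
      at = indexed⇒At rules ir∈
      go : eq i (number h t) ≡ true ⊎ any (λ j → eq i (symbolKind j (symbolAt t p j))) tapes ≡ true → rule h t ≡ r
      go (inj₁ e) = At-functional (numbered h t) (subst (λ i → At rules i r) (eq⇒≡ {a = i} e) at)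
      go (inj₂ e) = let j , _ , e′ = any⇒ tapes e in
        ⊥-elim (<⇒≱ (At-< at) (subst (ruleCount ≤_) (sym (eq⇒≡ {a = i} e′)) (m≤m+n ruleCount _)))

    symbol⁺ : ∀ t p j → a (t , (p , symbolKind j (symbolAt t p j))) ≡ true
    symbol⁺ t p j = ∨-introʳ {eq (symbolKind j (symbolAt t p j)) (number h t)}
      (⇒any {p = λ j′ → eq (symbolKind j (symbolAt t p j)) (symbolKind j′ (symbolAt t p j′))} (∈-allFin j) (eq-refl (symbolKind j (symbolAt t p j))))

    symbol⁻ : ∀ {t p j s} → a (t , (p , symbolKind j s)) ≡ true → s ≡ symbolAt t p j
    symbol⁻ {t} {p} {j} {s} eqn = go (∨-true {eq (symbolKind j s) (number h t)} eqn)
      where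
      go : eq (symbolKind j s) (number h t) ≡ true ⊎ any (λ j′ → eq (symbolKind j s) (symbolKind j′ (symbolAt t p j′))) tapes ≡ true →
           s ≡ symbolAt t p j
      go (inj₁ e) = ⊥-elim (<⇒≱ (At-< (numbered h t)) (subst (ruleCount ≤_) (eq⇒≡ {a = symbolKind j s} e) (m≤m+n ruleCount _)))
      go (inj₂ e) = let j′ , _ , e′ = any⇒ tapes e
                        j≡ , s≡ = symbolKind-injective {j} {j′} (eq⇒≡ {a = symbolKind j s} e′)
                    in trans s≡ (cong (symbolAt t p) (sym j≡))

    refute : ∀ {l c} → l ∈ c → value a l ≡ true → Solves a c
    refute l∈ v = _ , l∈ , v

    not-of : ∀ {b} → b ≡ false → not b ≡ true
    not-of refl = refl

    same-state : ∀ {p q} → p ≡ q → sameState p q ≡ true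
    same-state {p} refl = eq-refl (codeOf finState p)

    same-letter : ∀ {s t} → s ≡ t → sameLetter s t ≡ true
    same-letter {s} refl = eq-refl (codeOf finLetter s)

    absurd : ∀ {A : Set} {b} → b ≡ true → b ≡ false → A
    absurd refl ()

    given-rule : ∀ {t i r c} → (i , r) ∈ indexed rules → (false , (t , (0 , i))) ∈ c → (rule h t ≡ r → Solves a c) → Solves a c
    given-rule {t} {i} {r} {c} ir∈ l∈ f = go (true-or-false (a (t , (0 , i))))
      where
      go : a (t , (0 , i)) ≡ true ⊎ a (t , (0 , i)) ≡ false → Solves a c
      go (inj₁ e) = f (rule⁻ {t} {0} ir∈ e)
      go (inj₂ e) = refute l∈ (not-of e)

    given-true : ∀ {v c} → (false , v) ∈ c → (a v ≡ true → Solves a c) → Solves a c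
    given-true {v} {c} l∈ f = go (true-or-false (a v))
      where
      go : a v ≡ true ⊎ a v ≡ false → Solves a c
      go (inj₁ e) = f e
      go (inj₂ e) = refute l∈ (not-of e)

    SolvesAt : ℕ × ℕ → List Pattern → Set
    SolvesAt tp c = Solves a (map (place tp) c)

    rule-elim : ∀ tp (f : ℕ × Rule → Table) → (∀ i r → (i , r) ∈ indexed rules → ∀ {c} → c ∈ f (i , r) → SolvesAt tp c) →
                ∀ {c} → c ∈ perRule f → SolvesAt tp c
    rule-elim tp f h = concatMap-elim (SolvesAt tp) f {indexed rules} λ {(i , r)} ir∈ → h i r ir∈

    tape-elim : ∀ tp (f : Fin k → Table) → (∀ j {c} → c ∈ f j → SolvesAt tp c) → ∀ {c} → c ∈ perTape f → SolvesAt tp c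
    tape-elim tp f h = concatMap-elim (SolvesAt tp) f {tapes} λ {j} _ → h j

    solve-someRule : ∀ t {c} → c ∈ someRule → Solves a (map (place (t , T)) c)
    solve-someRule t (here refl) = solve-∈ (usesRule false (number h t)) (∈-map⁺ (λ ir → usesRule false (proj₁ ir)) (At⇒indexed (numbered h t))) (rule⁺ t 0)

    reads-cell : ∀ t j → lookup (reads (rule h t)) j ≡ symbolAt t (suc T) j
    reads-cell t j = trans (cong (λ ss → lookup ss j) (same-reads h t)) (trans (Vec.lookup-map j current (tapesAt t)) (sym (cell-centre (suc T) (lookup (tapesAt t) j))))

    solve-reading : ∀ t {c} → c ∈ reading → SolvesAt (t , T) c
    solve-reading t = rule-elim (t , T) (λ ir → perTape λ j → concatMap (readingClauses ir j) letters) λ i r ir∈ →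
      tape-elim (t , T) (λ j → concatMap (readingClauses (i , r) j) letters) λ j →
      concatMap-elim (SolvesAt (t , T)) (readingClauses (i , r) j) {letters} λ {s} _ →
      if-elim (SolvesAt (t , T)) (sameLetter s (lookup (reads r) j)) λ differ → given-rule ir∈ (here refl) (finish i r j s differ)
      where
      finish : ∀ i r j s → sameLetter s (lookup (reads r) j) ≡ false → rule h t ≡ r →
               SolvesAt (t , T) (avoidsRule false i ∷ lacksSymbol false 1 j s ∷ [])
      finish i r j s differ refl = given-true (there (here refl)) λ e →
        absurd (same-letter (trans (symbol⁻ {t} {suc T} {j} e) (sym (reads-cell t j)))) differ

    next-source : ∀ t → source (rule h (suc t)) ≡ target (rule h t)
    next-source t = trans (same-source h (suc t)) (cong proj₁ (next h t))

    solve-succession : ∀ t {c} → c ∈ succession → SolvesAt (t , T) c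
    solve-succession t = rule-elim (t , T) (λ ir → perRule (successionClauses ir)) λ i r ir∈ →
      rule-elim (t , T) (successionClauses (i , r)) λ i′ r′ ir′∈ →
      if-elim (SolvesAt (t , T)) (sameState (target r) (source r′)) λ differ → given-rule ir∈ (here refl) (finish i r i′ r′ ir′∈ differ)
      where
      finish : ∀ i r i′ r′ → (i′ , r′) ∈ indexed rules → sameState (target r) (source r′) ≡ false → rule h t ≡ r →
               SolvesAt (t , T) (avoidsRule false i ∷ avoidsRule true i′ ∷ [])
      finish i r i′ r′ ir′∈ differ refl = given-true (there (here refl)) λ e →
        absurd (same-state (trans (sym (next-source t)) (cong source (rule⁻ {suc t} {0} ir′∈ e)))) differ

    symbol-next : ∀ t p j → symbolAt (suc t) (shift (proj₂ (lookup (actions (rule h t)) j)) + p) j ≡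
                            cell (suc T) (write (proj₁ (lookup (actions (rule h t)) j)) (lookup (tapesAt t) j)) (suc p)
    symbol-next t p j = trans (cong (λ c → cell (suc T) (lookup (proj₂ c) j) (shift (proj₂ o) + p)) (next h t))
      (trans (cong (λ tp → cell (suc T) tp (shift (proj₂ o) + p)) (lookup-act (actions (rule h t)) (tapesAt t) j))
        (cell-act (suc T) (proj₁ o) (proj₂ o) (lookup (tapesAt t) j) p))
      where o = lookup (actions (rule h t)) j

    solve-writing : ∀ t {c} → c ∈ writing → SolvesAt (t , T) c
    solve-writing t = rule-elim (t , T) (λ ir → perTape λ j → writingClause ir j ∷ []) λ i r ir∈ →
      tape-elim (t , T) (λ j → writingClause (i , r) j ∷ []) λ j →
      one-elim (SolvesAt (t , T)) (given-rule ir∈ (here refl) (finish i r j))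
      where
      finish : ∀ i r j → rule h t ≡ r → SolvesAt (t , T) (writingClause (i , r) j)
      finish i r j refl = refute (there (here refl)) (subst (λ s → a (suc t , (shift (proj₂ o) + T , symbolKind j s)) ≡ true)
        (trans (symbol-next t T j) (cell-centre (suc T) (write (proj₁ o) (lookup (tapesAt t) j)))) (symbol⁺ (suc t) (shift (proj₂ o) + T) j))
        where o = lookup (actions (rule h t)) j

    solve-moving : ∀ t p {c} → p ≢ T → c ∈ moving → SolvesAt (t , p) c
    solve-moving t p p≢T = rule-elim (t , p) (λ ir → perTape λ j → map (movingClause ir j) letters) λ i r ir∈ →
      tape-elim (t , p) (λ j → map (movingClause (i , r) j) letters) λ j →
      map-elim (SolvesAt (t , p)) (movingClause (i , r) j) {letters} λ {s} _ → given-rule ir∈ (here refl) (finish i r j s)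
      where
      finish : ∀ i r j s → rule h t ≡ r → SolvesAt (t , p) (movingClause (i , r) j s)
      finish i r j s refl = given-true (there (here refl)) λ e → refute (there (there (here refl))) (subst (λ s → a (suc t , (shift (proj₂ o) + p , symbolKind j s)) ≡ true)
        (trans (symbol-next t p j) (trans (cell-write≢ (suc T) (proj₁ o) (lookup (tapesAt t) j) (suc p) (p≢T ∘ suc-injective)) (sym (symbol⁻ {t} {suc p} {j} e))))
        (symbol⁺ (suc t) (shift (proj₂ o) + p) j))
        where o = lookup (actions (rule h t)) j

    solve-beginning : ∀ {c} → c ∈ beginning → SolvesAt (0 , T) c
    solve-beginning = rule-elim (0 , T) beginningClauses λ i r ir∈ →
      if-elim (SolvesAt (0 , T)) (sameState (source r) start) λ differ → given-rule ir∈ (here refl)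
      λ e → absurd (same-state (trans (cong source (sym e)) (trans (same-source h 0) (cong proj₁ (first h))))) differ

    solve-ending : ∀ {c} → c ∈ ending → SolvesAt (T , T) c
    solve-ending = rule-elim (T , T) endingClauses λ i r ir∈ →
      if-elim (SolvesAt (T , T)) (accepting (source r)) λ rejects → given-rule ir∈ (here refl)
      λ e → absurd (trans (cong (accepting ∘ source) (sym e)) (trans (cong accepting (same-source h T)) (accepts h T n≤T))) rejects

    initial-symbol : ∀ p j → symbolAt 0 p j ≡ cell (suc T) (lookup (proj₂ (initial x)) j) p
    initial-symbol p j = cong (λ c → cell (suc T) (lookup (proj₂ c) j) p) (first h)

    solve-blanks : ∀ p {c} → c ∈ blanks → SolvesAt (0 , p) c
    solve-blanks p = map-elim (SolvesAt (0 , p)) blankClause λ {j} _ → refute (here refl) (subst (λ s → a (0 , (p , symbolKind (suc j) s)) ≡ true)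
      (trans (initial-symbol p (suc j)) (trans (cong (λ t → cell (suc T) t p) (Vec.lookup-replicate j emptyTape)) (look-blank (p ℤ.⊖ suc T))))
      (symbol⁺ 0 p (suc j)))

    solve-input : ∀ {c} → c ∈ inputClauses T x → Solves a c
    solve-input = map-elim (Solves a) inputClause λ {(p , b)} pb∈ → refute (here refl) (subst (λ s → a (0 , (p , symbolKind zero s)) ≡ true)
      (trans (initial-symbol p zero) (sym (At-initialCells T x (indexed⇒At (initialCells T x) pb∈)))) (symbol⁺ 0 p zero))

    offCentre-≢ : ∀ {p} → p ∈ offCentre T x → p ≢ T
    offCentre-≢ p∈ refl with ∈-++⁻ (indices T) p∈
    ... | inj₁ p∈′ = <-irrefl refl (indices-< p∈′)
    ... | inj₂ p∈′ with ∈-map⁻ (suc T +_) p∈′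
    ...   | q , _ , e = <-irrefl e (s≤s (m≤m+n T q))

    over : ∀ dom table → (∀ {tp} → tp ∈ dom → ∀ {c} → c ∈ table → SolvesAt tp c) → ∀ {c} → c ∈ instances (dom , table) → Solves a c
    over dom table f = instances-elim (Solves a) {dom} {table} λ tp∈ → f tp∈

    AllSolve : Table → ℕ × ℕ → Set
    AllSolve table tp = ∀ {c} → c ∈ table → SolvesAt tp c

    solve-throughout : ∀ {c} → c ∈ instances (centred T x (throughout T x) , someRule ++ reading) → Solves a c
    solve-throughout = over (centred T x (throughout T x)) (someRule ++ reading) (map-elim (AllSolve (someRule ++ reading)) (_, T) {throughout T x} λ {t} _ →
      ++-elim (SolvesAt (t , T)) someRule (solve-someRule t) (solve-reading t))

    solve-early : ∀ {c} → c ∈ instances (centred T x (early T x) , succession ++ writing) → Solves a c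
    solve-early = over (centred T x (early T x)) (succession ++ writing) (map-elim (AllSolve (succession ++ writing)) (_, T) {early T x} λ {t} _ →
      ++-elim (SolvesAt (t , T)) succession (solve-succession t) (solve-writing t))

    solve-offCentre : ∀ {c} → c ∈ instances (concatMap (λ t → map (t ,_) (offCentre T x)) (early T x) , moving) → Solves a c
    solve-offCentre = over (concatMap (λ t → map (t ,_) (offCentre T x)) (early T x)) moving (concatMap-elim (AllSolve moving) (λ t → map (t ,_) (offCentre T x)) {early T x} λ {t} _ →
      map-elim (AllSolve moving) (t ,_) {offCentre T x} λ {p} p∈ → solve-moving t p (offCentre-≢ p∈))

    solve-family : ∀ {F} → F ∈ families T x → ∀ {c} → c ∈ instances F → Solves a c
    solve-family (here refl)                                         = solve-throughout
    solve-family (there (here refl))                                 = solve-early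
    solve-family (there (there (here refl)))                         = over ((0 , T) ∷ []) beginning (one-elim (AllSolve beginning) solve-beginning)
    solve-family (there (there (there (here refl))))                 = over ((T , T) ∷ []) ending (one-elim (AllSolve ending) solve-ending)
    solve-family (there (there (there (there (here refl)))))         = solve-offCentre
    solve-family (there (there (there (there (there (here refl)))))) = over (map (0 ,_) (indices (width T x))) blanks (map-elim (AllSolve blanks) (0 ,_) {indices (width T x)} λ {p} _ → solve-blanks p)

    solved : ∀ {c} → c ∈ clauses T x → Solves a c
    solved = ++-elim (Solves a) (concatMap instances (families T x))
      (concatMap-elim (Solves a) instances λ F∈ → solve-family F∈) solve-input

  complete : ∀ {n} → n ≤ T → AcceptsIn n x → ∃[ a ] (∀ {c} → c ∈ clauses T x → Solves a c)
  complete n≤T (d , run , acc) = a n≤T (history run acc) , solved n≤T (history run acc)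

-- Numbering the variables and computing the reduction.

pair : ℕ → ℕ → ℕ
pair m n = (m + n) * (m + n) + m

-- A pair of sum s gets a number from s*s to s*s+s, below the square of s+1; so the number
-- determines the sum. The values are polynomial in the arguments, which matters because the numbers
-- of variables are computed in unary.
pair-< : ∀ m n m′ n′ → m + n < m′ + n′ → pair m n < pair m′ n′
pair-< m n m′ n′ lt = ≤-trans (≤-trans (s≤s (m≤m+n (pair m n) (m + n + n)))
  (≤-reflexive (lemma m n))) (≤-trans (*-mono-≤ lt lt) (m≤m+n _ m′))
  where
  lemma : ∀ m n → 1 + ((m + n) * (m + n) + m + (m + n + n)) ≡ (1 + (m + n)) * (1 + (m + n))
  lemma = solve-∀

pair-injective : ∀ m n m′ n′ → pair m n ≡ pair m′ n′ → m ≡ m′ × n ≡ n′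
pair-injective m n m′ n′ eq with <-cmp (m + n) (m′ + n′)
... | tri< s<s′ _ _ = ⊥-elim (<-irrefl eq (pair-< m n m′ n′ s<s′))
... | tri> _ _ s>s′ = ⊥-elim (<-irrefl (sym eq) (pair-< m′ n′ m n s>s′))
... | tri≈ _ s≡s′ _ with +-cancelˡ-≡ ((m + n) * (m + n)) m m′ (trans eq (cong (λ s → s * s + m′) (sym s≡s′)))
...   | refl = refl , +-cancelˡ-≡ m n n′ s≡s′

index : Variable → ℕ
index (t , (p , c)) = pair t (pair p c)

index-injective : ∀ {u v} → index u ≡ index v → u ≡ v
index-injective {t , (p , c)} {t′ , (p′ , c′)} eq =
  let e₁ , e = pair-injective t (pair p c) t′ (pair p′ c′) eq ; e₂ , e₃ = pair-injective p c p′ c′ e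
  in cong₂ _,_ e₁ (cong₂ _,_ e₂ e₃)

numberLiteral : Bool × Variable → Literal
numberLiteral (s , v) = s , index v

numberClause : Clause → List Literal
numberClause = map numberLiteral

module _ (cs : List Clause) where

  Satisfiable⇒Solves : Satisfiable (map numberClause cs) → ∃[ a ] (∀ {c} → c ∈ cs → Solves a c)
  Satisfiable⇒Solves (b , h) = (λ v → b (index v)) , λ c∈ → go (h (∈-map⁺ numberClause c∈))
    where
    go : ∀ {c} → ∃[ l ] (l ∈ numberClause c × holds b l ≡ true) → Solves (λ v → b (index v)) c
    go (_ , l∈ , e) with ∈-map⁻ numberLiteral l∈
    ... | (s , v) , sv∈ , refl = (s , v) , sv∈ , e

  -- Not every number is the index of a variable. The value at a number is found by searching the
  -- variables that occur for one with this index; injectivity of `index` makes the answer agree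
  -- with `a`.
  Solves⇒Satisfiable : ∃[ a ] (∀ {c} → c ∈ cs → Solves a c) → Satisfiable (map numberClause cs)
  Solves⇒Satisfiable (a , h) = b , go
    where
    variables : List Variable
    variables = map proj₂ (concat cs)
    b : ℕ → Bool
    b n = any (λ v → eq (index v) n ∧ a v) variables
    b-index : ∀ {v} → v ∈ variables → b (index v) ≡ a v
    b-index {v} v∈ with true-or-false (a v)
    ... | inj₁ e = trans (⇒any {p = λ u → eq (index u) (index v) ∧ a u} v∈ (∧-intro (eq-refl (index v)) e)) (sym e)
    ... | inj₂ e with true-or-false (b (index v))
    ...   | inj₂ e′ = trans e′ (sym e)
    ...   | inj₁ e′ with any⇒ {p = λ u → eq (index u) (index v) ∧ a u} variables e′
    ...     | u , _ , e″ with index-injective {u} {v} (eq⇒≡ {a = index u} (proj₁ (∧-true {eq (index u) (index v)} e″)))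
    ...       | refl = case trans (sym e) (proj₂ (∧-true {eq (index u) (index u)} e″)) of λ ()
    go : ∀ {c} → c ∈ map numberClause cs → ∃[ l ] (l ∈ c × holds b l ≡ true)
    go c∈ with ∈-map⁻ numberClause c∈
    ... | c , c∈′ , refl with h c∈′
    ...   | (s , v) , sv∈ , e = (s , index v) , ∈-map⁺ numberLiteral sv∈ ,
      trans (cong (λ β → if s then β else not β) (b-index (∈-map⁺ proj₂ (∈-concat⁺′ sv∈ c∈′)))) e

-- The sum of all variable numbers that occur, a crude upper bound for each of them which spares
-- computing a maximum.
total : CNF → ℕ
total cs = length (concatMap (λ l → replicate (proj₂ l) tt) (concat cs))

total-bound : ∀ cs {c l} → c ∈ cs → l ∈ c → proj₂ l < suc (total cs)
total-bound cs {l = l} c∈ l∈ = s≤s (subst (_≤ total cs) (length-replicate (proj₂ l)) (go (concat cs) (∈-concat⁺′ l∈ c∈)))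
  where
  go : ∀ ls → l ∈ ls → length (replicate (proj₂ l) tt) ≤ length (concatMap (λ l → replicate (proj₂ l) tt) ls)
  go (l ∷ ls) (here refl) = ≤-trans (m≤m+n _ _) (≤-reflexive (sym (length-++ (replicate (proj₂ l) tt))))
  go (m ∷ ls) (there l∈)  = ≤-trans (go ls l∈) (≤-trans (m≤n+m _ _) (≤-reflexive (sym (length-++ (replicate (proj₂ m) tt)))))

total′ : PT total
total′ = _∙_ {g = length {A = ⊤}} length′
  (_∙_ {g = λ ls → concatMap (λ l → replicate (proj₂ l) tt) ls} {f = concat}
    (concatMap′ {E = ⊤} (unary′ ∙ snd ∙ snd) ∙ (const′ tt ▵ id′)) concat′)

pair′ : PT (λ (i : ℕ × ℕ) → pair (proj₁ i) (proj₂ i))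
pair′ = (fst +′ snd) *′ (fst +′ snd) +′ fst

index′ : PT index
index′ = pair′ ∙ (fst ▵ pair′ ∙ snd)

numberClause′ : PT numberClause
numberClause′ = map′ {E = ⊤} {f = λ i → numberLiteral (proj₂ i)} (fst ∙ snd ▵ index′ ∙ snd ∙ snd) ∙ (const′ tt ▵ id′)

place′ : PT (λ (i : (ℕ × ℕ) × Pattern) → place (proj₁ i) (proj₂ i))
place′ = fst ∙ snd ▵ (if′ (fst ∙ snd ∙ snd) (suc′ (fst ∙ fst)) (fst ∙ fst) ▵
  (fst ∙ snd ∙ snd ∙ snd ∙ snd +′ if′ (fst ∙ snd ∙ snd ∙ snd) (snd ∙ fst) (const′ 0) ▵ snd ∙ snd ∙ snd ∙ snd ∙ snd))

instances′ : ∀ table → PT (λ dom → instances (dom , table))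
instances′ table = concatMap′ {E = ⊤} {f = λ i → map (λ c → map (place (proj₂ i)) c) table}
  (map′ {E = ℕ × ℕ} {f = λ i → map (place (proj₁ i)) (proj₂ i)} (map′ place′) ∙ (snd ▵ const′ table)) ∙ (const′ tt ▵ id′)

instance
  code-Maybe : ∀ {A} {{_ : Code A}} → Code (Maybe A)
  code-Maybe .enc nothing  = leaf
  code-Maybe .enc (just a) = node (enc a) leaf

  view-Maybe : ∀ {A} {{_ : Code A}} → View (Maybe A) A ⊤
  view-Maybe .view nothing  = nothing
  view-Maybe .view (just a) = just (a , tt)
  view-Maybe .enc-view nothing  = refl
  view-Maybe .enc-view (just a) = refl

initialCells′ : PT (λ (i : ℕ × List Bool) → initialCells (proj₁ i) (proj₂ i))
initialCells′ = replicate′ (suc′ fst) (const′ nothing) ++′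
  (map′ {E = ⊤} {f = λ i → just (proj₂ i)} (recode {f = λ (i : Bool × ⊤) → just (proj₁ i)} (λ _ → refl) ∙ (snd ▵ const′ tt)) ∙ (const′ tt ▵ snd) ++′
   replicate′ (suc′ (suc′ fst)) (const′ nothing))

module Generate (M : Machine) where
  open Tableau M

  inputClause′ : PT inputClause
  inputClause′ = cons′ (const′ true ▵ (const′ 0 ▵ (fst ▵ kind′ ∙ snd))) (const′ [])
    where
    kind : Maybe Bool → ℕ
    kind b = symbolKind zero (cellSymbol b)
    kind′ : PT kind
    kind′ = (λ { nothing → refl ; (just false) → refl ; (just true) → refl }) ≗⇒
      case′ {E = ⊤} (const′ (kind nothing)) (if′ (fst ∙ snd) (const′ (kind (just true))) (const′ (kind (just false)))) ∙ (const′ tt ▵ id′)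

  Source : Set
  Source = ℕ × List Bool

  inputClauses′ : PT (λ (i : Source) → inputClauses (proj₁ i) (proj₂ i))
  inputClauses′ = _∙_ {g = map inputClause} (map′ {E = ⊤} {f = λ i → inputClause (proj₂ i)} (_∙_ {g = inputClause} inputClause′ snd) ∙ (const′ tt ▵ id′))
    (_∙_ {g = indexed} indexed′ initialCells′)

  centred′ : {f : Source → List ℕ} → PT f → PT (λ i → map (_, proj₁ i) (f i))
  centred′ p = map′ {E = ℕ} {f = λ i → proj₂ i , proj₁ i} (snd ▵ fst) ∙ (fst ▵ p)

  offCentre′ : PT (λ (T : ℕ) → indices T ++ map (suc T +_) (indices T))
  offCentre′ = indices′ ++′ map′ {E = ℕ} {f = λ i → suc (proj₁ i) + proj₂ i} (suc′ fst +′ snd) ∙ (id′ ▵ indices′)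

  -- Only the lists of places depend on the input. The tables enter as constants, so each family is
  -- computed by `instances′` from a list of pairs.
  clauses′ : PT (λ (i : Source) → clauses (proj₁ i) (proj₂ i))
  clauses′ =
    (family (someRule ++ reading) (centred′ (_∙_ {g = indices} indices′ (suc′ fst))) ++′
    (family (succession ++ writing) (centred′ (_∙_ {g = indices} indices′ fst)) ++′
    (family beginning (cons′ (const′ 0 ▵ fst) (const′ [])) ++′
    (family ending (cons′ (fst ▵ fst) (const′ [])) ++′
    (family moving (concatMap′ {E = List ℕ} {f = λ i → map (proj₂ i ,_) (proj₁ i)} (map′ {E = ℕ} {f = id} id′ ∙ (snd ▵ fst)) ∙ (offCentre′ ∙ fst ▵ indices′ ∙ fst)) ++′
    (family blanks (map′ {E = ⊤} {f = λ i → 0 , proj₂ i} (const′ 0 ▵ snd) ∙ (const′ tt ▵ indices′ ∙ length′ ∙ initialCells′)) ++′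
    const′ [])))))) ++′ inputClauses′
    where
    family : ∀ table {f : Source → List (ℕ × ℕ)} → PT f → PT (λ i → instances (f i , table))
    family table p = _∙_ {g = λ dom → instances (dom , table)} (instances′ table) p

size-inc : ∀ ds → ⌈ incDigits ds ⌉ ≤ 4 + ⌈ ds ⌉
size-inc []           = ≤ᵇ⇒≤ 3 5 _
size-inc (true ∷ ds)  = ≤-trans (s≤s (s≤s (size-inc ds))) (+-monoʳ-≤ 2 (+-monoʳ-≤ 4 (m≤n+m _ 2)))
size-inc (false ∷ ds) = +-monoʳ-≤ 4 (m≤n+m _ 2)

-- The reduction counts in unary and writes in binary. The conversion is a repeated increment, each
-- of which adds at most 4 to the size.
binary′ : PT fromℕ
binary′ = (λ n → trans (cong undigits (as-digits n)) (undigits-digits (fromℕ n))) ≗⇒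
  undigits′ ∙ foldr′ {E = ⊤} {A = ⊤} {s = λ i → incDigits (proj₂ (proj₂ i))} (_∙_ {g = incDigits} incDigits′ (snd ∙ snd)) (con 4 ⊗ var) bound ∙
  (const′ tt ▵ const′ [] ▵ unary′)
  where
  as-digits : ∀ n → foldr (λ _ → incDigits) [] (replicate n tt) ≡ digits (fromℕ n)
  as-digits zero    = refl
  as-digits (suc n) = trans (cong incDigits (as-digits n)) (sym (trans (cong digits (fromℕ-suc n)) (digits-suc (fromℕ n))))
  go : ∀ z (xs : List ⊤) → ⌈ foldr (λ _ → incDigits) z xs ⌉ ≤ 4 * ⌈ xs ⌉ + ⌈ z ⌉
  go z []       = m≤n+m _ 4
  go z (x ∷ xs) = ≤-trans (size-inc (foldr (λ _ → incDigits) z xs)) (≤-trans (+-monoʳ-≤ 4 (go z xs))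
    (≤-trans (m≤n+m _ 4) (≤-reflexive (lemma ⌈ xs ⌉ ⌈ z ⌉))))
    where
    lemma : ∀ s z → 4 + (4 + (4 * s + z)) ≡ 4 * (2 + s) + z
    lemma = solve-∀
  bound : ∀ (e : ⊤) (z : List Bool) (xs : List ⊤) → ⌈ foldr (λ _ → incDigits) z xs ⌉ ≤ 4 * ⌈ e , z , xs ⌉
  bound e z xs = ≤-trans (go z xs) (≤-trans (m≤m+n _ (12 + 3 * ⌈ z ⌉)) (≤-reflexive (lemma ⌈ xs ⌉ ⌈ z ⌉)))
    where
    lemma : ∀ s z → 4 * s + z + (12 + 3 * z) ≡ 4 * (3 + (z + s))
    lemma = solve-∀

pos′ : PT pos
pos′ = (λ n → unsigned-signed (pos n)) ≗⇒ unsigned′ ∙ (const′ false ▵ digits′ ∙ binary′)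

guesses′ : PT guesses
guesses′ = as-guesses ≗⇒ concatMap′ {E = ⊤} {A = ⊤} (const′ (guess₁ ∷ guess₂ ∷ [])) ∙ (const′ tt ▵ unary′)
  where
  as-guesses : ∀ n → concatMap (λ _ → guess₁ ∷ guess₂ ∷ []) (replicate n tt) ≡ guesses n
  as-guesses zero    = refl
  as-guesses (suc n) = cong (λ l → guess₁ ∷ guess₂ ∷ l) (as-guesses n)

use′ : PT use
use′ = (λ { false → refl ; true → refl }) ≗⇒ if′ id′ (const′ 1) (const′ 0)

-- A right fold meets the last element first, and recognises it by the fact that no rows have been
-- produced yet.
tokenStep : Bool → List (Colour × Colour) → List (Colour × Colour)
tokenStep o rs = (use o , (if null rs then token true else use false)) ∷ rs

tokenRows′ : PT tokenRows
tokenRows′ = as-tokenRows ≗⇒ foldr′ {E = ⊤} {s = λ i → tokenStep (proj₁ (proj₂ i)) (proj₂ (proj₂ i))}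
  (cons′ (_∙_ {g = use} use′ (fst ∙ snd) ▵ if′ (null′ ∙ snd ∙ snd) (const′ (token true)) (const′ (use false))) (snd ∙ snd)) (con 12 ⊗ var) bound ∙
  (const′ tt ▵ const′ [] ▵ id′)
  where
  as-tokenRows : ∀ os → foldr tokenStep [] os ≡ tokenRows os
  as-tokenRows []           = refl
  as-tokenRows (o ∷ [])     = refl
  as-tokenRows (o ∷ p ∷ os) = trans (cong (tokenStep o) (as-tokenRows (p ∷ os)))
    (cong (λ b → (use o , (if b then token true else use false)) ∷ tokenRows (p ∷ os)) (nonempty os))
    where
    nonempty : ∀ os → null (tokenRows (p ∷ os)) ≡ false
    nonempty []       = refl
    nonempty (q ∷ os) = refl
  size-step : ∀ o rs → ⌈ tokenStep o rs ⌉ ≤ 12 + ⌈ rs ⌉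
  size-step o rs = s≤s (+-monoˡ-≤ ⌈ rs ⌉ (s≤s (+-mono-≤ (size-use o) (size-end (null rs)))))
    where
    size-use : ∀ o → ⌈ use o ⌉ ≤ 3
    size-use false = s≤s z≤n
    size-use true  = ≤-refl
    size-end : ∀ b → ⌈ (if b then token true else use false) ⌉ ≤ 7
    size-end false = s≤s z≤n
    size-end true  = ≤-refl
  go : ∀ z os → ⌈ foldr tokenStep z os ⌉ ≤ 12 * ⌈ os ⌉ + ⌈ z ⌉
  go z []       = m≤n+m _ 12
  go z (o ∷ os) = ≤-trans (size-step o (foldr tokenStep z os)) (≤-trans (+-monoʳ-≤ 12 (go z os))
    (≤-trans (m≤m+n _ (12 * ⌈ o ⌉)) (≤-reflexive (lemma ⌈ o ⌉ ⌈ os ⌉ ⌈ z ⌉))))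
    where
    lemma : ∀ o s z → 12 + (12 * s + z) + 12 * o ≡ 12 * (1 + (o + s)) + z
    lemma = solve-∀
  bound : ∀ (e : ⊤) (z : List (Colour × Colour)) (os : List Bool) → ⌈ foldr tokenStep z os ⌉ ≤ 12 * ⌈ e , z , os ⌉
  bound e z os = ≤-trans (go z os) (≤-trans (m≤m+n _ (36 + 11 * ⌈ z ⌉)) (≤-reflexive (lemma ⌈ os ⌉ ⌈ z ⌉)))
    where
    lemma : ∀ s z → 12 * s + z + (36 + 11 * z) ≡ 12 * (3 + (z + s))
    lemma = solve-∀

clauseRows′ : PT clauseRows
clauseRows′ = cons′ (const′ (token false , use false)) tokenRows′

choicesUpTo′ : PT (λ (i : ℕ × List Literal) → choicesUpTo (proj₁ i) (proj₂ i))
choicesUpTo′ = concatMap′ {E = List Literal} {f = λ i → choices (proj₁ i) (proj₂ i)}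
  (cons′ (elem′ ∙ ((const′ true ▵ snd) ▵ fst)) (cons′ (elem′ ∙ ((const′ false ▵ snd) ▵ fst)) (const′ []))) ∙ (snd ▵ indices′ ∙ fst)

formula′ : PT (λ (i : ℕ × CNF) → formula (proj₁ i) (proj₂ i))
formula′ = cons′ (const′ (use false , use false)) (clausesRows′ ∙ map′ choicesUpTo′ ++′ const′ ((sinking , sinking) ∷ []))
  where
  clausesRows′ : PT clausesRows
  clausesRows′ = concatMap′ {E = ⊤} {f = λ i → clauseRows (proj₂ i)} (_∙_ {g = clauseRows} clauseRows′ snd) ∙ (const′ tt ▵ id′)

grid′ : PT (λ (i : ℕ × ℕ) → grid (proj₁ i) (proj₂ i))
grid′ = concatMap′ {E = ℕ} {f = λ i → map (λ j → pos (proj₂ i) , pos j) (indices (proj₁ i))}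
  (map′ {E = ℕ} {f = λ i → pos (proj₁ i) , pos (proj₂ i)} (pos′ ∙ fst ▵ pos′ ∙ snd) ∙ (snd ▵ indices′ ∙ fst)) ∙ (snd ▵ indices′ ∙ fst)

southBorder′ : PT (λ (i : ℕ × List Colour) → southBorder (proj₁ i) (proj₂ i))
southBorder′ = map′ {E = ℕ} {f = λ i → ((pos (proj₁ (proj₂ i)) , pos 0) , south) , proj₂ (proj₂ i)}
  (((pos′ ∙ fst ∙ snd ▵ const′ (pos 0)) ▵ const′ south) ▵ snd ∙ snd) ∙ (fst ▵ indexed′ ∙ snd)

northBorder′ : PT (λ (i : ℕ × List Colour) → northBorder (proj₁ i) (proj₂ i))
northBorder′ = map′ {E = ℕ} {f = λ i → ((pos (proj₁ (proj₂ i)) , pos (pred (proj₁ i))) , north) , proj₂ (proj₂ i)}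
  (((pos′ ∙ fst ∙ snd ▵ pos′ ∙ pred′ ∙ fst) ▵ const′ north) ▵ snd ∙ snd) ∙ (fst ▵ indexed′ ∙ snd)

westBorder′ : PT (λ (i : ℕ × List (Colour × Colour)) → westBorder (proj₁ i) (proj₂ i))
westBorder′ = map′ {E = ℕ} {f = λ i → ((pos 0 , pos (proj₁ (proj₂ i))) , west) , proj₁ (proj₂ (proj₂ i))}
  (((const′ (pos 0) ▵ pos′ ∙ fst ∙ snd) ▵ const′ west) ▵ fst ∙ snd ∙ snd) ∙ (fst ▵ indexed′ ∙ snd)

eastBorder′ : PT (λ (i : ℕ × List (Colour × Colour)) → eastBorder (proj₁ i) (proj₂ i))
eastBorder′ = map′ {E = ℕ} {f = λ i → ((pos (pred (proj₁ i)) , pos (proj₁ (proj₂ i))) , east) , proj₂ (proj₂ (proj₂ i))}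
  (((pos′ ∙ pred′ ∙ fst ▵ pos′ ∙ fst ∙ snd) ▵ const′ east) ▵ snd ∙ snd ∙ snd) ∙ (fst ▵ indexed′ ∙ snd)

Rectangular : Set
Rectangular = List Colour × (List (Colour × Colour) × List Colour)

rectangle′ : PT (λ (i : Rectangular) → rectangle (proj₁ i) (proj₁ (proj₂ i)) (proj₂ (proj₂ i)))
rectangle′ = grid′ ∙ (len ▵ hei) ▵
  (southBorder′ ∙ (hei ▵ fst) ++′ northBorder′ ∙ (hei ▵ snd ∙ snd) ++′ westBorder′ ∙ (len ▵ fst ∙ snd) ++′ eastBorder′ ∙ (len ▵ fst ∙ snd))
  where
  len : PT (λ (i : Rectangular) → length (proj₁ i))
  len = length′ ∙ fst
  hei : PT (λ (i : Rectangular) → length (proj₁ (proj₂ i)))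
  hei = length′ ∙ fst ∙ snd

picture′ : PT picture
picture′ = rectangle′ ∙ (guesses′ ∙ fst ▵ (formula′ ▵ replicate′ (fst +′ fst) (const′ sink)))

toBinary : List Square × List (Segment × Colour) → BinaryRegion
toBinary (squares , boundary) = squares , map (λ (s , c) → s , fromℕ c) boundary

toBinary′ : PT toBinary
toBinary′ = fst ▵ map′ {E = ⊤} {f = λ i → proj₁ (proj₂ i) , fromℕ (proj₂ (proj₂ i))} (fst ∙ snd ▵ binary′ ∙ snd ∙ snd) ∙ (const′ tt ▵ snd)

encodePicture : ℕ × CNF → List Bool
encodePicture i = encodeRegion (asRegion (picture i))

encodePicture′ : PT encodePicture
encodePicture′ = (λ i → cong encodeRegion (to-from-binary (picture i))) ≗⇒
  _∙_ {g = λ D → encodeRegion (toRegion D)} encodeRegion′ (_∙_ {g = toBinary} {f = picture} toBinary′ picture′)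
  where
  to-from-binary : ∀ D → toRegion (toBinary D) ≡ asRegion D
  to-from-binary (squares , boundary) = cong (region squares)
    (trans (sym (map-∘ boundary)) (trans (map-cong (λ (s , c) → cong (s ,_) (Bin.toℕ-fromℕ c)) boundary) (map-id boundary)))

eval′ : ∀ p → PT (eval p)
eval′ []      = const′ 0
eval′ (a ∷ p) = const′ a +′ id′ *′ eval′ p

module Reduction (M : Machine) (p : Polynomial) where
  open Machine M
  open Tableau M

  time : List Bool → ℕ
  time x = eval p (length x)

  cnf : List Bool → CNF
  cnf x = map numberClause (clauses (time x) x)

  cnf′ : PT cnf
  cnf′ = _∙_ {g = map numberClause} (map′ {E = ⊤} {f = λ i → numberClause (proj₂ i)} (_∙_ {g = numberClause} numberClause′ snd) ∙ (const′ tt ▵ id′))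
    (_∙_ {g = λ i → clauses (proj₁ i) (proj₂ i)} {f = λ x → time x , x} (Generate.clauses′ M) (_∙_ {g = eval p} (eval′ p) length′ ▵ id′))

  reduction : List Bool → List Bool
  -- The successor makes the number of variables exceed every index that occurs, and it leaves the
  -- token a first column even if the total is 0.
  reduction x = encodePicture (suc (total (cnf x)) , cnf x)

  reduction′ : PT reduction
  reduction′ = _∙_ {g = encodePicture} {f = λ x → suc (total (cnf x)) , cnf x} encodePicture′ (suc′ (_∙_ {g = total} {f = cnf} total′ cnf′) ▵ cnf′)

  accepting⇒tiling : ∀ x → (∃[ t ] (t ≤ time x × AcceptsIn t x)) → TilingProblem W (reduction x)
  accepting⇒tiling x (t , t≤ , acc) = Equivalence.to (Satisfiable⇔Tiling (total (cnf x)) (cnf x) (total-bound (cnf x)))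
    (Solves⇒Satisfiable (clauses (time x) x) (Complete.complete M (time x) x t≤ acc))

  -- The clauses yield an accepting run of some length. That is enough, since the machine for `K`
  -- accepts no word outside `K` in any number of steps.
  tiling⇒accepting : ∀ x → TilingProblem W (reduction x) → ∃[ t ] AcceptsIn t x
  tiling⇒accepting x tiling =
    let a , solves = Satisfiable⇒Solves (clauses (time x) x)
          (Equivalence.from (Satisfiable⇔Tiling (total (cnf x)) (cnf x) (total-bound (cnf x))) tiling)
    in Correct.Sound.accepted M (time x) x a solves

TilingProblem-NPHard : NPHard (TilingProblem W)
TilingProblem-NPHard K (M , accepted⇒K , p , K⇒accepted) =
  reduction , PT⇒PolyTime reduction′ , λ x → mk⇔
    (λ Kx → accepting⇒tiling x (K⇒accepted x Kx))
    (λ tiling → let t , acc = tiling⇒accepting x tiling in accepted⇒K x t acc)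
  where open Reduction M p

theorem3 : Σ (List Tile) λ W → Unique W × length W ≡ 23 × NPComplete (TilingProblem W)
theorem3 = W , W-unique , refl , TilingProblem-NP W , TilingProblem-NPHard
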